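{- Let $\approx$ be a natural equinumerosity on $\mathbb W$ and let $\mathfrak I$ be the gauge ideal of $\mathcal R$ with $X\approx Y\iff S_X-S_Y\in\mathfrak I$ for all $X,Y\in\mathbb W$. Then $\mathbb L$ is a counting set suitable for $\mathfrak I$, and there exists a unique gauge ultrafilter $\mathcal U$ on $\mathbb N^{<\omega}$ suitable for $\mathbb L$ such that for all $X,Y\in\mathbb W$ $$X\approx Y\iff\{F\in\mathbb N^{<\omega}: S_X(\mathbf x_F)=S_Y(\mathbf x_F)\}\in\mathcal U.\qquad(\ast)$$ Hence the counting map $\Phi$ induces an ordered semiring isomorphism between the set of numerosities $\mathbb W/\approx$ and the ultrapower $\mathbb N^{\mathbb N^{<\omega}}/\mathcal U$. Conversely, for an ultrafilter $\mathcal U$ on $\mathbb N^{<\omega}$, condition $(\ast)$ defines a natural equinumerosity on $\mathbb W$ if and only if $\mathcal U$ is gauge.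
   Context: Let $\mathbb N=\{0,1,2,\dots\}$, $\mathbb N^{<\omega}$ the set of finite subsets of $\mathbb N$. Let $\mathbb{W}$ be the family of finitary point sets: sets $A\subseteq\bigcup_{k\ge1}\mathbb N^k$ of finite tuples of natural numbers (tuples of different lengths allowed) such that for every $n$ there is $h$ with $A\cap\{0,\dots,n\}^k=\emptyset$ for all $k>h$. Cartesian products are identified with concatenations: $A\times B=\{(a_1,\dots,a_k,b_1,\dots,b_h):(a_1,\dots,a_k)\in A,(b_1,\dots,b_h)\in B\}$; $\{n\}$ is the set whose only element is the 1-tuple $(n)$. $A,B\in\mathbb W$ are multipliable if distinct pairs $(a,b)\in A\times B$ have distinct concatenations. Given an equivalence relation $\approx$ on $\mathbb W$, $A\succ B$ (equivalently $B\prec A$) means there exist $A',B'\in\mathbb W$ with $B'\subsetneq A'$, $A\approx A'$, $B\approx B'$. An equinumerosity is an equivalence relation on $\mathbb W$ such that for all $A,B\in\mathbb W$: (AP) $A\approx B$ iff $A\setminus B\approx B\setminus A$; (ZP) exactly one of $A\approx B$, $A\succ B$, $A\prec B$ holds; (TP) if $T$ is injective on $A$ and $T(a)$ is a permutation of the coordinates of $a$ for every $a\in A$, then $A\approx T[A]$; (UP) $A\times\{n\}\approx A$ for all $n$; (PP) if $A,B$ are multipliable, $A',B'$ are multipliable, $A\approx A'$, $B\approx B'$, then $A\times B\approx A'\times B'$. It is natural if whenever $T$ is injective on $X\in\mathbb W$ and the set of components of $T(x)$ equals that of $x$ for every $x\in X$, then $X\approx T[X]$. Series: indeterminates $t_0,t_1,\dots$;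 $\mathbf A$ the eventually zero sequences $\mathbf a$ of non-negative integers; $t^{\mathbf a}=\prod_it_i^{a_i}$; $\mathcal R$ is the ring of formal series $S=\sum n_{\mathbf a}t^{\mathbf a}$ ($n_{\mathbf a}\in\mathbb Z$) for which there are $d_n\in\mathbb N$ with $n_{\mathbf a}=0$ whenever $a_n>d_n$ for some $n$, and $b\in\mathbb N$ with $|n_{\mathbf a}|\le b(\sum_ia_i)!/\prod_ia_i!$. $\mathcal R^+$: nonzero series of $\mathcal R$ with all coefficients non-negative. $\mathfrak I_0$: ideal generated by $\{t_n-1\}$. For a tuple $x=(x_1,\dots,x_d)$, $t_x=t^{\mathbf a}$ with $a_i=|\{j:x_j=i\}|$; $S_X=\sum_{x\in X}t_x$, $S_\emptyset=0$. A gauge ideal is an ideal $\mathfrak I\supseteq\mathfrak I_0$ of $\mathcal R$ with $\mathcal R^+\cap\mathfrak I=\emptyset$ such that for every $S\in\mathcal R\setminus\mathfrak I$ there is $P\in\mathcal R^+$ with $S+P\in\mathfrak I$ or $S-P\in\mathfrak I$. $S(\mathbf x)$ is the value of $S$ when $x_n$ is assigned to $t_n$. For $F\in\mathbb N^{<\omega}$, $\mathbf x_F$ is the $0$-$1$ sequence with $\mathbf x_F(n)=1$ iff $n\in F$; $\mathbb L=\{\mathbf x_F:F\in\mathbb N^{<\omega}\}$, identified with $\mathbb N^{<\omega}$; $\Phi:\mathcal R\to\mathbb Z^{\mathbb L}$, $\Phi(S)=\langle S(\mathbf x_F)\rangle_F$. A set $\mathbb I$ of non-negative real sequences is a counting set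 if each $\mathbb I_k=\{\mathbf i\in\mathbb I:i_0=\dots=i_k=1\}$ is nonempty; it is suitable for an ideal $\mathfrak I$ if for all $S\in\mathfrak I$ and $k$ there is $\mathbf i\in\mathbb I_k$ with $S(\mathbf i)=0$; an ultrafilter on $\mathbb I$ is suitable for $\mathbb I$ if it contains every $\mathbb I_k$. An ultrafilter $\mathcal U$ on $\mathbb N^{<\omega}$ is fine if it contains every set $\{F:n\in F\}$, $n\in\mathbb N$; it is gauge if it is fine and for every $f:\mathbb N^{<\omega}\to\mathbb Z$ the function $f^2$ is $\mathcal U$-equivalent to some $g:\mathbb N^{<\omega}\to\mathbb Z$ with $\sum_{E\subseteq F}(-1)^{|F\setminus E|}g(E)\ge0$ for all $F\in\mathbb N^{<\omega}$. -}

module Defs where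

open import Algebra.Bundles.Raw using (RawSemiring)
open import Algebra.Morphism.Structures using (module SemiringMorphisms)
open import Data.Bool using (Bool; true; false; not; _∧_; _∨_; if_then_else_)
open import Data.Bool.ListAction using (all; any)
open import Data.Bool.Properties using (¬-not)
open import Data.Empty using (⊥)
open import Data.Unit using (⊤; tt)
open import Data.Nat
open import Data.Nat.ListAction using (sum; product)
open import Data.Nat.Properties
open import Data.Integer as ℤ using (ℤ; 0ℤ; 1ℤ; -1ℤ; ∣_∣)
import Data.Integer.Properties as ℤ
open import Data.List
  using (List; []; _∷_; _++_; length; map; filter; foldr; take; drop; upTo;
         cartesianProductWith)
open import Data.List.Properties using (≡-dec; length-++; take++drop≡id)
open import Data.List.Relation.Unary.All as All using (All; []; _∷_)
import Data.List.Relation.Unary.All.Properties as All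
open import Data.List.Relation.Unary.Any using (here; there)
open import Data.List.Relation.Unary.AllPairs using (AllPairs; []; _∷_)
import Data.List.Relation.Unary.AllPairs.Properties as AllPairs
open import Data.List.Membership.Propositional using (_∈_)
import Data.List.Membership.DecPropositional as DecMembership
open import Data.List.Relation.Binary.Permutation.Propositional using (_↭_)
open import Data.Product using (∃₂; Σ-syntax; ∃-syntax; _×_; _,_; proj₁; proj₂)
open import Data.Sum using (_⊎_; inj₁; inj₂; [_,_]′)
open import Function.Base using (_∘_; const)
open import Function.Bundles using (_⇔_)
open import Level using (0ℓ)
open import Relation.Binary.Core using (Rel)
open import Relation.Binary.Structures using (IsEquivalence)
open import Relation.Binary.PropositionalEquality
  using (_≡_; refl; sym; trans; cong; cong₂; subst)
open import Relation.Nullary using (¬_; Dec; yes; no; does; ¬?; contradiction)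
open import Relation.Nullary.Decidable using (map′; dec-false)
open import Relation.Unary using (Pred)

------------------------------------------------------------------------
-- Subsets

-- A subset is given by its characteristic function; under excluded middle
-- every Set-valued predicate has one.  Equality of subsets is pointwise.

Subset : Set → Set
Subset I = I → Bool

infix 4 _∈ˢ_ _⊆ˢ_

_∈ˢ_ : {I : Set} → I → Subset I → Set
i ∈ˢ A = A i ≡ true

_⊆ˢ_ : {I : Set} → Subset I → Subset I → Set
A ⊆ˢ B = ∀ i → i ∈ˢ A → i ∈ˢ B

record IsUltrafilter {I : Set} (𝒰 : Pred (Subset I) 0ℓ) : Set where
  field
    upward   : ∀ {A B} → A ⊆ˢ B → 𝒰 A → 𝒰 B
    ∩-closed : ∀ {A B} → 𝒰 A → 𝒰 B → 𝒰 (λ i → A i ∧ B i)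
    whole    : 𝒰 (const true)
    proper   : ¬ 𝒰 (const false)
    ultra    : ∀ A → 𝒰 A ⊎ 𝒰 (not ∘ A)

------------------------------------------------------------------------
-- Finitary point sets

-- A set of tuples of length ≥ 1 is a set of lists not containing [].

Tuple : Set
Tuple = List ℕ

record 𝕎 : Set where
  field
    mem      : Subset Tuple
    no-[]    : ¬ ([] ∈ˢ mem)
    finitary : ∀ n → ∃[ h ] (∀ x → length x > h → All (_≤ n) x → ¬ (x ∈ˢ mem))

open 𝕎 public using (mem)

infix 4 _∈ʷ_ _⊆ʷ_ _⊊_

_∈ʷ_ : Tuple → 𝕎 → Set
x ∈ʷ A = x ∈ˢ mem A

_⊆ʷ_ : 𝕎 → 𝕎 → Set
A ⊆ʷ B = mem A ⊆ˢ mem B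

_⊊_ : 𝕎 → 𝕎 → Set
A ⊊ B = A ⊆ʷ B × ¬ (B ⊆ʷ A)

Disjoint : 𝕎 → 𝕎 → Set
Disjoint A B = ∀ x → x ∈ʷ A → ¬ (x ∈ʷ B)

∧-true : ∀ {b c} → b ∧ c ≡ true → b ≡ true × c ≡ true
∧-true {true} {true} _ = refl , refl

∨-true : ∀ {b c} → b ∨ c ≡ true → b ≡ true ⊎ c ≡ true
∨-true {true}  p = inj₁ refl
∨-true {false} p = inj₂ p

any-true : ∀ {I : Set} (p : I → Bool) xs → any p xs ≡ true → ∃[ i ] (p i ≡ true)
any-true p (x ∷ xs) e with ∨-true e
... | inj₁ q = x , q
... | inj₂ q = any-true p xs q

split-sum : ∀ {i j h k} → h + k < i + j → h < i ⊎ k < j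
split-sum {i} {j} {h} {k} lt with h <? i
... | yes p = inj₁ p
... | no ¬p with k <? j
...   | yes q = inj₂ q
...   | no ¬q = contradiction lt (≤⇒≯ (+-mono-≤ (≮⇒≥ ¬p) (≮⇒≥ ¬q)))

∅ : 𝕎
∅ = record
  { mem      = const false
  ; no-[]    = λ ()
  ; finitary = λ _ → 0 , λ _ _ _ ()
  }

｛_｝ : ℕ → 𝕎
｛ n ｝ = record
  { mem      = λ x → does (≡-dec _≟_ x (n ∷ []))
  ; no-[]    = λ ()
  ; finitary = λ _ → 1 , λ x l _ e → long x l (holds x e)
  }
  where
  holds : ∀ x → does (≡-dec _≟_ x (n ∷ [])) ≡ true → x ≡ n ∷ []
  holds x e with ≡-dec _≟_ x (n ∷ [])
  ... | yes p = p
  holds x () | no _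
  long : ∀ x → length x > 1 → ¬ (x ≡ n ∷ [])
  long _ (s≤s ()) refl

infixl 7 _×ʷ_
infixl 6 _∖ʷ_ _∪_

_∖ʷ_ : 𝕎 → 𝕎 → 𝕎
A ∖ʷ B = record
  { mem      = λ x → mem A x ∧ not (mem B x)
  ; no-[]    = λ e → 𝕎.no-[] A (proj₁ (∧-true e))
  ; finitary = λ n → proj₁ (𝕎.finitary A n) ,
      λ x l b e → proj₂ (𝕎.finitary A n) x l b (proj₁ (∧-true e))
  }

_∪_ : 𝕎 → 𝕎 → 𝕎
A ∪ B = record
  { mem      = λ x → mem A x ∨ mem B x
  ; no-[]    = λ e → [ 𝕎.no-[] A , 𝕎.no-[] B ]′ (∨-true e)
  ; finitary = λ n → let h , p = 𝕎.finitary A n ; k , q = 𝕎.finitary B n in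
      h + k , λ x l b e → [ p x (≤-<-trans (m≤m+n h k) l) b
                          , q x (≤-<-trans (m≤n+m k h) l) b ]′ (∨-true e)
  }

-- The Cartesian product, identified with the set of concatenations.

cut : 𝕎 → 𝕎 → Tuple → ℕ → Bool
cut A B x k = mem A (take k x) ∧ mem B (drop k x)

_×ʷ_ : 𝕎 → 𝕎 → 𝕎
A ×ʷ B = record
  { mem      = λ x → any (cut A B x) (upTo (suc (length x)))
  ; no-[]    = λ e → let k , c = any-true (cut A B []) (upTo 1) e in
      𝕎.no-[] A (subst (_∈ʷ A) (take-[] k) (proj₁ (∧-true c)))
  ; finitary = λ n → let h , p = 𝕎.finitary A n ; k , q = 𝕎.finitary B n in
      h + k , λ x l b e →
        let i , c   = any-true (cut A B x) (upTo (suc (length x))) e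
            cA , cB = ∧-true c
            len     = trans (cong length (sym (take++drop≡id i x)))
                            (length-++ (take i x))
        in [ (λ l′ → p (take i x) l′ (All.take⁺ i b) cA)
           , (λ l′ → q (drop i x) l′ (All.drop⁺ i b) cB)
           ]′ (split-sum (subst (h + k <_) len l))
  }
  where
  take-[] : ∀ k → take {A = ℕ} k [] ≡ []
  take-[] zero    = refl
  take-[] (suc k) = refl

Multipliable : 𝕎 → 𝕎 → Set
Multipliable A B = ∀ {a a′ b b′} → a ∈ʷ A → a′ ∈ʷ A → b ∈ʷ B → b′ ∈ʷ B →
                   a ++ b ≡ a′ ++ b′ → (a , b) ≡ (a′ , b′)

InjectiveOn : 𝕎 → (Tuple → Tuple) → Set
InjectiveOn A τ = ∀ {a b} → a ∈ʷ A → b ∈ʷ A → τ a ≡ τ b → a ≡ b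

-- B = τ[A].  For the maps occurring in TP and in naturality the image of a
-- finitary set is again finitary, so asking for a B in 𝕎 loses nothing.

IsImage : (Tuple → Tuple) → 𝕎 → 𝕎 → Set
IsImage τ A B = ∀ y → y ∈ʷ B ⇔ (∃[ x ] (x ∈ʷ A × τ x ≡ y))

module _ (_≈_ : Rel 𝕎 0ℓ) where

  Succ : 𝕎 → 𝕎 → Set
  Succ A B = ∃₂ λ A′ B′ → B′ ⊊ A′ × A ≈ A′ × B ≈ B′

  Prec : 𝕎 → 𝕎 → Set
  Prec A B = Succ B A

  record IsEquinumerosity : Set where
    field
      isEquivalence : IsEquivalence _≈_
      AP : ∀ A B → A ≈ B ⇔ (A ∖ʷ B) ≈ (B ∖ʷ A)
      ZP : ∀ A B → (A ≈ B     × ¬ Succ A B   × ¬ Prec A B)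
                 ⊎ (¬ (A ≈ B) × Succ A B     × ¬ Prec A B)
                 ⊎ (¬ (A ≈ B) × ¬ Succ A B   × Prec A B)
      TP : ∀ A B τ → InjectiveOn A τ → (∀ a → a ∈ʷ A → τ a ↭ a) →
           IsImage τ A B → A ≈ B
      UP : ∀ A n → (A ×ʷ ｛ n ｝) ≈ A
      PP : ∀ {A B A′ B′} → Multipliable A B → Multipliable A′ B′ →
           A ≈ A′ → B ≈ B′ → (A ×ʷ B) ≈ (A′ ×ʷ B′)

  record IsNaturalEquinumerosity : Set where
    field
      isEquinumerosity : IsEquinumerosity
      natural : ∀ X Y τ → InjectiveOn X τ →
                (∀ x → x ∈ʷ X → ∀ i → i ∈ τ x ⇔ i ∈ x) →
                IsImage τ X Y → X ≈ Y

------------------------------------------------------------------------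
-- Exponents

Trimmed : List ℕ → Set
Trimmed []           = ⊤
Trimmed (zero ∷ [])  = ⊥
Trimmed (suc _ ∷ []) = ⊤
Trimmed (_ ∷ m ∷ a)  = Trimmed (m ∷ a)

-- Eventually zero sequences, as lists without trailing zeros.

record 𝐀 : Set where
  constructor exponent
  field
    entries  : List ℕ
    .trimmed : Trimmed entries

open 𝐀 public using (entries)

entry : List ℕ → ℕ → ℕ
entry []      _       = 0
entry (m ∷ _) zero    = m
entry (_ ∷ a) (suc n) = entry a n

width : 𝐀 → ℕ
width a = length (entries a)

degree : 𝐀 → ℕ
degree a = sum (entries a)

_≟ᴬ_ : (a b : 𝐀) → Dec (a ≡ b)
exponent a p ≟ᴬ exponent b q = map′ (λ { refl → refl }) (cong entries) (≡-dec _≟_ a b)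

infixr 5 _∷ᵗ_

_∷ᵗ_ : ℕ → List ℕ → List ℕ
zero  ∷ᵗ []      = []
suc n ∷ᵗ []      = suc n ∷ []
n     ∷ᵗ (m ∷ a) = n ∷ m ∷ a

trim : List ℕ → List ℕ
trim = foldr _∷ᵗ_ []

∷ᵗ-trimmed : ∀ n a → Trimmed a → Trimmed (n ∷ᵗ a)
∷ᵗ-trimmed zero    []      p = tt
∷ᵗ-trimmed (suc n) []      p = tt
∷ᵗ-trimmed zero    (m ∷ a) p = p
∷ᵗ-trimmed (suc n) (m ∷ a) p = p

trim-trimmed : ∀ a → Trimmed (trim a)
trim-trimmed []      = tt
trim-trimmed (n ∷ a) = ∷ᵗ-trimmed n (trim a) (trim-trimmed a)

⟦_⟧ : List ℕ → 𝐀
⟦ a ⟧ = exponent (trim a) (trim-trimmed a)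

length-∷ᵗ : ∀ n a → length (n ∷ᵗ a) ≤ suc (length a)
length-∷ᵗ zero    []      = z≤n
length-∷ᵗ (suc n) []      = ≤-refl
length-∷ᵗ zero    (m ∷ a) = ≤-refl
length-∷ᵗ (suc n) (m ∷ a) = ≤-refl

length-trim : ∀ a → length (trim a) ≤ length a
length-trim []      = z≤n
length-trim (n ∷ a) = ≤-trans (length-∷ᵗ n (trim a)) (s≤s (length-trim a))

sum-∷ᵗ : ∀ n a → sum (n ∷ᵗ a) ≡ n + sum a
sum-∷ᵗ zero    []      = refl
sum-∷ᵗ (suc n) []      = refl
sum-∷ᵗ zero    (m ∷ a) = refl
sum-∷ᵗ (suc n) (m ∷ a) = refl

sum-trim : ∀ a → sum (trim a) ≡ sum a
sum-trim []      = refl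
sum-trim (n ∷ a) = trans (sum-∷ᵗ n (trim a)) (cong (n +_) (sum-trim a))

------------------------------------------------------------------------
-- Formal series

-- Formal series over ℤ with finitely many nonzero terms in t₀,…,tₙ₋₁ for
-- each n: those whose value at every eventually zero point is a finite sum.
-- They include both the members of ℛ (bounded degree in each indeterminate)
-- and S_X for every X in 𝕎.

record Series : Set where
  field
    coeff    : 𝐀 → ℤ
    finitary : ∀ n → ∃[ h ] (∀ a → width a ≤ n → degree a > h → coeff a ≡ 0ℤ)

open Series public using (coeff)

infix 4 _≐_

_≐_ : Series → Series → Set
S ≐ T = ∀ a → coeff S a ≡ coeff T a

sumℤ : List ℤ → ℤ
sumℤ = foldr ℤ._+_ 0ℤ

-- All (b , c) with b + c = a, as lists of the same length as a.

splits : List ℕ → List (List ℕ × List ℕ)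
splits []      = ([] , []) ∷ []
splits (n ∷ a) =
  cartesianProductWith (λ i (b , c) → (i ∷ b , (n ∸ i) ∷ c)) (upTo (suc n)) (splits a)

Splits : List ℕ → List ℕ × List ℕ → Set
Splits a (b , c) = length b ≡ length a × length c ≡ length a × sum b + sum c ≡ sum a

interchange : ∀ i j k l → (i + j) + (k + l) ≡ (i + k) + (j + l)
interchange i j k l = trans (+-assoc i j (k + l)) (trans (cong (i +_)
  (trans (sym (+-assoc j k l)) (trans (cong (_+ l) (+-comm j k)) (+-assoc k j l))))
  (sym (+-assoc i k (j + l))))

splits-All : ∀ a → All (Splits a) (splits a)
splits-All []      = (refl , refl , refl) ∷ []
splits-All (n ∷ a) = outer (upTo (suc n)) (All.all-upTo (suc n))
  where
  inner : ∀ {i} → i < suc n → ∀ {ps} → All (Splits a) ps →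
          All (Splits (n ∷ a)) (map (λ (b , c) → (i ∷ b , (n ∸ i) ∷ c)) ps)
  inner i<n [] = []
  inner {i} i<n {(b , c) ∷ _} ((p , q , r) ∷ ps) =
    (cong suc p , cong suc q ,
     trans (interchange i (sum b) (n ∸ i) (sum c))
           (cong₂ _+_ (m+[n∸m]≡n (≤-pred i<n)) r)) ∷ inner i<n ps
  outer : ∀ is → All (_< suc n) is → All (Splits (n ∷ a))
    (cartesianProductWith (λ i (b , c) → (i ∷ b , (n ∸ i) ∷ c)) is (splits a))
  outer []       []        = []
  outer (i ∷ is) (lt ∷ ls) = All.++⁺ (inner lt (splits-All a)) (outer is ls)

sumℤ-zero : ∀ {I : Set} (f : I → ℤ) {xs} → All (λ x → f x ≡ 0ℤ) xs → sumℤ (map f xs) ≡ 0ℤ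
sumℤ-zero f []       = refl
sumℤ-zero f (p ∷ ps) = cong₂ ℤ._+_ p (sumℤ-zero f ps)

infixl 7 _*ˢ_
infixl 6 _+ˢ_ _-ˢ_

_+ˢ_ : Series → Series → Series
S +ˢ T = record
  { coeff    = λ a → coeff S a ℤ.+ coeff T a
  ; finitary = λ n → let h , p = Series.finitary S n ; k , q = Series.finitary T n in
      h + k , λ a w l → cong₂ ℤ._+_ (p a w (≤-<-trans (m≤m+n h k) l))
                                    (q a w (≤-<-trans (m≤n+m k h) l))
  }

_-ˢ_ : Series → Series → Series
S -ˢ T = record
  { coeff    = λ a → coeff S a ℤ.- coeff T a
  ; finitary = λ n → let h , p = Series.finitary S n ; k , q = Series.finitary T n in
      h + k , λ a w l → cong₂ ℤ._-_ (p a w (≤-<-trans (m≤m+n h k) l))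
                                    (q a w (≤-<-trans (m≤n+m k h) l))
  }

term : Series → Series → List ℕ × List ℕ → ℤ
term S T (b , c) = coeff S ⟦ b ⟧ ℤ.* coeff T ⟦ c ⟧

_*ˢ_ : Series → Series → Series
S *ˢ T = record
  { coeff    = λ a → sumℤ (map (term S T) (splits (entries a)))
  ; finitary = λ n → let h , p = Series.finitary S n ; k , q = Series.finitary T n in
      h + k , λ a w l → sumℤ-zero (term S T) (All.map (λ { {b , c} (lb , lc , s) →
        let wide : ∀ {d} → length d ≡ width a → width ⟦ d ⟧ ≤ n
            wide {d} e = ≤-trans (length-trim d) (subst (_≤ n) (sym e) w)
        in [ (λ l′ → trans (cong (ℤ._* coeff T ⟦ c ⟧)
                       (p ⟦ b ⟧ (wide {b} lb) (subst (h <_) (sym (sum-trim b)) l′)))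
                       (ℤ.*-zeroˡ (coeff T ⟦ c ⟧)))
           , (λ l′ → trans (cong (coeff S ⟦ b ⟧ ℤ.*_)
                       (q ⟦ c ⟧ (wide {c} lc) (subst (k <_) (sym (sum-trim c)) l′)))
                       (ℤ.*-zeroʳ (coeff S ⟦ b ⟧)))
           ]′ (split-sum (subst (h + k <_) (sym s) l)) }) (splits-All (entries a)))
  }

0ˢ : Series
0ˢ = record { coeff = const 0ℤ ; finitary = λ _ → 0 , λ _ _ _ → refl }

monomial : 𝐀 → Series
monomial c = record
  { coeff    = λ a → if does (a ≟ᴬ c) then 1ℤ else 0ℤ
  ; finitary = λ _ → degree c , λ a _ l → cong (if_then 1ℤ else 0ℤ)
      (dec-false (a ≟ᴬ c) (λ e → <-irrefl (cong degree (sym e)) l))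
  }

-- For a tuple x, the exponent of t_x.

occurrences : Tuple → ℕ → ℕ
occurrences x i = length (filter (_≟ i) x)

exponentOf : Tuple → 𝐀
exponentOf x = ⟦ map (occurrences x) (upTo (suc (foldr _⊔_ 0 x))) ⟧

1ˢ : Series
1ˢ = monomial (exponentOf [])

t : ℕ → Series
t n = monomial (exponentOf (n ∷ []))

-- All tuples of length k with components < n.

words : ℕ → ℕ → List Tuple
words zero    n = [] ∷ []
words (suc k) n = cartesianProductWith _∷_ (upTo n) (words k n)

words-All : ∀ k n → All (λ x → length x ≡ k × All (_< n) x) (words k n)
words-All zero    n = (refl , []) ∷ []
words-All (suc k) n = outer (upTo n) (All.all-upTo n)
  where
  inner : ∀ {i} → i < n → ∀ {ws} → All (λ x → length x ≡ k × All (_< n) x) ws →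
          All (λ x → length x ≡ suc k × All (_< n) x) (map (i ∷_) ws)
  inner lt []             = []
  inner lt ((e , b) ∷ ws) = (cong suc e , lt ∷ b) ∷ inner lt ws
  outer : ∀ is → All (_< n) is →
          All (λ x → length x ≡ suc k × All (_< n) x)
              (cartesianProductWith _∷_ is (words k n))
  outer []       []        = []
  outer (i ∷ is) (lt ∷ ls) = All.++⁺ (inner lt (words-All k n)) (outer is ls)

-- The coefficient of t^a in S_X is the number of x in X with t_x = t^a; such
-- an x has length ∑ᵢ aᵢ and components below the length of the list for a.

hits : 𝕎 → 𝐀 → Tuple → Bool
hits X a x = mem X x ∧ does (exponentOf x ≟ᴬ a)

count : {I : Set} → (I → Bool) → List I → ℕ
count p xs = sum (map (λ x → if p x then 1 else 0) xs)

count-zero : ∀ {I : Set} (p : I → Bool) {xs} → All (λ x → ¬ (p x ≡ true)) xs → count p xs ≡ 0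
count-zero p []                = refl
count-zero p {x ∷ xs} (e ∷ es) =
  cong₂ _+_ (cong (if_then 1 else 0) (¬-not e)) (count-zero p es)

𝕊 : 𝕎 → Series
𝕊 X = record
  { coeff    = λ a → ℤ.+ count (hits X a) (words (degree a) (width a))
  ; finitary = λ n → let h , p = 𝕎.finitary X n in
      h , λ a w l → cong ℤ.+_ (count-zero (hits X a) (All.map (λ { {x} (e , b) m →
        p x (subst (h <_) (sym e) l) (All.map (λ lt → ≤-trans (<⇒≤ lt) w) b)
          (proj₁ (∧-true m)) }) (words-All (degree a) (width a))))
  }

------------------------------------------------------------------------
-- The set ℛ and its ideals

-- |n_a| ≤ b (∑ aᵢ)! / ∏ aᵢ!  is stated with the denominator cleared.

record _∈ℛ (S : Series) : Set where
  field
    boundedDegrees : Σ[ d ∈ (ℕ → ℕ) ]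
      (∀ a → (∃[ n ] (entry (entries a) n > d n)) → coeff S a ≡ 0ℤ)
    boundedCoeffs  : ∃[ b ] (∀ a →
      ∣ coeff S a ∣ * product (map _! (entries a)) ≤ b * (degree a) !)

record _∈ℛ⁺ (S : Series) : Set where
  field
    inℛ         : S ∈ℛ
    nonzero     : ¬ (S ≐ 0ˢ)
    nonnegative : ∀ a → 0ℤ ℤ.≤ coeff S a

-- ℛ is not closed under products: if X is the set of all tuples with pairwise
-- distinct components, a squarefree monomial of degree n ≥ 1 has coefficient
-- n! in S_X but (n-1) n! in S_X².  So an ideal is required to contain those
-- products with elements of ℛ that belong to ℛ.

record IsIdeal (𝔍 : Pred Series 0ℓ) : Set where
  field
    ⊆ℛ       : ∀ {S} → 𝔍 S → S ∈ℛ
    resp     : ∀ {S T} → S ≐ T → 𝔍 S → 𝔍 T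
    0-closed : 𝔍 0ˢ
    +-closed : ∀ {S T} → 𝔍 S → 𝔍 T → 𝔍 (S +ˢ T)
    *-closed : ∀ {S T} → S ∈ℛ → 𝔍 T → (S *ˢ T) ∈ℛ → 𝔍 (S *ˢ T)

-- The ideal generated by the series tₙ − 1.

data 𝔍₀ : Pred Series 0ℓ where
  generator : ∀ n → 𝔍₀ (t n -ˢ 1ˢ)
  resp      : ∀ {S T} → S ≐ T → 𝔍₀ S → 𝔍₀ T
  0-closed  : 𝔍₀ 0ˢ
  +-closed  : ∀ {S T} → 𝔍₀ S → 𝔍₀ T → 𝔍₀ (S +ˢ T)
  *-closed  : ∀ {S T} → S ∈ℛ → 𝔍₀ T → (S *ˢ T) ∈ℛ → 𝔍₀ (S *ˢ T)

record IsGaugeIdeal (𝔍 : Pred Series 0ℓ) : Set where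
  field
    isIdeal  : IsIdeal 𝔍
    ⊇𝔍₀      : ∀ {S} → 𝔍₀ S → 𝔍 S
    positive : ∀ {S} → S ∈ℛ⁺ → ¬ 𝔍 S
    gauge    : ∀ {S} → S ∈ℛ → ¬ 𝔍 S →
               ∃[ P ] (P ∈ℛ⁺ × (𝔍 (S +ˢ P) ⊎ 𝔍 (S -ˢ P)))

-- Not every X in 𝕎 has S_X in ℛ: the tuples (0,…,0,j) with j zeros form a
-- set in 𝕎 with t₀ʲ tⱼ in its series for every j ≥ 1.  The equivalence is
-- therefore assumed where S_X and S_Y lie in ℛ.  This is a weaker hypothesis
-- than assuming it for all X and Y, where it would be unsatisfiable.

Represents : Pred Series 0ℓ → Rel 𝕎 0ℓ → Set
Represents 𝔍 _≈_ = ∀ X Y → 𝕊 X ∈ℛ → 𝕊 Y ∈ℛ → X ≈ Y ⇔ 𝔍 (𝕊 X -ˢ 𝕊 Y)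

------------------------------------------------------------------------
-- Points and values

-- Eventually zero sequences of natural numbers.  These include the 0-1
-- sequences x_F; counting sets are considered only among such points, where
-- values of formal series are finite sums.

record Point : Set where
  field
    at       : ℕ → ℕ
    bound    : ℕ
    vanishes : ∀ n → bound ≤ n → at n ≡ 0

open Point public using (at)

power : (ℕ → ℕ) → List ℕ → ℕ
power x []      = 1
power x (n ∷ a) = x 0 ^ n * power (x ∘ suc) a

box : ℕ → ℕ → List (List ℕ)
box zero    h = [] ∷ []
box (suc N) h = cartesianProductWith _∷_ (upTo (suc h)) (box N h)

-- Monomials outside the box either have a zero coefficient or involve an
-- indeterminate to which x assigns 0.

value : Series → Point → ℤ
value S x =
  let N = Point.bound x ; h = proj₁ (Series.finitary S N)
  in sumℤ (map (λ v → coeff S ⟦ v ⟧ ℤ.* (ℤ.+ power (at x) v)) (box N h))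

-- A set of points is given by a family enumerating it.

module _ {I : Set} (𝐢 : I → Point) where

  Initial : ℕ → Subset I
  Initial k i = all (λ n → does (at (𝐢 i) n ≟ 1)) (upTo (suc k))

  IsCountingSet : Set
  IsCountingSet = ∀ k → ∃[ i ] (i ∈ˢ Initial k)

  SuitableForIdeal : Pred Series 0ℓ → Set
  SuitableForIdeal 𝔍 = ∀ S → 𝔍 S → ∀ k → ∃[ i ] (i ∈ˢ Initial k × value S (𝐢 i) ≡ 0ℤ)

  SuitableUltrafilter : Pred (Subset I) 0ℓ → Set
  SuitableUltrafilter 𝒰 = ∀ k → 𝒰 (Initial k)

------------------------------------------------------------------------
-- Finite sets of natural numbers

record FinSet : Set where
  constructor finSet
  field
    elements : List ℕ
    .sorted  : AllPairs _<_ elements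

open FinSet public using (elements)

open DecMembership _≟_ using (_∈?_)

_∈ᶠ?_ : (n : ℕ) (F : FinSet) → Dec (n ∈ elements F)
n ∈ᶠ? F = n ∈? elements F

restrict : FinSet → List ℕ → FinSet
restrict (finSet F s) m = finSet (filter (_∈? m) F) (AllPairs.filter⁺ (_∈? m) s)

sublists : List ℕ → List (List ℕ)
sublists []       = [] ∷ []
sublists (n ∷ ns) = sublists ns ++ map (n ∷_) (sublists ns)

subsets : FinSet → List FinSet
subsets F = map (restrict F) (sublists (elements F))

∣_∖_∣ : FinSet → FinSet → ℕ
∣ F ∖ E ∣ = length (filter (λ n → ¬? (n ∈ᶠ? E)) (elements F))

below-max : ∀ {n} xs → n ∈ xs → n ≤ foldr _⊔_ 0 xs
below-max (x ∷ xs) (here refl) = m≤m⊔n x _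
below-max (x ∷ xs) (there i)   = ≤-trans (below-max xs i) (m≤n⊔m x _)

𝐱 : FinSet → Point
𝐱 F = record
  { at       = λ n → if does (n ∈ᶠ? F) then 1 else 0
  ; bound    = suc (foldr _⊔_ 0 (elements F))
  ; vanishes = λ n b → cong (if_then 1 else 0)
      (dec-false (n ∈ᶠ? F) (λ i → ≤⇒≯ (below-max (elements F) i) b))
  }

Φ : Series → FinSet → ℤ
Φ S F = value S (𝐱 F)

-- {F : S_X(x_F) = S_Y(x_F)}

Agree : 𝕎 → 𝕎 → Subset FinSet
Agree X Y F = does (Φ (𝕊 X) F ℤ.≟ Φ (𝕊 Y) F)

record IsGaugeUltrafilter (𝒰 : Pred (Subset FinSet) 0ℓ) : Set where
  field
    isUltrafilter : IsUltrafilter 𝒰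
    fine          : ∀ n → 𝒰 (λ F → does (n ∈ᶠ? F))
    squares       : ∀ (f : FinSet → ℤ) → Σ[ g ∈ (FinSet → ℤ) ]
      ( 𝒰 (λ F → does (f F ℤ.* f F ℤ.≟ g F))
      × (∀ F → 0ℤ ℤ.≤ sumℤ (map (λ E → -1ℤ ℤ.^ ∣ F ∖ E ∣ ℤ.* g E) (subsets F))) )

------------------------------------------------------------------------
-- The semiring of numerosities and the ultrapower of ℕ

-- On 𝕎/≈ sums are classes of disjoint unions, products are classes of
-- products of multipliable sets.  Both are determined by the fields below,
-- since suitable representatives exist.

record NumerosityOperations (_≈_ : Rel 𝕎 0ℓ) : Set where
  field
    _+ᴺ_ _*ᴺ_ : 𝕎 → 𝕎 → 𝕎
    +-reps : ∀ A B → ∃₂ λ A′ B′ → A ≈ A′ × B ≈ B′ × Disjoint A′ B′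
    *-reps : ∀ A B → ∃₂ λ A′ B′ → A ≈ A′ × B ≈ B′ × Multipliable A′ B′
    +-spec : ∀ {A B A′ B′} → A ≈ A′ → B ≈ B′ → Disjoint A′ B′ → (A +ᴺ B) ≈ (A′ ∪ B′)
    *-spec : ∀ {A B A′ B′} → A ≈ A′ → B ≈ B′ → Multipliable A′ B′ → (A *ᴺ B) ≈ (A′ ×ʷ B′)

  numerosities : RawSemiring 0ℓ 0ℓ
  numerosities = record
    { Carrier = 𝕎 ; _≈_ = _≈_ ; _+_ = _+ᴺ_ ; _*_ = _*ᴺ_ ; 0# = ∅ ; 1# = ｛ 0 ｝ }

module _ (𝒰 : Pred (Subset FinSet) 0ℓ) where

  ultrapower : RawSemiring 0ℓ 0ℓ
  ultrapower = record
    { Carrier = FinSet → ℕ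
    ; _≈_     = λ f g → 𝒰 (λ F → does (f F ≟ g F))
    ; _+_     = λ f g F → f F + g F
    ; _*_     = λ f g F → f F * g F
    ; 0#      = const 0
    ; 1#      = const 1
    }

  _<ᵁ_ : Rel (FinSet → ℕ) 0ℓ
  f <ᵁ g = 𝒰 (λ F → does (f F <? g F))

  record ΦInducesIsomorphism (_≈_ : Rel 𝕎 0ℓ) : Set where
    field
      operations : NumerosityOperations _≈_
      φ          : 𝕎 → FinSet → ℕ
      induced    : ∀ X F → ℤ.+ φ X F ≡ Φ (𝕊 X) F

    open NumerosityOperations operations
    open SemiringMorphisms numerosities ultrapower

    field
      isSemiringIsomorphism : IsSemiringIsomorphism φ
      order                 : ∀ X Y → Prec _≈_ X Y ⇔ (φ X <ᵁ φ Y)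

{-# OPTIONS --safe #-}
module Submission where

-- For a finite set F of indices, S_X(x_F) is the number φ_X(F) of tuples of X with
-- support contained in F.  By naturality the class of X depends on φ_X only, and by
-- Möbius inversion every f : FinSet → ℤ is φ_X − φ_Y on the sets containing 0 and 1.
-- The differences φ_X − φ_Y with X ≈ Y form an ideal of ℤ^FinSet, and trichotomy makes
-- the quotient an ordered ring.  Idempotents of an ordered ring are trivial, so the
-- sets whose complement has its characteristic function in the ideal form an
-- ultrafilter; a member of the ideal vanishes on a set of the ultrafilter, because a
-- function with values ≥ 1 has a multiple φ_W with W nonempty.  Conversely, for a gauge
-- ultrafilter the missing point is trichotomy: a nonnegative function is a sum of four
-- squares, hence almost everywhere a sum of functions with nonnegative Möbius transform.
--
-- A series in a gauge ideal is transferred to sets by writing it, up to the ideal and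
-- with the same values, as S_X − S_Y: a coefficient within b multinomial coefficients
-- is a sum of b differences of numbers of words with that exponent.

open import Defs
open import Axiom.ExcludedMiddle using (ExcludedMiddle)
open import Data.Bool using (Bool; true; false; not; _∧_; _∨_; if_then_else_)
open import Data.Bool.ListAction using (all; any)
import Data.Bool.Properties as Bool
open import Data.Empty using (⊥; ⊥-elim)
open import Data.Fin using (Fin; toℕ; fromℕ<)
import Data.Fin.Properties as Fin
open import Data.Integer as ℤ using (ℤ; 0ℤ; 1ℤ; -1ℤ)
import Data.Integer.DivMod as ℤ
import Data.Integer.Properties as ℤ
open import Data.Integer.Tactic.RingSolver using (solve-∀)
open import Data.List
  using (List; []; _∷_; _++_; length; map; filter; foldr; take; drop; upTo; applyUpTo;
         concatMap; cartesianProductWith; replicate)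
open import Data.List.Membership.Propositional using (_∈_; find; lose)
open import Data.List.Membership.Propositional.Properties
open import Data.List.Membership.Propositional.Properties.WithK using (unique∧set⇒bag)
import Data.List.Properties as List
open import Data.List.Relation.Binary.BagAndSetEquality using (∼bag⇒↭)
open import Data.List.Relation.Binary.Permutation.Propositional as ↭ using (_↭_; prep; swap)
open import Data.List.Relation.Binary.Permutation.Propositional.Properties using (↭-length; map⁺; ∈-resp-↭)
open import Data.List.Relation.Unary.All as All using (All; []; _∷_)
import Data.List.Relation.Unary.All.Properties as All
open import Data.List.Relation.Unary.AllPairs as AllPairs using (AllPairs; []; _∷_)
import Data.List.Relation.Unary.AllPairs.Properties as AllPairs
open import Data.List.Relation.Unary.Any using (here; there)
open import Data.List.Relation.Unary.Unique.Propositional using (Unique)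
import Data.List.Relation.Unary.Unique.Propositional.Properties as Unique
open import Data.Nat
open import Data.List.Membership.DecPropositional _≟_ using (_∈?_)
open import Data.Nat.Divisibility using (_∣_; divides; ∣⇒≤)
open import Data.Nat.DivMod using (_%_; _/_; m≡m%n+[m/n]*n; m%n<n)
open import Data.Nat.ListAction using (sum; product)
open import Data.Nat.ListAction.Properties using (product-++; ∈⇒∣product; product≢0)
open import Data.Nat.Primality using (Prime; prime⇒nonZero; prime⇒nonTrivial; euclidsLemma; prime⇒irreducible)
open import Data.Nat.Primality.Factorisation using (factorise; module PrimeFactorisation)
open import Data.Nat.Properties
import Data.Nat.Tactic.RingSolver as ℕ-Solver
open import Data.Product using (Σ-syntax; ∃-syntax; ∃₂; _×_; _,_; proj₁; proj₂)
open import Data.Sum using (_⊎_; inj₁; inj₂; [_,_]′)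
open import Function.Base using (_∘_; id; const)
open import Function.Bundles using (_⇔_; mk⇔; Equivalence)
open import Level using (0ℓ)
open import Relation.Binary.Core using (Rel)
open import Relation.Binary.PropositionalEquality
  using (_≡_; _≢_; refl; sym; trans; cong; cong₂; subst; subst₂; module ≡-Reasoning)
open import Relation.Binary.Structures using (IsEquivalence)
open import Relation.Nullary using (¬_; Dec; yes; no; does; contradiction; ¬?)
open import Relation.Nullary.Decidable using (dec-true; dec-false; recompute; _×-dec_; map′)
open import Relation.Unary using (Pred; Decidable)

-- Counting by enumeration

-- Two defects of point sets shape the constructions. No tuple is empty, so every φ_X vanishes at
-- the empty set; and φ is multiplicative only on multipliable pairs. A prefix code with delimiters
-- 0 and 1 repairs the second defect, multiplication by the characteristic function of the sets
-- containing 0 and 1 the first. Nothing is lost on the way: (UP) allows 0 and 1 to be appended to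
-- all tuples, and a fine ultrafilter contains the family of these sets. The multiple of a function
-- h with values ≥ 1 is the product of h(E) over all subsets E of F. The Möbius transform of h may
-- have any sign, that of this product is nonnegative. The gauge ideal is related only to sets with
-- series in ℛ, so auxiliary sets need bounded degree in each indeterminate. Tuples with a
-- prescribed support are therefore produced by repeating the largest element of the support: only
-- finitely many finite sets share it.

does-true : ∀ {P : Set} (P? : Dec P) → does P? ≡ true → P
does-true (yes p) _ = p

-- Every cardinality below is the length of such a list. Enumerations of equivalent predicates are
-- permutations of each other, so counts are compared by translating predicates.
record _Enumerates_ {A : Set} (xs : List A) (P : A → Set) : Set where
  field
    unique   : Unique xs
    sound    : ∀ {x} → x ∈ xs → P x
    complete : ∀ {x} → P x → x ∈ xs

open _Enumerates_ public

enum-↭ : ∀ {A : Set} {P Q : A → Set} {xs ys} → xs Enumerates P → ys Enumerates Q →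
                 (∀ {x} → P x → Q x) → (∀ {x} → Q x → P x) → xs ↭ ys
enum-↭ p q f g = ∼bag⇒↭ (unique∧set⇒bag (unique p) (unique q)
  (mk⇔ (complete q ∘ f ∘ sound p) (complete p ∘ g ∘ sound q)))

enum-length : ∀ {A : Set} {P Q : A → Set} {xs ys} → xs Enumerates P → ys Enumerates Q →
                      (∀ {x} → P x → Q x) → (∀ {x} → Q x → P x) → length xs ≡ length ys
enum-length p q f g = ↭-length (enum-↭ p q f g)

enum-self : ∀ {A : Set} {xs : List A} → Unique xs → xs Enumerates (_∈ xs)
enum-self u = record { unique = u ; sound = id ; complete = id }

enum-cong : ∀ {A : Set} {P Q : A → Set} {xs} → (∀ {x} → P x → Q x) → (∀ {x} → Q x → P x) →
                  xs Enumerates P → xs Enumerates Q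
enum-cong f g p = record { unique = unique p ; sound = f ∘ sound p ; complete = complete p ∘ g }

enum-filter : ∀ {A : Set} {P Q : A → Set} {xs} (Q? : Decidable Q) → xs Enumerates P →
                    filter Q? xs Enumerates (λ x → P x × Q x)
enum-filter {xs = xs} Q? p = record
  { unique   = Unique.filter⁺ Q? (unique p)
  ; sound    = λ i → let j , q = ∈-filter⁻ Q? {xs = xs} i in sound p j , q
  ; complete = λ (a , b) → ∈-filter⁺ Q? (complete p a) b
  }

map-unique : ∀ {A B : Set} (f : A → B) {xs} →
             (∀ {x y} → x ∈ xs → y ∈ xs → f x ≡ f y → x ≡ y) → Unique xs → Unique (map f xs)
map-unique f inj []       = []
map-unique f {x ∷ xs} inj (a ∷ u) =
  All.map⁺ (All.tabulate (λ i e → All.lookup a i (inj (here refl) (there i) e)))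
  ∷ map-unique f (λ i j → inj (there i) (there j)) u

enum-map : ∀ {A B : Set} (f : A → B) {P xs} → (∀ {x y} → P x → P y → f x ≡ f y → x ≡ y) →
                 xs Enumerates P → map f xs Enumerates (λ y → ∃[ x ] (P x × f x ≡ y))
enum-map f inj p = record
  { unique   = map-unique f (λ i j → inj (sound p i) (sound p j)) (unique p)
  ; sound    = λ i → let x , j , e = ∈-map⁻ f i in x , sound p j , sym e
  ; complete = λ { (x , q , refl) → ∈-map⁺ f (complete p q) }
  }

enum-++ : ∀ {A : Set} {P Q : A → Set} {xs ys} → (∀ {x} → P x → ¬ Q x) →
                xs Enumerates P → ys Enumerates Q → (xs ++ ys) Enumerates (λ x → P x ⊎ Q x)
enum-++ {xs = xs} d p q = record
  { unique   = Unique.++⁺ (unique p) (unique q) (λ (i , j) → d (sound p i) (sound q j))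
  ; sound    = λ i → [ inj₁ ∘ sound p , inj₂ ∘ sound q ]′ (∈-++⁻ xs i)
  ; complete = [ ∈-++⁺ˡ ∘ complete p , ∈-++⁺ʳ xs ∘ complete q ]′
  }

concatMap-unique : ∀ {A B : Set} (f : A → List B) {xs} → Unique xs →
  (∀ {x} → x ∈ xs → Unique (f x)) →
  (∀ {x y b} → x ∈ xs → y ∈ xs → b ∈ f x → b ∈ f y → x ≡ y) → Unique (concatMap f xs)
concatMap-unique f []      _ _ = []
concatMap-unique f {x ∷ xs} (a ∷ u) v d =
  Unique.++⁺ (v (here refl)) (concatMap-unique f u (v ∘ there) (λ i j → d (there i) (there j)))
    (λ (i , j) → let y , k , l = find (∈-concatMap⁻ f {xs = xs} j)
                 in All.lookup a k (d (here refl) (there k) i l))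

enum-concatMap : ∀ {A B : Set} (f : A → List B) {P : A → Set} {Q : A → B → Set} {xs} →
  (∀ {x y b} → Q x b → Q y b → x ≡ y) → xs Enumerates P →
  (∀ {x} → P x → f x Enumerates Q x) →
  concatMap f xs Enumerates (λ b → ∃[ x ] (P x × Q x b))
enum-concatMap f {xs = xs} d p q = record
  { unique   = concatMap-unique f (unique p) (λ i → unique (q (sound p i)))
                 (λ i j k l → d (sound (q (sound p i)) k) (sound (q (sound p j)) l))
  ; sound    = λ i → let x , j , k = find (∈-concatMap⁻ f {xs = xs} i)
                     in x , sound p j , sound (q (sound p j)) k
  ; complete = λ (x , a , b) → ∈-concatMap⁺ f (lose (complete p a) (complete (q a) b))
  }

enum-product : ∀ {A B C : Set} (f : A → B → C) {P : A → Set} {Q : B → Set} {xs ys} →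
  (∀ {a a′ b b′} → P a → P a′ → Q b → Q b′ → f a b ≡ f a′ b′ → a ≡ a′ × b ≡ b′) →
  xs Enumerates P → ys Enumerates Q →
  cartesianProductWith f xs ys Enumerates (λ c → ∃₂ λ a b → (P a × Q b) × f a b ≡ c)
enum-product f {P} {Q} {xs} {ys} inj p q = record
  { unique   = go (unique p) (sound p)
  ; sound    = λ i → let a , b , j , k , e = ∈-cartesianProductWith⁻ f xs ys i
                     in a , b , (sound p j , sound q k) , sym e
  ; complete = λ { (a , b , (j , k) , refl) → ∈-cartesianProductWith⁺ f (complete p j) (complete q k) }
  }
  where
  go : ∀ {xs} → Unique xs → (∀ {x} → x ∈ xs → P x) → Unique (cartesianProductWith f xs ys)
  go []              _ = []
  go {x ∷ xs} (a ∷ u) s = Unique.++⁺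
    (map-unique (f x) (λ i j e → proj₂ (inj (s (here refl)) (s (here refl)) (sound q i) (sound q j) e)) (unique q))
    (go u (s ∘ there))
    (λ (i , j) → let b , k , e = ∈-map⁻ (f x) i
                     a′ , b′ , k′ , l′ , e′ = ∈-cartesianProductWith⁻ f xs ys j
                 in All.lookup a k′ (proj₁ (inj (s (here refl)) (s (there k′)) (sound q k) (sound q l′)
                                       (trans (sym e) e′))))

length-concatMap : ∀ {A B : Set} (f : A → List B) xs →
                   length (concatMap f xs) ≡ sum (map (length ∘ f) xs)
length-concatMap f []       = refl
length-concatMap f (x ∷ xs) = trans (List.length-++ (f x)) (cong (length (f x) +_) (length-concatMap f xs))

count-length : ∀ {I : Set} (p : I → Bool) xs →
               count p xs ≡ length (filter (λ x → p x Bool.≟ true) xs)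
count-length p []       = refl
count-length p (x ∷ xs) with p x
... | true  = cong suc (count-length p xs)
... | false = count-length p xs

sum-map-≡ : ∀ {A : Set} {f g : A → ℕ} xs → (∀ {x} → x ∈ xs → f x ≡ g x) → sum (map f xs) ≡ sum (map g xs)
sum-map-≡ []       e = refl
sum-map-≡ (x ∷ xs) e = cong₂ _+_ (e (here refl)) (sum-map-≡ xs (e ∘ there))

sum-map-+ : ∀ {A : Set} (f g : A → ℕ) xs →
            sum (map (λ x → f x + g x) xs) ≡ sum (map f xs) + sum (map g xs)
sum-map-+ f g []       = refl
sum-map-+ f g (x ∷ xs) = trans (cong ((f x + g x) +_) (sum-map-+ f g xs))
  (interchange (f x) (g x) (sum (map f xs)) (sum (map g xs)))

sum-map-*ʳ : ∀ {A : Set} (f : A → ℕ) k xs → sum (map (λ x → f x * k) xs) ≡ sum (map f xs) * k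
sum-map-*ʳ f k []       = refl
sum-map-*ʳ f k (x ∷ xs) = trans (cong (f x * k +_) (sum-map-*ʳ f k xs))
                                (sym (*-distribʳ-+ k (f x) (sum (map f xs))))

∈⇒≤sum : ∀ {A : Set} (f : A → ℕ) {x} xs → x ∈ xs → f x ≤ sum (map f xs)
∈⇒≤sum f (x ∷ xs) (here refl) = m≤m+n (f x) _
∈⇒≤sum f (y ∷ xs) (there i)   = ≤-trans (∈⇒≤sum f xs i) (m≤n+m _ (f y))

upTo-enum : ∀ n → upTo n Enumerates (_< n)
upTo-enum n = record { unique = Unique.upTo⁺ n ; sound = ∈-upTo⁻ ; complete = ∈-upTo⁺ }

words-enum : ∀ k n → words k n Enumerates (λ x → length x ≡ k × All (_< n) x)
words-enum zero    n = record
  { unique = [] ∷ [] ; sound = λ { (here refl) → refl , [] } ; complete = λ { {[]} _ → here refl } }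
words-enum (suc k) n = enum-cong
  (λ { (_ , _ , (p , e , a) , refl) → cong suc e , p ∷ a })
  (λ { {_ ∷ _} (e , p ∷ a) → _ , _ , (p , suc-injective e , a) , refl })
  (enum-product _∷_ (λ { _ _ _ _ refl → refl , refl }) (upTo-enum n) (words-enum k n))

box-enum : ∀ N h → box N h Enumerates (λ x → length x ≡ N × All (_≤ h) x)
box-enum zero    n = record
  { unique = [] ∷ [] ; sound = λ { (here refl) → refl , [] } ; complete = λ { {[]} _ → here refl } }
box-enum (suc k) n = enum-cong
  (λ { (_ , _ , (p , e , a) , refl) → cong suc e , ≤-pred p ∷ a })
  (λ { {_ ∷ _} (e , p ∷ a) → _ , _ , (s≤s p , suc-injective e , a) , refl })
  (enum-product _∷_ (λ { _ _ _ _ refl → refl , refl }) (upTo-enum (suc n)) (box-enum k n))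

-- Supports

_⊆ᴸ_ : List ℕ → List ℕ → Set
x ⊆ᴸ y = All (_∈ y) x

-- The field `sorted` is irrelevant; as sortedness is decidable, a usable proof can be recomputed.
sortedness : ∀ F → AllPairs _<_ (elements F)
sortedness (finSet xs s) = recompute (AllPairs.allPairs? _<?_ xs) s

-- Each head is the least element of its list, so the heads agree; by strictness neither recurs in a
-- tail.
sorted-ext : ∀ {xs ys : List ℕ} → AllPairs _<_ xs → AllPairs _<_ ys → xs ⊆ᴸ ys → ys ⊆ᴸ xs → xs ≡ ys
sorted-ext [] [] _ _ = refl
sorted-ext [] (_ ∷ _) _ (() ∷ _)
sorted-ext (_ ∷ _) [] (() ∷ _) _
sorted-ext {x ∷ xs} {y ∷ ys} (a ∷ s) (b ∷ t) (p ∷ ps) (q ∷ qs) with head p q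
  where
  head : x ∈ y ∷ ys → y ∈ x ∷ xs → x ≡ y
  head (here e)  _         = e
  head (there _) (here e)  = sym e
  head (there i) (there j) = contradiction (All.lookup a j) (<-asym (All.lookup b i))
... | refl = cong (x ∷_) (sorted-ext s t (tail a ps) (tail b qs))
  where
  tail : ∀ {us vs} → All (x <_) us → All (_∈ x ∷ vs) us → All (_∈ vs) us
  tail [] [] = []
  tail (l ∷ ls) (here e ∷ is)  = contradiction l (<-irrefl (sym e))
  tail (l ∷ ls) (there i ∷ is) = i ∷ tail ls is

FinSet-ext : ∀ {E F} → elements E ⊆ᴸ elements F → elements F ⊆ᴸ elements E → E ≡ F
FinSet-ext {finSet xs s} {finSet ys t} p q
  with sorted-ext (sortedness (finSet xs s)) (sortedness (finSet ys t)) p q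
... | refl = refl

-- Applied to lists in general, not only to tuples: `g ∘ supp` reads a function of finite sets as a
-- function of lists, where Möbius transforms are computed by recursion.
supp : List ℕ → FinSet
supp x = finSet (filter (_∈? x) (upTo (suc (foldr _⊔_ 0 x))))
  (AllPairs.filter⁺ (_∈? x) (AllPairs.applyUpTo⁺₁ id _ (λ lt _ → lt)))

∈-supp⁺ : ∀ {x i} → i ∈ x → i ∈ elements (supp x)
∈-supp⁺ {x} i = ∈-filter⁺ (_∈? x) (∈-upTo⁺ (s≤s (below-max x i))) i

∈-supp⁻ : ∀ {x i} → i ∈ elements (supp x) → i ∈ x
∈-supp⁻ {x} i = proj₂ (∈-filter⁻ (_∈? x) {xs = upTo (suc (foldr _⊔_ 0 x))} i)

supp-≡ : ∀ {x F} → x ⊆ᴸ elements F → elements F ⊆ᴸ x → supp x ≡ F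
supp-≡ p q = FinSet-ext (All.tabulate (All.lookup p ∘ ∈-supp⁻)) (All.map ∈-supp⁺ q)

supp-elements : ∀ F → supp (elements F) ≡ F
supp-elements F = supp-≡ (All.tabulate id) (All.tabulate id)

_≟ᶠ_ : (E F : FinSet) → Dec (E ≡ F)
E ≟ᶠ F with List.≡-dec _≟_ (elements E) (elements F)
... | no ¬e = no (¬e ∘ cong elements)
... | yes e = yes (FinSet-ext (subst (elements E ⊆ᴸ_) e (All.tabulate id))
                              (subst (_⊆ᴸ elements E) e (All.tabulate id)))

-- Exponents

entry-∷ᵗ : ∀ n a i → entry (n ∷ᵗ a) i ≡ entry (n ∷ a) i
entry-∷ᵗ zero    []      zero    = refl
entry-∷ᵗ zero    []      (suc i) = refl
entry-∷ᵗ (suc n) []      i       = refl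
entry-∷ᵗ zero    (m ∷ a) i       = refl
entry-∷ᵗ (suc n) (m ∷ a) i       = refl

entry-trim : ∀ a i → entry (trim a) i ≡ entry a i
entry-trim []      i       = refl
entry-trim (n ∷ a) zero    = entry-∷ᵗ n (trim a) zero
entry-trim (n ∷ a) (suc i) = trans (entry-∷ᵗ n (trim a) (suc i)) (entry-trim a i)

trim-zero : ∀ a → (∀ i → entry a i ≡ 0) → trim a ≡ []
trim-zero []      e = refl
trim-zero (n ∷ a) e rewrite trim-zero a (e ∘ suc) | e 0 = refl

trim-cong : ∀ a b → (∀ i → entry a i ≡ entry b i) → trim a ≡ trim b
trim-cong []      b       e = sym (trim-zero b (sym ∘ e))
trim-cong (m ∷ a) []      e = trim-zero (m ∷ a) e
trim-cong (m ∷ a) (n ∷ b) e rewrite e 0 | trim-cong a b (e ∘ suc) = refl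

trim-trimmed-≡ : ∀ a → Trimmed a → trim a ≡ a
trim-trimmed-≡ []            _ = refl
trim-trimmed-≡ (suc n ∷ [])  _ = refl
trim-trimmed-≡ (zero ∷ m ∷ a)  p rewrite trim-trimmed-≡ (m ∷ a) p = refl
trim-trimmed-≡ (suc n ∷ m ∷ a) p rewrite trim-trimmed-≡ (m ∷ a) p = refl

trim-entries : ∀ a → trim (entries a) ≡ entries a
trim-entries (exponent as p) = recompute (List.≡-dec _≟_ _ _) (trim-trimmed-≡ as p)

𝐀-entries : ∀ {a b} → entries a ≡ entries b → a ≡ b
𝐀-entries {exponent _ _} {exponent _ _} refl = refl

𝐀-ext : ∀ {a b} → (∀ i → entry (entries a) i ≡ entry (entries b) i) → a ≡ b
𝐀-ext {a} {b} e = 𝐀-entries (trans (sym (trim-entries a))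
  (trans (trim-cong (entries a) (entries b) e) (trim-entries b)))

⟦entries⟧ : ∀ a → ⟦ entries a ⟧ ≡ a
⟦entries⟧ a = 𝐀-entries (trim-entries a)

entry-ext : ∀ {a b} → length a ≡ length b → (∀ i → entry a i ≡ entry b i) → a ≡ b
entry-ext {[]}    {[]}    _ _ = refl
entry-ext {_ ∷ _} {_ ∷ _} l e = cong₂ _∷_ (e 0) (entry-ext (suc-injective l) (e ∘ suc))

entry-beyond : ∀ a i → length a ≤ i → entry a i ≡ 0
entry-beyond []      i       _       = refl
entry-beyond (_ ∷ a) (suc i) (s≤s l) = entry-beyond a i l

map-upTo-suc : ∀ {A : Set} (f : ℕ → A) k → map f (upTo (suc k)) ≡ f 0 ∷ map (f ∘ suc) (upTo k)
map-upTo-suc f k = cong (f 0 ∷_) (trans (List.map-applyUpTo suc f k) (sym (List.map-upTo (f ∘ suc) k)))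

entry-tabulated : ∀ f k i → i < k → entry (map f (upTo k)) i ≡ f i
entry-tabulated f (suc k) i lt rewrite map-upTo-suc f k with i | lt
... | zero  | _     = refl
... | suc j | s≤s l = entry-tabulated (f ∘ suc) k j l

entry-tabulated′ : ∀ f k i → (k ≤ i → f i ≡ 0) → entry (map f (upTo k)) i ≡ f i
entry-tabulated′ f k i z with i <? k
... | yes lt = entry-tabulated f k i lt
... | no ≮   = trans (entry-beyond (map f (upTo k)) i (subst (_≤ i)
  (sym (trans (List.length-map f (upTo k)) (List.length-upTo k))) (≮⇒≥ ≮)))
                     (sym (z (≮⇒≥ ≮)))

occurrences-∉ : ∀ {i} x → ¬ (i ∈ x) → occurrences x i ≡ 0
occurrences-∉ {i} x i∉ = cong length (List.filter-none (_≟ i) (All.tabulate (λ { j refl → i∉ j })))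

occurrences-∈ : ∀ {i} x → i ∈ x → 0 < occurrences x i
occurrences-∈ {i} x p with filter (_≟ i) x in eq
... | []    with () ← subst (i ∈_) eq (∈-filter⁺ (_≟ i) p refl)
... | _ ∷ _ = s≤s z≤n

occurrences>0⇒∈ : ∀ {i} x → 0 < occurrences x i → i ∈ x
occurrences>0⇒∈ {i} x p with i ∈? x
... | yes j = j
... | no i∉ = contradiction (subst (0 <_) (occurrences-∉ x i∉) p) (<-irrefl refl)

entry-exponentOf : ∀ x i → entry (entries (exponentOf x)) i ≡ occurrences x i
entry-exponentOf x i = trans (entry-trim (map (occurrences x) (upTo (suc (foldr _⊔_ 0 x)))) i)
  (entry-tabulated′ (occurrences x) _ i (λ le → occurrences-∉ x (λ j → ≤⇒≯ (below-max x j) le)))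

exponentOf-≡ : ∀ x {a} → (∀ i → occurrences x i ≡ entry (entries a) i) → exponentOf x ≡ a
exponentOf-≡ x e = 𝐀-ext (λ i → trans (entry-exponentOf x i) (e i))

indicator : ℕ → ℕ → ℕ
indicator y i = if does (y ≟ i) then 1 else 0

occurrences-∷ : ∀ y x i → occurrences (y ∷ x) i ≡ indicator y i + occurrences x i
occurrences-∷ y x i with does (y ≟ i)
... | true  = refl
... | false = refl

sum-indicator : ∀ y k → y < k → sum (map (indicator y) (upTo k)) ≡ 1
sum-indicator zero    (suc k) _ = trans (cong sum (map-upTo-suc (indicator 0) k))
  (cong suc (zeros (upTo k)))
  where
  zeros : ∀ xs → sum (map (indicator 0 ∘ suc) xs) ≡ 0
  zeros []       = refl
  zeros (_ ∷ xs) = zeros xs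
sum-indicator (suc y) (suc k) (s≤s l) = trans (cong sum (map-upTo-suc (indicator (suc y)) k)) (sum-indicator y k l)

sum-occurrences : ∀ x k → All (_< k) x → sum (map (occurrences x) (upTo k)) ≡ length x
sum-occurrences []      k _ = zeros (upTo k)
  where
  zeros : ∀ (xs : List ℕ) → sum (map (λ _ → 0) xs) ≡ 0
  zeros []       = refl
  zeros (_ ∷ xs) = zeros xs
sum-occurrences (y ∷ x) k (l ∷ ls) = begin
  sum (map (occurrences (y ∷ x)) (upTo k))
    ≡⟨ sum-map-≡ (upTo k) (λ {i} _ → occurrences-∷ y x i) ⟩
  sum (map (λ i → indicator y i + occurrences x i) (upTo k))
    ≡⟨ sum-map-+ (indicator y) (occurrences x) (upTo k) ⟩
  sum (map (indicator y) (upTo k)) + sum (map (occurrences x) (upTo k))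
    ≡⟨ cong₂ _+_ (sum-indicator y k l) (sum-occurrences x k ls) ⟩
  suc (length x) ∎
  where open ≡-Reasoning

degree-exponentOf : ∀ x → degree (exponentOf x) ≡ length x
degree-exponentOf x = trans (sum-trim (map (occurrences x) (upTo (suc (foldr _⊔_ 0 x)))))
  (sum-occurrences x _ (All.tabulate (s≤s ∘ below-max x)))

entry>0⇒<length : ∀ a i → 0 < entry a i → i < length a
entry>0⇒<length a i p with i <? length a
... | yes l = l
... | no ≮  = contradiction (subst (0 <_) (entry-beyond a i (≮⇒≥ ≮)) p) (<-irrefl refl)

-- Together with `degree-exponentOf`: the words that `𝕊` searches for an exponent include every
-- tuple with that exponent.
components-<-width : ∀ x → All (_< width (exponentOf x)) x
components-<-width x = All.tabulate (λ {i} j → entry>0⇒<length (entries (exponentOf x)) i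
  (subst (0 <_) (sym (entry-exponentOf x i)) (occurrences-∈ x j)))

-- Their number is the multinomial coefficient in the definition of ℛ (`arrangements-length`).
arrangements : 𝐀 → List Tuple
arrangements a = filter (λ x → exponentOf x ≟ᴬ a) (words (degree a) (width a))

arrangements-enum : ∀ a → arrangements a Enumerates (λ x → exponentOf x ≡ a)
arrangements-enum a = enum-cong proj₂
  (λ { {x} refl → (sym (degree-exponentOf x) , components-<-width x) , refl })
  (enum-filter (λ x → exponentOf x ≟ᴬ a) (words-enum (degree a) (width a)))

module _ (X : 𝕎) (a : 𝐀) where

  members : List Tuple
  members = filter (λ x → hits X a x Bool.≟ true) (words (degree a) (width a))

  members-enum : members Enumerates (λ x → x ∈ʷ X × exponentOf x ≡ a)
  members-enum = enum-cong
    (λ {x} (_ , h) → let p , q = ∧-true h in p , does-true (exponentOf x ≟ᴬ a) q)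
    (λ { {x} (p , refl) → (sym (degree-exponentOf x) , components-<-width x)
                        , cong₂ _∧_ p (dec-true (exponentOf x ≟ᴬ a) refl) })
    (enum-filter (λ x → hits X a x Bool.≟ true) (words-enum (degree a) (width a)))

  coeff-𝕊 : coeff (𝕊 X) a ≡ ℤ.+ length members
  coeff-𝕊 = cong ℤ.+_ (count-length (hits X a) (words (degree a) (width a)))

-- Multinomial coefficients

decrement : List ℕ → ℕ → List ℕ
decrement []      _       = []
decrement (m ∷ v) zero    = pred m ∷ v
decrement (m ∷ v) (suc i) = m ∷ decrement v i

entry-decrement : ∀ v i j → 0 < entry v i → indicator i j + entry (decrement v i) j ≡ entry v j
entry-decrement (suc m ∷ v) zero    zero    _ = refl
entry-decrement (m ∷ v)     zero    (suc j) _ = refl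
entry-decrement (m ∷ v)     (suc i) zero    _ = refl
entry-decrement (m ∷ v)     (suc i) (suc j) p = entry-decrement v i j p

sum-decrement : ∀ v i → 0 < entry v i → suc (sum (decrement v i)) ≡ sum v
sum-decrement (suc m ∷ v) zero    _ = refl
sum-decrement (m ∷ v)     (suc i) p = trans (sym (+-suc m _)) (cong (m +_) (sum-decrement v i p))

product-decrement : ∀ v i → 0 < entry v i →
                    product (map _! v) ≡ product (map _! (decrement v i)) * entry v i
product-decrement (suc m ∷ v) zero    _ =
  trans (*-assoc (suc m) (m !) _) (*-comm (suc m) _)
product-decrement (m ∷ v)     (suc i) p =
  trans (cong (m ! *_) (product-decrement v i p)) (sym (*-assoc (m !) _ (entry v i)))

sum-map-filter-pos : ∀ {A : Set} (f : A → ℕ) xs →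
                     sum (map f (filter (λ x → 0 <? f x) xs)) ≡ sum (map f xs)
sum-map-filter-pos f [] = refl
sum-map-filter-pos f (x ∷ xs) with f x in eq
... | zero  = sum-map-filter-pos f xs
... | suc n = cong₂ _+_ eq (sum-map-filter-pos f xs)

sum-entries : ∀ v → sum (map (entry v) (upTo (length v))) ≡ sum v
sum-entries []      = refl
sum-entries (m ∷ v) = trans (cong sum (map-upTo-suc (entry (m ∷ v)) (length v))) (cong (m +_) (sum-entries v))

exponentOf-≡⟦⟧⁺ : ∀ x v → (∀ i → occurrences x i ≡ entry v i) → exponentOf x ≡ ⟦ v ⟧
exponentOf-≡⟦⟧⁺ x v e = exponentOf-≡ x (λ i → trans (e i) (sym (entry-trim v i)))

exponentOf-≡⟦⟧⁻ : ∀ x v → exponentOf x ≡ ⟦ v ⟧ → ∀ i → occurrences x i ≡ entry v i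
exponentOf-≡⟦⟧⁻ x v e i =
  trans (sym (entry-exponentOf x i)) (trans (cong (λ a → entry (entries a) i) e) (entry-trim v i))

arrangements-by-head : List ℕ → List Tuple
arrangements-by-head v = concatMap (λ i → map (i ∷_) (arrangements ⟦ decrement v i ⟧))
                                   (filter (λ i → 0 <? entry v i) (upTo (length v)))

arrangements-by-head-enum : ∀ v {k} → sum v ≡ suc k →
  arrangements-by-head v Enumerates (λ x → exponentOf x ≡ ⟦ v ⟧)
arrangements-by-head-enum v s = enum-cong to from
  (enum-concatMap (λ i → map (i ∷_) (arrangements ⟦ decrement v i ⟧))
    (λ { (_ , _ , refl) (_ , _ , refl) → refl })
    (enum-filter (λ i → 0 <? entry v i) (upTo-enum (length v)))
    (λ {i} _ → enum-map (i ∷_) (λ { _ _ refl → refl }) (arrangements-enum ⟦ decrement v i ⟧)))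
  where
  to : ∀ {x} → ∃[ i ] ((i < length v × 0 < entry v i) ×
         ∃[ y ] (exponentOf y ≡ ⟦ decrement v i ⟧ × i ∷ y ≡ x)) → exponentOf x ≡ ⟦ v ⟧
  to (i , (_ , p) , y , e , refl) = exponentOf-≡⟦⟧⁺ (i ∷ y) v (λ j → trans (occurrences-∷ i y j)
    (trans (cong (indicator i j +_) (exponentOf-≡⟦⟧⁻ y (decrement v i) e j)) (entry-decrement v i j p)))
  from : ∀ {x} → exponentOf x ≡ ⟦ v ⟧ → ∃[ i ] ((i < length v × 0 < entry v i) ×
         ∃[ y ] (exponentOf y ≡ ⟦ decrement v i ⟧ × i ∷ y ≡ x))
  from {[]}    e with () ← trans (sym s) (trans (sym (sum-trim v)) (trans (cong degree (sym e)) (degree-exponentOf [])))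
  from {i ∷ y} e = i , (entry>0⇒<length v i p , p) , y
                 , exponentOf-≡⟦⟧⁺ y (decrement v i) (λ j → +-cancelˡ-≡ (indicator i j) _ _
                     (trans (sym (occurrences-∷ i y j)) (trans (o j) (sym (entry-decrement v i j p)))))
                 , refl
    where
    o : ∀ j → occurrences (i ∷ y) j ≡ entry v j
    o = exponentOf-≡⟦⟧⁻ (i ∷ y) v e
    p : 0 < entry v i
    p = subst (0 <_) (o i) (occurrences-∈ (i ∷ y) (here refl))

-- Classify arrangements by the first letter i; the rest arranges v with its i-th entry lowered.
-- After multiplication by the product of the factorials, class i contributes v_i k!, and the v_i
-- add up to k + 1. Only positive entries count as letters, because `decrement` stops at zero.
multinomial : ∀ k v → sum v ≡ k → length (arrangements ⟦ v ⟧) * product (map _! v) ≡ k !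
multinomial zero v s = cong₂ _*_ one (prod v s)
  where
  entry≤sum : ∀ v i → entry v i ≤ sum v
  entry≤sum []      i       = z≤n
  entry≤sum (m ∷ v) zero    = m≤m+n m _
  entry≤sum (m ∷ v) (suc i) = ≤-trans (entry≤sum v i) (m≤n+m _ m)
  one : length (arrangements ⟦ v ⟧) ≡ 1
  one = enum-length (arrangements-enum ⟦ v ⟧) (enum-self {xs = [] ∷ []} ([] ∷ []))
    (λ { {[]} _ → here refl
       ; {x ∷ y} e → contradiction (trans (sym (degree-exponentOf (x ∷ y)))
         (trans (cong degree e) (trans (sum-trim v) s))) λ () })
    (λ { (here refl) → exponentOf-≡⟦⟧⁺ [] v (λ i → sym (n≤0⇒n≡0 (subst (entry v i ≤_) s (entry≤sum v i)))) })
  prod : ∀ v → sum v ≡ 0 → product (map _! v) ≡ 1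
  prod []         _ = refl
  prod (zero ∷ v) s = trans (+-identityʳ _) (prod v s)
multinomial (suc k) v s = begin
  length (arrangements ⟦ v ⟧) * P
    ≡⟨ cong (_* P) (enum-length (arrangements-enum ⟦ v ⟧) (arrangements-by-head-enum v s) id id) ⟩
  length (arrangements-by-head v) * P
    ≡⟨ cong (_* P) (length-concatMap (λ i → map (i ∷_) (arrangements ⟦ decrement v i ⟧)) letters) ⟩
  sum (map (λ i → length (map (i ∷_) (arrangements ⟦ decrement v i ⟧))) letters) * P
    ≡⟨ sym (sum-map-*ʳ (λ i → length (map (i ∷_) (arrangements ⟦ decrement v i ⟧))) P letters) ⟩
  sum (map (λ i → length (map (i ∷_) (arrangements ⟦ decrement v i ⟧)) * P) letters)
    ≡⟨ sum-map-≡ letters (λ {i} m → step i (proj₂ (∈-filter⁻ (λ i → 0 <? entry v i) {xs = upTo (length v)} m))) ⟩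
  sum (map (λ i → entry v i * k !) letters)
    ≡⟨ sum-map-*ʳ (entry v) (k !) letters ⟩
  sum (map (entry v) letters) * k !
    ≡⟨ cong (_* k !) (trans (sum-map-filter-pos (entry v) (upTo (length v))) (trans (sum-entries v) s)) ⟩
  suc k ! ∎
  where
  open ≡-Reasoning
  P = product (map _! v)
  letters = filter (λ i → 0 <? entry v i) (upTo (length v))
  step : ∀ i → 0 < entry v i → length (map (i ∷_) (arrangements ⟦ decrement v i ⟧)) * P ≡ entry v i * k !
  step i p = begin
    length (map (i ∷_) (arrangements ⟦ decrement v i ⟧)) * P
      ≡⟨ cong₂ _*_ (List.length-map (i ∷_) (arrangements ⟦ decrement v i ⟧)) (product-decrement v i p) ⟩
    length (arrangements ⟦ decrement v i ⟧) * (product (map _! (decrement v i)) * entry v i)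
      ≡⟨ sym (*-assoc (length (arrangements ⟦ decrement v i ⟧)) _ (entry v i)) ⟩
    length (arrangements ⟦ decrement v i ⟧) * product (map _! (decrement v i)) * entry v i
      ≡⟨ cong (_* entry v i) (multinomial k (decrement v i) (suc-injective (trans (sum-decrement v i p) s))) ⟩
    k ! * entry v i
      ≡⟨ *-comm (k !) (entry v i) ⟩
    entry v i * k ! ∎

factorials : 𝐀 → ℕ
factorials a = product (map _! (entries a))

arrangements-length : ∀ a → length (arrangements a) * factorials a ≡ degree a !
arrangements-length a = subst (λ c → length (arrangements c) * factorials a ≡ degree a !)
  (⟦entries⟧ a) (multinomial (degree a) (entries a) refl)

members-≤ : ∀ X a → length (members X a) ≤ length (arrangements a)
members-≤ X a = subst (_≤ length (arrangements a))
  (enum-length (enum-filter (λ x → mem X x Bool.≟ true) (arrangements-enum a))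
    (members-enum X a) (λ (p , q) → q , p) (λ (p , q) → q , p))
  (List.length-filter (λ x → mem X x Bool.≟ true) (arrangements a))

DegreeBounded : 𝕎 → Set
DegreeBounded X = ∀ n → ∃[ d ] (∀ x → x ∈ʷ X → occurrences x n ≤ d)

-- The bound on coefficients holds with b = 1, since the tuples of X with a given exponent are among
-- its arrangements.
𝕊-∈ℛ : ∀ X → DegreeBounded X → 𝕊 X ∈ℛ
𝕊-∈ℛ X bd = record
  { boundedDegrees = (λ n → proj₁ (bd n)) , λ a (n , gt) → trans (coeff-𝕊 X a)
      (cong (λ l → ℤ.+ length l) (empty (members X a) (λ {x} i → let p , e = sound (members-enum X a) i in
        <⇒≱ gt (subst (_≤ proj₁ (bd n))
          (trans (sym (entry-exponentOf x n)) (cong (λ c → entry (entries c) n) e))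
          (proj₂ (bd n) x p)))))
  ; boundedCoeffs = 1 , λ a → subst₂ _≤_
      (cong (λ z → ℤ.∣ z ∣ * factorials a) (sym (coeff-𝕊 X a)))
      (trans (arrangements-length a) (sym (*-identityˡ (degree a !))))
      (*-monoˡ-≤ (factorials a) (members-≤ X a))
  }
  where
  empty : ∀ {A : Set} (xs : List A) → (∀ {x} → ¬ (x ∈ xs)) → xs ≡ []
  empty []       _ = refl
  empty (x ∷ xs) e = contradiction (here refl) e

-- Values of series

sumℤ-↭ : ∀ {xs ys} → xs ↭ ys → sumℤ xs ≡ sumℤ ys
sumℤ-↭ ↭.refl            = refl
sumℤ-↭ (prep x p)        = cong (λ z → x ℤ.+ z) (sumℤ-↭ p)
sumℤ-↭ (swap {xs} {ys} x y p) = trans (sym (ℤ.+-assoc x y (sumℤ xs)))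
  (trans (cong₂ ℤ._+_ (ℤ.+-comm x y) (sumℤ-↭ p)) (ℤ.+-assoc y x (sumℤ ys)))
sumℤ-↭ (↭.trans p q)     = trans (sumℤ-↭ p) (sumℤ-↭ q)

sumℤ-nonzero : ∀ {A : Set} (k : A → ℤ) xs →
               sumℤ (map k (filter (λ x → ¬? (k x ℤ.≟ 0ℤ)) xs)) ≡ sumℤ (map k xs)
sumℤ-nonzero k []       = refl
sumℤ-nonzero k (x ∷ xs) with k x ℤ.≟ 0ℤ
... | no _  = cong (λ z → k x ℤ.+ z) (sumℤ-nonzero k xs)
... | yes e = trans (sumℤ-nonzero k xs) (sym (trans (cong (ℤ._+ sumℤ (map k xs)) e) (ℤ.+-identityˡ _)))

sumℤ-support : ∀ {A : Set} (k : A → ℤ) {P Q : A → Set} {xs ys} → xs Enumerates P → ys Enumerates Q →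
               (∀ {x} → P x → k x ≢ 0ℤ → Q x) → (∀ {x} → Q x → k x ≢ 0ℤ → P x) →
               sumℤ (map k xs) ≡ sumℤ (map k ys)
sumℤ-support k {xs = xs} {ys} p q f g = trans (sym (sumℤ-nonzero k xs))
  (trans (sumℤ-↭ (map⁺ k (enum-↭ (enum-filter nz p) (enum-filter nz q)
    (λ (a , b) → f a b , b) (λ (a , b) → g a b , b)))) (sumℤ-nonzero k ys))
  where nz = λ x → ¬? (k x ℤ.≟ 0ℤ)

sumℤ-map-+ : ∀ {A : Set} (f g : A → ℤ) xs →
             sumℤ (map (λ x → f x ℤ.+ g x) xs) ≡ sumℤ (map f xs) ℤ.+ sumℤ (map g xs)
sumℤ-map-+ f g []       = refl
sumℤ-map-+ f g (x ∷ xs) = trans (cong (λ z → (f x ℤ.+ g x) ℤ.+ z) (sumℤ-map-+ f g xs)) (inter (f x) (g x) _ _)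
  where
  inter : ∀ i j k l → (i ℤ.+ j) ℤ.+ (k ℤ.+ l) ≡ (i ℤ.+ k) ℤ.+ (j ℤ.+ l)
  inter = solve-∀

sumℤ-map-neg : ∀ {A : Set} (f : A → ℤ) xs → sumℤ (map (λ x → ℤ.- f x) xs) ≡ ℤ.- sumℤ (map f xs)
sumℤ-map-neg f []       = refl
sumℤ-map-neg f (x ∷ xs) = trans (cong (λ z → ℤ.- f x ℤ.+ z) (sumℤ-map-neg f xs))
                                (sym (ℤ.neg-distrib-+ (f x) (sumℤ (map f xs))))

sumℤ-map-≡ : ∀ {A : Set} {f g : A → ℤ} xs → (∀ {x} → x ∈ xs → f x ≡ g x) → sumℤ (map f xs) ≡ sumℤ (map g xs)
sumℤ-map-≡ []       e = refl
sumℤ-map-≡ (x ∷ xs) e = cong₂ ℤ._+_ (e (here refl)) (sumℤ-map-≡ xs (e ∘ there))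

sumℤ-map-pos : ∀ {A : Set} (f : A → ℕ) xs → sumℤ (map (λ x → ℤ.+ f x) xs) ≡ ℤ.+ sum (map f xs)
sumℤ-map-pos f []       = refl
sumℤ-map-pos f (x ∷ xs) = cong (λ z → ℤ.+ f x ℤ.+ z) (sumℤ-map-pos f xs)

sumℤ-weighted : ∀ {A : Set} (c : A → ℤ) (w : A → ℕ) → (∀ x → w x ≡ 0 ⊎ w x ≡ 1) → ∀ xs →
                sumℤ (map (λ x → c x ℤ.* ℤ.+ w x) xs) ≡ sumℤ (map c (filter (λ x → w x ≟ 1) xs))
sumℤ-weighted c w b []       = refl
sumℤ-weighted c w b (x ∷ xs) with w x | b x
... | .0 | inj₁ refl = trans (cong₂ ℤ._+_ (ℤ.*-zeroʳ (c x)) (sumℤ-weighted c w b xs)) (ℤ.+-identityˡ _)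
... | .1 | inj₂ refl = cong₂ ℤ._+_ (ℤ.*-identityʳ (c x)) (sumℤ-weighted c w b xs)

monomialValue : Series → Point → List ℕ → ℤ
monomialValue S x v = coeff S ⟦ v ⟧ ℤ.* ℤ.+ power (at x) v

-- Each series brings its own height from `finitary`, so linearity of `value` needs a common box. A
-- vector of degree above the height has coefficient 0; one of smaller degree has all its entries
-- within the height.
value-at-height : ∀ S x h → proj₁ (Series.finitary S (Point.bound x)) ≤ h →
                  sumℤ (map (monomialValue S x) (box (Point.bound x) h)) ≡ value S x
value-at-height S x h le = sumℤ-support (monomialValue S x) (box-enum N h) (box-enum N h₀)
  (λ {v} (l , _) nz → l , low v l nz)
  (λ (l , a) _ → l , All.map (λ b → ≤-trans b le) a)
  where
  N  = Point.bound x
  h₀ = proj₁ (Series.finitary S N)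
  bounded : ∀ v → All (_≤ sum v) v
  bounded []      = []
  bounded (m ∷ v) = m≤m+n m _ ∷ All.map (λ b → ≤-trans b (m≤n+m _ m)) (bounded v)
  low : ∀ v → length v ≡ N → monomialValue S x v ≢ 0ℤ → All (_≤ h₀) v
  low v l nz with sum v ≤? h₀
  ... | yes b = All.map (λ c → ≤-trans c b) (bounded v)
  ... | no ≰  = contradiction (trans (cong (ℤ._* ℤ.+ power (at x) v)
                  (proj₂ (Series.finitary S N) ⟦ v ⟧ (subst (length (trim v) ≤_) l (length-trim v))
                    (subst (h₀ <_) (sym (sum-trim v)) (≰⇒> ≰))))
                  (ℤ.*-zeroˡ (ℤ.+ power (at x) v))) nz

value-+ : ∀ S T x → value (S +ˢ T) x ≡ value S x ℤ.+ value T x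
value-+ S T x = trans
  (trans (sumℤ-map-≡ (box N (h + k)) (λ {v} _ → ℤ.*-distribʳ-+ (ℤ.+ power (at x) v) (coeff S ⟦ v ⟧) (coeff T ⟦ v ⟧)))
         (sumℤ-map-+ (monomialValue S x) (monomialValue T x) (box N (h + k))))
  (cong₂ ℤ._+_ (value-at-height S x (h + k) (m≤m+n h k)) (value-at-height T x (h + k) (m≤n+m k h)))
  where
  N = Point.bound x
  h = proj₁ (Series.finitary S N)
  k = proj₁ (Series.finitary T N)

value-- : ∀ S T x → value (S -ˢ T) x ≡ value S x ℤ.- value T x
value-- S T x = trans
  (trans (sumℤ-map-≡ (box N (h + k)) (λ {v} _ → trans
           (ℤ.*-distribʳ-+ (ℤ.+ power (at x) v) (coeff S ⟦ v ⟧) (ℤ.- coeff T ⟦ v ⟧))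
           (cong (λ z → monomialValue S x v ℤ.+ z) (sym (ℤ.neg-distribˡ-* (coeff T ⟦ v ⟧) _)))))
  (trans (sumℤ-map-+ (monomialValue S x) (λ v → ℤ.- monomialValue T x v) (box N (h + k)))
         (cong (λ z → sumℤ (map (monomialValue S x) (box N (h + k))) ℤ.+ z)
           (sumℤ-map-neg (monomialValue T x) (box N (h + k))))))
  (cong₂ ℤ._-_ (value-at-height S x (h + k) (m≤m+n h k)) (value-at-height T x (h + k) (m≤n+m k h)))
  where
  N = Point.bound x
  h = proj₁ (Series.finitary S N)
  k = proj₁ (Series.finitary T N)

value-cong : ∀ {S T} x → S ≐ T → value S x ≡ value T x
value-cong {S} {T} x e = trans (sym (value-at-height S x (h + k) (m≤m+n h k)))
  (trans (sumℤ-map-≡ (box N (h + k)) (λ {v} _ → cong (ℤ._* ℤ.+ power (at x) v) (e ⟦ v ⟧)))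
         (value-at-height T x (h + k) (m≤n+m k h)))
  where
  N = Point.bound x
  h = proj₁ (Series.finitary S N)
  k = proj₁ (Series.finitary T N)

power-one : ∀ x v → (∀ i → 0 < entry v i → x i ≡ 1) → power x v ≡ 1
power-one x []          _ = refl
power-one x (zero ∷ v)  p = trans (+-identityʳ _) (power-one (x ∘ suc) v (p ∘ suc))
power-one x (suc n ∷ v) p rewrite p 0 (s≤s z≤n) =
  cong₂ _*_ (^-zeroˡ (suc n)) (power-one (x ∘ suc) v (p ∘ suc))

power-one⁻ : ∀ x v → power x v ≡ 1 → ∀ i → 0 < entry v i → x i ≢ 0
power-one⁻ x (suc n ∷ v) e zero    p z rewrite z = contradiction e λ ()
power-one⁻ x (m ∷ v)     e (suc i) p = power-one⁻ (x ∘ suc) v (m*n≡1⇒n≡1 (x 0 ^ m) (power (x ∘ suc) v) e) i p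

power-01 : ∀ x v → (∀ i → x i ≡ 0 ⊎ x i ≡ 1) → power x v ≡ 0 ⊎ power x v ≡ 1
power-01 x []          _ = inj₂ refl
power-01 x (zero ∷ v)  b rewrite +-identityʳ (power (x ∘ suc) v) = power-01 (x ∘ suc) v (b ∘ suc)
power-01 x (suc n ∷ v) b with b 0
... | inj₁ e rewrite e = inj₁ refl
... | inj₂ e rewrite e | ^-zeroˡ n | +-identityʳ (power (x ∘ suc) v) = power-01 (x ∘ suc) v (b ∘ suc)

at-01 : ∀ F i → at (𝐱 F) i ≡ 0 ⊎ at (𝐱 F) i ≡ 1
at-01 F i with does (i ∈ᶠ? F)
... | true  = inj₂ refl
... | false = inj₁ refl

at-∈ : ∀ {F i} → i ∈ elements F → at (𝐱 F) i ≡ 1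
at-∈ {F} {i} p = cong (if_then 1 else 0) (dec-true (i ∈ᶠ? F) p)

at-∈⁻ : ∀ {F i} → at (𝐱 F) i ≢ 0 → i ∈ elements F
at-∈⁻ {F} {i} p with i ∈ᶠ? F
... | yes q = q
... | no ¬q = contradiction refl p

module _ (X : 𝕎) (F : FinSet) where
  private
    N = Point.bound (𝐱 F)
    -- `𝕊` takes its heights over from `X`, so this is the box over which `Φ (𝕊 X) F` is summed.
    h = proj₁ (𝕎.finitary X N)
    inF? : Decidable (λ v → power (at (𝐱 F)) v ≡ 1)
    inF? v = power (at (𝐱 F)) v ≟ 1

  tuplesIn : List Tuple
  tuplesIn = concatMap (λ v → members X ⟦ v ⟧) (filter inF? (box N h))

  φ : ℕ
  φ = length tuplesIn

  -- At a 0-1 point a monomial is 1 or 0 according to whether all its indeterminates lie in F, so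
  -- the value adds up the coefficients of the monomials inside F.
  Φ-𝕊 : Φ (𝕊 X) F ≡ ℤ.+ φ
  Φ-𝕊 = trans (sumℤ-weighted (λ v → coeff (𝕊 X) ⟦ v ⟧) (power (at (𝐱 F))) (λ v → power-01 (at (𝐱 F)) v (at-01 F)) (box N h))
    (trans (sumℤ-map-≡ (filter inF? (box N h)) (λ {v} _ → coeff-𝕊 X ⟦ v ⟧))
    (trans (sumℤ-map-pos (λ v → length (members X ⟦ v ⟧)) (filter inF? (box N h)))
    (cong ℤ.+_ (sym (length-concatMap (λ v → members X ⟦ v ⟧) (filter inF? (box N h)))))))

  tuplesIn-enum : tuplesIn Enumerates (λ x → x ∈ʷ X × x ⊆ᴸ elements F)
  tuplesIn-enum = record
    { unique   = concatMap-unique (λ v → members X ⟦ v ⟧) (Unique.filter⁺ inF? (unique (box-enum N h)))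
        (λ {v} _ → unique (members-enum X ⟦ v ⟧))
        (λ {v} {w} {x} i j p q → entry-ext
          (trans (proj₁ (sound (box-enum N h) (proj₁ (∈-filter⁻ inF? {xs = box N h} i))))
            (sym (proj₁ (sound (box-enum N h) (proj₁ (∈-filter⁻ inF? {xs = box N h} j))))))
          (λ k → trans (sym (exponentOf-≡⟦⟧⁻ x v (proj₂ (sound (members-enum X ⟦ v ⟧) p)) k))
                       (exponentOf-≡⟦⟧⁻ x w (proj₂ (sound (members-enum X ⟦ w ⟧) q)) k)))
    ; sound    = λ {x} i → let v , j , m = find (∈-concatMap⁻ (λ v → members X ⟦ v ⟧) {xs = filter inF? (box N h)} i)
                               p , e = sound (members-enum X ⟦ v ⟧) m
                               w = proj₂ (∈-filter⁻ inF? {xs = box N h} j)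
                           in p , All.tabulate (λ {k} c → at-∈⁻ {F} (power-one⁻ (at (𝐱 F)) v w k
                                (subst (0 <_) (exponentOf-≡⟦⟧⁻ x v e k) (occurrences-∈ x c))))
    ; complete = λ {x} (p , s) → ∈-concatMap⁺ (λ v → members X ⟦ v ⟧)
      (lose (visible x p s) (complete (members-enum X ⟦ exps x ⟧) (p , exps-≡ x s)))
    }
    where
    exps : Tuple → List ℕ
    exps x = map (occurrences x) (upTo N)
    below-N : ∀ x → x ⊆ᴸ elements F → All (_< N) x
    below-N x s = All.map (λ i → s≤s (below-max (elements F) i)) s
    entry-exps : ∀ x → x ⊆ᴸ elements F → ∀ i → entry (exps x) i ≡ occurrences x i
    entry-exps x s i = entry-tabulated′ (occurrences x) N i
      (λ le → occurrences-∉ x (λ j → ≤⇒≯ le (All.lookup (below-N x s) j)))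
    exps-≡ : ∀ x → x ⊆ᴸ elements F → exponentOf x ≡ ⟦ exps x ⟧
    exps-≡ x s = exponentOf-≡⟦⟧⁺ x (exps x) (sym ∘ entry-exps x s)
    visible : ∀ x → x ∈ʷ X → x ⊆ᴸ elements F → exps x ∈ filter inF? (box N h)
    visible x p s = ∈-filter⁺ inF?
      (complete (box-enum N h)
        (trans (List.length-map (occurrences x) (upTo N)) (List.length-upTo N)
        , All.map⁺ (All.universal (λ i → ≤-trans (List.length-filter (_≟ i) x) length≤h) (upTo N))))
      (power-one (at (𝐱 F)) (exps x)
        (λ i lt → at-∈ {F} (All.lookup s (occurrences>0⇒∈ x (subst (0 <_) (entry-exps x s i) lt)))))
      where
      length≤h : length x ≤ h
      length≤h with length x ≤? h
      ... | yes le = le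
      ... | no ≰   = contradiction p (proj₂ (𝕎.finitary X N) x (≰⇒> ≰) (All.map <⇒≤ (below-N x s)))

-- Counting tuples by support

Agree⁺ : ∀ X Y F → φ X F ≡ φ Y F → F ∈ˢ Agree X Y
Agree⁺ X Y F e = dec-true (Φ (𝕊 X) F ℤ.≟ Φ (𝕊 Y) F) (trans (Φ-𝕊 X F) (trans (cong ℤ.+_ e) (sym (Φ-𝕊 Y F))))

Agree⁻ : ∀ X Y F → F ∈ˢ Agree X Y → φ X F ≡ φ Y F
Agree⁻ X Y F i = ℤ.+-injective
  (trans (sym (Φ-𝕊 X F)) (trans (does-true (Φ (𝕊 X) F ℤ.≟ Φ (𝕊 Y) F) i) (Φ-𝕊 Y F)))

SupportPreserving : 𝕎 → (Tuple → Tuple) → Set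
SupportPreserving X τ = ∀ x → x ∈ʷ X → ∀ i → i ∈ τ x ⇔ i ∈ x

⊆ᴸ-resp : ∀ {x y z} → (∀ i → i ∈ y ⇔ i ∈ x) → x ⊆ᴸ z → y ⊆ᴸ z
⊆ᴸ-resp e s = All.tabulate (All.lookup s ∘ Equivalence.to (e _))

-- A tuple and its image lie within the same finite sets, so τ restricts to a bijection of the
-- tuples within F. Permutations of coordinates are a special case, which later settles (TP).
φ-image : ∀ {X Y τ} → InjectiveOn X τ → SupportPreserving X τ → IsImage τ X Y → ∀ F → φ X F ≡ φ Y F
φ-image {X} {Y} {τ} inj pres im F = trans (sym (List.length-map τ (tuplesIn X F)))
  (enum-length
    (enum-map τ (λ p q → inj (proj₁ p) (proj₁ q)) (tuplesIn-enum X F))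
    (tuplesIn-enum Y F)
    (λ { (x , (p , s) , refl) → Equivalence.from (im (τ x)) (x , p , refl) , ⊆ᴸ-resp (pres x p) s })
    (λ {y} (p , s) → from s (Equivalence.to (im y) p)))
  where
  from : ∀ {y} → y ⊆ᴸ elements F → ∃[ x ] (x ∈ʷ X × τ x ≡ y) → ∃[ x ] ((x ∈ʷ X × x ⊆ᴸ elements F) × τ x ≡ y)
  from s (x , p , refl) =
    x , (p , ⊆ᴸ-resp (λ i → mk⇔ (Equivalence.from (pres x p i)) (Equivalence.to (pres x p i))) s) , refl

φ-split : ∀ {A B C} → (∀ {x} → x ∈ʷ C → x ∈ʷ A ⊎ x ∈ʷ B) → A ⊆ʷ C → B ⊆ʷ C → Disjoint A B →
          ∀ F → φ C F ≡ φ A F + φ B F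
φ-split {A} {B} {C} c a b d F = trans
  (enum-length (tuplesIn-enum C F)
    (enum-++ (λ (p , _) (q , _) → d _ p q) (tuplesIn-enum A F) (tuplesIn-enum B F))
    (λ (p , s) → [ (λ q → inj₁ (q , s)) , (λ q → inj₂ (q , s)) ]′ (c p))
    [ (λ (p , s) → a _ p , s) , (λ (p , s) → b _ p , s) ]′)
  (List.length-++ (tuplesIn A F))

∨-introˡ : ∀ {a b} → a ≡ true → a ∨ b ≡ true
∨-introˡ refl = refl

∨-introʳ : ∀ {a b} → b ≡ true → a ∨ b ≡ true
∨-introʳ {true}  refl = refl
∨-introʳ {false} refl = refl

not-true : ∀ {b} → not b ≡ true → ¬ (b ≡ true)
not-true {false} _ ()

true? : ∀ b → b ≡ true ⊎ not b ≡ true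
true? true  = inj₁ refl
true? false = inj₂ refl

φ-∪ : ∀ A B → Disjoint A B → ∀ F → φ (A ∪ B) F ≡ φ A F + φ B F
φ-∪ A B = φ-split {A} {B} {A ∪ B} ∨-true (λ _ → ∨-introˡ) (λ x → ∨-introʳ {mem A x})

φ-∪-∖ : ∀ A B F → φ (A ∪ B) F ≡ φ A F + φ (B ∖ʷ A) F
φ-∪-∖ A B = φ-split {A} {B ∖ʷ A} {A ∪ B}
  (λ {x} p → [ inj₁ , (λ q → [ inj₁ , (λ r → inj₂ (cong₂ _∧_ q r)) ]′ (true? (mem A x))) ]′ (∨-true p))
  (λ _ → ∨-introˡ) (λ x p → ∨-introʳ {mem A x} (proj₁ (∧-true p)))
  (λ x p q → not-true (proj₂ (∧-true {mem B x} q)) p)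

φ-⊆ : ∀ A B → B ⊆ʷ A → ∀ F → φ A F ≡ φ B F + φ (A ∖ʷ B) F
φ-⊆ A B s = φ-split {B} {A ∖ʷ B} {A}
  (λ {x} p → [ inj₁ , (λ r → inj₂ (cong₂ _∧_ p r)) ]′ (true? (mem B x)))
  s (λ x p → proj₁ (∧-true p)) (λ x p q → not-true (proj₂ (∧-true {mem A x} q)) p)

φ-same : ∀ {X Y} → X ⊆ʷ Y → Y ⊆ʷ X → ∀ F → φ X F ≡ φ Y F
φ-same {X} {Y} p q F = enum-length (tuplesIn-enum X F) (tuplesIn-enum Y F)
  (λ (a , s) → p _ a , s) (λ (a , s) → q _ a , s)

φ-∅ : ∀ F → φ ∅ F ≡ 0
φ-∅ F = enum-length (tuplesIn-enum ∅ F) (enum-self {xs = []} []) (λ ()) (λ ())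

φ-positive : ∀ X F {x} → x ∈ʷ X → x ⊆ᴸ elements F → 0 < φ X F
φ-positive X F p s = ∈-length (complete (tuplesIn-enum X F) (p , s))

φ-positive⁻ : ∀ X F → 0 < φ X F → ∃[ x ] (x ∈ʷ X)
φ-positive⁻ X F p with tuplesIn X F in eq
... | x ∷ _ = x , proj₁ (sound (tuplesIn-enum X F) (subst (x ∈_) (sym eq) (here refl)))

any-intro : ∀ {I : Set} (p : I → Bool) {xs i} → i ∈ xs → p i ≡ true → any p xs ≡ true
any-intro p (here refl) e rewrite e = refl
any-intro p {x ∷ _} (there i) e = ∨-introʳ {p x} (any-intro p i e)

∈-×ʷ⁺ : ∀ {A B a b} → a ∈ʷ A → b ∈ʷ B → (a ++ b) ∈ʷ (A ×ʷ B)
∈-×ʷ⁺ {A} {B} {a} {b} p q = any-intro (cut A B (a ++ b))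
  (∈-upTo⁺ (s≤s (subst (length a ≤_) (sym (List.length-++ a)) (m≤m+n _ _))))
  (cong₂ _∧_ (trans (cong (mem A) (take-++-≡ a)) p) (trans (cong (mem B) (drop-++-≡ a)) q))
  where
  take-++-≡ : ∀ (a : Tuple) {b} → take (length a) (a ++ b) ≡ a
  take-++-≡ []      = refl
  take-++-≡ (x ∷ a) = cong (x ∷_) (take-++-≡ a)
  drop-++-≡ : ∀ (a : Tuple) {b} → drop (length a) (a ++ b) ≡ b
  drop-++-≡ []      = refl
  drop-++-≡ (x ∷ a) = drop-++-≡ a

∈-×ʷ⁻ : ∀ {A B x} → x ∈ʷ (A ×ʷ B) → ∃₂ λ a b → (a ∈ʷ A × b ∈ʷ B) × a ++ b ≡ x
∈-×ʷ⁻ {A} {B} {x} e = let k , c = any-true (cut A B x) (upTo (suc (length x))) e in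
  take k x , drop k x , ∧-true c , List.take++drop≡id k x

length-cartesianProductWith : ∀ {A B C : Set} (f : A → B → C) xs ys →
                              length (cartesianProductWith f xs ys) ≡ length xs * length ys
length-cartesianProductWith f []       ys = refl
length-cartesianProductWith f (x ∷ xs) ys = trans (List.length-++ (map (f x) ys))
  (cong₂ _+_ (List.length-map (f x) ys) (length-cartesianProductWith f xs ys))

-- Multipliability makes concatenation injective on pairs, and a concatenation lies within F exactly
-- when both parts do.
φ-×ʷ : ∀ A B → Multipliable A B → ∀ F → φ (A ×ʷ B) F ≡ φ A F * φ B F
φ-×ʷ A B m F = trans
  (enum-length (tuplesIn-enum (A ×ʷ B) F)
    (enum-product _++_
      (λ (p , _) (p′ , _) (q , _) (q′ , _) e → let r = m p p′ q q′ e in cong proj₁ r , cong proj₂ r)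
      (tuplesIn-enum A F) (tuplesIn-enum B F))
    (λ {x} (p , s) → to s (∈-×ʷ⁻ {A} {B} {x} p))
    (λ { (a , b , ((p , s) , q , t) , refl) → ∈-×ʷ⁺ {A} {B} {a} p q , All.++⁺ s t }))
  (length-cartesianProductWith _++_ (tuplesIn A F) (tuplesIn B F))
  where
  to : ∀ {x} → x ⊆ᴸ elements F → (∃₂ λ a b → (a ∈ʷ A × b ∈ʷ B) × a ++ b ≡ x) →
       ∃₂ λ a b → ((a ∈ʷ A × a ⊆ᴸ elements F) × (b ∈ʷ B × b ⊆ᴸ elements F)) × a ++ b ≡ x
  to s (a , b , (p , q) , refl) = a , b , ((p , All.++⁻ˡ a s) , (q , All.++⁻ʳ a s)) , refl

module _ (X : 𝕎) (E : FinSet) where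

  withSupport : List Tuple
  withSupport = filter (λ x → supp x ≟ᶠ E) (tuplesIn X E)

  -- As a function of E this is the Möbius transform of `φ X` (`mobius-φ`), which is therefore
  -- nonnegative.
  ν : ℕ
  ν = length withSupport

  withSupport-enum : withSupport Enumerates (λ x → x ∈ʷ X × supp x ≡ E)
  withSupport-enum = enum-cong (λ ((p , _) , e) → p , e)
    (λ { (p , refl) → (p , All.tabulate ∈-supp⁺) , refl })
    (enum-filter (λ x → supp x ≟ᶠ E) (tuplesIn-enum X E))

-- Sublists

Sorted : List ℕ → Set
Sorted = AllPairs _<_

[]∈sublists : ∀ l → [] ∈ sublists l
[]∈sublists []      = here refl
[]∈sublists (_ ∷ l) = ∈-++⁺ˡ ([]∈sublists l)

∈-sublists-∷⁻ : ∀ {n l m} → m ∈ sublists (n ∷ l) →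
                m ∈ sublists l ⊎ ∃[ m′ ] (m′ ∈ sublists l × m ≡ n ∷ m′)
∈-sublists-∷⁻ {n} {l} i = [ inj₁ , (λ j → inj₂ (∈-map⁻ (n ∷_) j)) ]′ (∈-++⁻ (sublists l) i)

sublists-⊆ : ∀ l {m} → m ∈ sublists l → m ⊆ᴸ l
sublists-⊆ []      (here refl) = []
sublists-⊆ (n ∷ l) i with ∈-sublists-∷⁻ {n} {l} i
... | inj₁ j              = All.map there (sublists-⊆ l j)
... | inj₂ (m , j , refl) = here refl ∷ All.map there (sublists-⊆ l j)

sublists-sorted : ∀ {l m} → Sorted l → m ∈ sublists l → Sorted m
sublists-sorted {[]}    []      (here refl) = []
sublists-sorted {n ∷ l} (a ∷ s) i with ∈-sublists-∷⁻ {n} {l} i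
... | inj₁ j              = sublists-sorted s j
... | inj₂ (m , j , refl) = All.tabulate (λ k → All.lookup a (All.lookup (sublists-⊆ l j) k)) ∷ sublists-sorted s j

sorted-∉ : ∀ {n l m} → All (n <_) l → m ∈ sublists l → ¬ (n ∈ m)
sorted-∉ {l = l} a j k = <-irrefl refl (All.lookup a (All.lookup (sublists-⊆ l j) k))

sublists-unique : ∀ {l} → Sorted l → Unique (sublists l)
sublists-unique []                = [] ∷ []
sublists-unique {n ∷ l} (a ∷ s) = Unique.++⁺ (sublists-unique s)
  (map-unique (n ∷_) (λ { _ _ refl → refl }) (sublists-unique s))
  (λ (i , j) → disjoint i (∈-map⁻ (n ∷_) j))
  where
  disjoint : ∀ {m} → m ∈ sublists l → ¬ (∃[ m′ ] (m′ ∈ sublists l × m ≡ n ∷ m′))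
  disjoint i (m′ , _ , refl) = sorted-∉ a i (here refl)

sorted-⊆⇒sublist : ∀ {m l} → Sorted m → Sorted l → m ⊆ᴸ l → m ∈ sublists l
sorted-⊆⇒sublist {[]}    {l}     _ _ _ = []∈sublists l
sorted-⊆⇒sublist {x ∷ m} {[]}    _ _ (() ∷ _)
sorted-⊆⇒sublist {x ∷ m} {n ∷ l} (a ∷ s) (b ∷ t) (here refl ∷ is) =
  ∈-++⁺ʳ (sublists l) (∈-map⁺ (n ∷_) (sorted-⊆⇒sublist s t (All.tabulate (λ j → tail (All.lookup a j) (All.lookup is j)))))
  where
  tail : ∀ {i} → n < i → i ∈ n ∷ l → i ∈ l
  tail lt (here e)  = contradiction lt (<-irrefl (sym e))
  tail lt (there j) = j
sorted-⊆⇒sublist {x ∷ m} {n ∷ l} (a ∷ s) (b ∷ t) (there i ∷ is) =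
  ∈-++⁺ˡ (sorted-⊆⇒sublist (a ∷ s) t (i ∷ All.tabulate (λ j → tail (<-trans (All.lookup b i) (All.lookup a j))
    (All.lookup is j))))
  where
  tail : ∀ {i} → n < i → i ∈ n ∷ l → i ∈ l
  tail lt (here e)  = contradiction lt (<-irrefl (sym e))
  tail lt (there j) = j

elements-supp : ∀ {m} → Sorted m → elements (supp m) ≡ m
elements-supp {m} s = cong elements (supp-elements (finSet m s))

supp-⊆ : ∀ {E F} → elements E ⊆ᴸ elements F → elements E ∈ sublists (elements F)
supp-⊆ {E} {F} = sorted-⊆⇒sublist (sortedness E) (sortedness F)

-- The tuples within F are partitioned by their supports, and these are subsets of F.
φ-ν : ∀ X F → φ X F ≡ sum (map (λ m → ν X (supp m)) (sublists (elements F)))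
φ-ν X F = trans
  (enum-length (tuplesIn-enum X F)
    (record
      { unique   = concatMap-unique f (sublists-unique (sortedness F))
          (λ {m} _ → unique (withSupport-enum X (supp m)))
          (λ {m} {m′} i j p q → trans (sym (elements-supp (sublists-sorted (sortedness F) i)))
            (trans (cong elements (trans (sym (proj₂ (sound (withSupport-enum X (supp m)) p)))
                                         (proj₂ (sound (withSupport-enum X (supp m′)) q))))
                   (elements-supp (sublists-sorted (sortedness F) j))))
      ; sound    = λ i → find (∈-concatMap⁻ f {xs = sublists (elements F)} i)
      ; complete = λ (m , i , j) → ∈-concatMap⁺ f (lose i j) })
    (λ {x} (p , s) → elements (supp x) , supp-⊆ {supp x} {F} (All.tabulate (All.lookup s ∘ ∈-supp⁻))
       , complete (withSupport-enum X _) (p , sym (supp-elements (supp x))))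
    (λ {x} (m , i , j) → let p , e = sound (withSupport-enum X (supp m)) j in
       p , All.tabulate (λ {y} k → All.lookup (sublists-⊆ (elements F) i)
         (∈-supp⁻ (subst (λ E → y ∈ elements E) e (∈-supp⁺ k))))))
  (length-concatMap f (sublists (elements F)))
  where
  f : List ℕ → List Tuple
  f m = withSupport X (supp m)

-- Möbius inversion

ζ : (List ℕ → ℤ) → List ℕ → ℤ
ζ k l = sumℤ (map k (sublists l))

-- The alternating sum over sublists (`signed-sum`, for sorted lists) as an iterated difference, one
-- for each element; inductions on the list then involve no signs.
μ : (List ℕ → ℤ) → List ℕ → ℤ
μ k []      = k []
μ k (n ∷ l) = μ (k ∘ (n ∷_)) l ℤ.- μ k l

sumℤ-++ : ∀ xs ys → sumℤ (xs ++ ys) ≡ sumℤ xs ℤ.+ sumℤ ys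
sumℤ-++ []       ys = sym (ℤ.+-identityˡ _)
sumℤ-++ (x ∷ xs) ys = trans (cong (λ z → x ℤ.+ z) (sumℤ-++ xs ys)) (sym (ℤ.+-assoc x (sumℤ xs) (sumℤ ys)))

sumℤ-map-- : ∀ {A : Set} (f g : A → ℤ) xs →
             sumℤ (map (λ x → f x ℤ.- g x) xs) ≡ sumℤ (map f xs) ℤ.- sumℤ (map g xs)
sumℤ-map-- f g xs = trans (sumℤ-map-+ f (λ x → ℤ.- g x) xs)
  (cong (λ z → sumℤ (map f xs) ℤ.+ z) (sumℤ-map-neg g xs))

sumℤ-sublists-∷ : ∀ k n l → sumℤ (map k (sublists (n ∷ l))) ≡
                  sumℤ (map k (sublists l)) ℤ.+ sumℤ (map (k ∘ (n ∷_)) (sublists l))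
sumℤ-sublists-∷ k n l = trans (cong sumℤ (List.map-++ k (sublists l) _))
  (trans (sumℤ-++ (map k (sublists l)) _)
    (cong (λ z → sumℤ (map k (sublists l)) ℤ.+ sumℤ z) (sym (List.map-∘ {g = k} {f = n ∷_} (sublists l)))))

ζ-μ : ∀ k l → ζ (μ k) l ≡ k l
ζ-μ k []      = ℤ.+-identityʳ _
ζ-μ k (n ∷ l) = begin
  ζ (μ k) (n ∷ l)
    ≡⟨ sumℤ-sublists-∷ (μ k) n l ⟩
  ζ (μ k) l ℤ.+ ζ (λ m → μ (k ∘ (n ∷_)) m ℤ.- μ k m) l
    ≡⟨ cong (λ z → ζ (μ k) l ℤ.+ z) (sumℤ-map-- (μ (k ∘ (n ∷_))) (μ k) (sublists l)) ⟩
  ζ (μ k) l ℤ.+ (ζ (μ (k ∘ (n ∷_))) l ℤ.- ζ (μ k) l)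
    ≡⟨ cancel (ζ (μ k) l) _ ⟩
  ζ (μ (k ∘ (n ∷_))) l
    ≡⟨ ζ-μ (k ∘ (n ∷_)) l ⟩
  k (n ∷ l) ∎
  where
  open ≡-Reasoning
  cancel : ∀ a b → a ℤ.+ (b ℤ.- a) ≡ b
  cancel = solve-∀

μ-cong : ∀ {k k′} l → (∀ {m} → m ∈ sublists l → k m ≡ k′ m) → μ k l ≡ μ k′ l
μ-cong []      e = e (here refl)
μ-cong (n ∷ l) e = cong₂ ℤ._-_ (μ-cong l (λ i → e (∈-++⁺ʳ (sublists l) (∈-map⁺ (n ∷_) i))))
                               (μ-cong l (e ∘ ∈-++⁺ˡ))

μ-+ : ∀ k k′ l → μ (λ m → k m ℤ.+ k′ m) l ≡ μ k l ℤ.+ μ k′ l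
μ-+ k k′ []      = refl
μ-+ k k′ (n ∷ l) = trans (cong₂ ℤ._-_ (μ-+ (k ∘ (n ∷_)) (k′ ∘ (n ∷_)) l) (μ-+ k k′ l)) (inter (μ (k ∘ (n ∷_)) l) _ _ _)
  where
  inter : ∀ a b c d → (a ℤ.+ b) ℤ.- (c ℤ.+ d) ≡ (a ℤ.- c) ℤ.+ (b ℤ.- d)
  inter = solve-∀

μ-ζ : ∀ k l → μ (ζ k) l ≡ k l
μ-ζ k []      = ℤ.+-identityʳ _
μ-ζ k (n ∷ l) = begin
  μ (λ m → ζ k (n ∷ m)) l ℤ.- μ (ζ k) l
    ≡⟨ cong (ℤ._- μ (ζ k) l) (μ-cong l (λ {m} _ → sumℤ-sublists-∷ k n m)) ⟩
  μ (λ m → ζ k m ℤ.+ ζ (k ∘ (n ∷_)) m) l ℤ.- μ (ζ k) l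
    ≡⟨ cong (ℤ._- μ (ζ k) l) (μ-+ (ζ k) (ζ (k ∘ (n ∷_))) l) ⟩
  μ (ζ k) l ℤ.+ μ (ζ (k ∘ (n ∷_))) l ℤ.- μ (ζ k) l
    ≡⟨ cancel (μ (ζ k) l) _ ⟩
  μ (ζ (k ∘ (n ∷_))) l
    ≡⟨ μ-ζ (k ∘ (n ∷_)) l ⟩
  k (n ∷ l) ∎
  where
  open ≡-Reasoning
  cancel : ∀ a b → a ℤ.+ b ℤ.- a ≡ b
  cancel = solve-∀

mobius : (FinSet → ℤ) → FinSet → ℤ
mobius g F = sumℤ (map (λ E → -1ℤ ℤ.^ ∣ F ∖ E ∣ ℤ.* g E) (subsets F))

sign : List ℕ → List ℕ → ℤ
sign l m = -1ℤ ℤ.^ length (filter (λ n → ¬? (n ∈? m)) l)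

filter-cong : ∀ {P Q : ℕ → Set} (P? : Decidable P) (Q? : Decidable Q) xs →
  (∀ {x} → x ∈ xs → P x → Q x) → (∀ {x} → x ∈ xs → Q x → P x) → filter P? xs ≡ filter Q? xs
filter-cong P? Q? []       f g = refl
filter-cong P? Q? (x ∷ xs) f g with P? x | Q? x
... | yes a | yes b = cong (x ∷_) (filter-cong P? Q? xs (f ∘ there) (g ∘ there))
... | yes a | no ¬b = contradiction (f (here refl) a) ¬b
... | no ¬a | yes b = contradiction (g (here refl) b) ¬a
... | no ¬a | no ¬b = filter-cong P? Q? xs (f ∘ there) (g ∘ there)

sign-skip : ∀ {n l m} → ¬ (n ∈ m) → sign (n ∷ l) m ≡ ℤ.- sign l m
sign-skip {n} {l} {m} n∉ = trans
  (cong (λ xs → -1ℤ ℤ.^ length xs) (List.filter-accept (λ i → ¬? (i ∈? m)) {xs = l} n∉))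
  (ℤ.-1*i≡-i (sign l m))

sign-keep : ∀ {n l m} → ¬ (n ∈ l) → sign (n ∷ l) (n ∷ m) ≡ sign l m
sign-keep {n} {l} {m} n∉ = cong (λ xs → -1ℤ ℤ.^ length xs) (trans
  (List.filter-reject (λ i → ¬? (i ∈? n ∷ m)) {xs = l} (λ ¬i → ¬i (here refl)))
  (filter-cong (λ i → ¬? (i ∈? n ∷ m)) (λ i → ¬? (i ∈? m)) l (λ _ p → p ∘ there)
    (λ { i p (here refl) → n∉ i ; i p (there j) → p j })))

-- Divide the sublists of n ∷ l by whether they contain n. Without n one more element is missing and
-- the sign flips; with n the sign is the one relative to l.
signed-sum : ∀ k {l} → Sorted l → sumℤ (map (λ m → sign l m ℤ.* k m) (sublists l)) ≡ μ k l
signed-sum k []                = trans (ℤ.+-identityʳ _) (ℤ.*-identityˡ (k []))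
signed-sum k {n ∷ l} (a ∷ s) = begin
  sumℤ (map (λ m → sign (n ∷ l) m ℤ.* k m) (sublists (n ∷ l)))
    ≡⟨ sumℤ-sublists-∷ (λ m → sign (n ∷ l) m ℤ.* k m) n l ⟩
  sumℤ (map (λ m → sign (n ∷ l) m ℤ.* k m) (sublists l)) ℤ.+
  sumℤ (map (λ m → sign (n ∷ l) (n ∷ m) ℤ.* k (n ∷ m)) (sublists l))
    ≡⟨ cong₂ ℤ._+_
        (trans (sumℤ-map-≡ (sublists l) (λ {m} i → trans (cong (ℤ._* k m) (sign-skip {n} {l} (sorted-∉ a i)))
                                                         (sym (ℤ.neg-distribˡ-* (sign l m) (k m)))))
               (sumℤ-map-neg (λ m → sign l m ℤ.* k m) (sublists l)))
        (sumℤ-map-≡ (sublists l) (λ {m} _ → cong (ℤ._* k (n ∷ m))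
          (sign-keep {n} {l} {m} (λ i → <-irrefl refl (All.lookup a i))))) ⟩
  ℤ.- sumℤ (map (λ m → sign l m ℤ.* k m) (sublists l)) ℤ.+
  sumℤ (map (λ m → sign l m ℤ.* k (n ∷ m)) (sublists l))
    ≡⟨ cong₂ (λ y z → ℤ.- y ℤ.+ z) (signed-sum k s) (signed-sum (k ∘ (n ∷_)) s) ⟩
  ℤ.- μ k l ℤ.+ μ (k ∘ (n ∷_)) l
    ≡⟨ ℤ.+-comm (ℤ.- μ k l) _ ⟩
  μ (k ∘ (n ∷_)) l ℤ.- μ k l ∎
  where open ≡-Reasoning

restrict-sublist : ∀ F {m} → m ∈ sublists (elements F) → restrict F m ≡ supp m
restrict-sublist F {m} i = sym (supp-≡
  (All.tabulate (λ k → ∈-filter⁺ (_∈? m) (All.lookup (sublists-⊆ (elements F) i) k) k))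
  (All.tabulate (λ k → proj₂ (∈-filter⁻ (_∈? m) {xs = elements F} k))))

mobius-μ : ∀ g F → mobius g F ≡ μ (g ∘ supp) (elements F)
mobius-μ g F = trans (cong sumℤ (sym (List.map-∘ (sublists (elements F)))))
  (trans (sumℤ-map-≡ (sublists (elements F)) (λ {m} i → cong₂ ℤ._*_
            (trans (cong (λ E → -1ℤ ℤ.^ ∣ F ∖ E ∣) (restrict-sublist F i))
                   (cong (sign (elements F)) (elements-supp (sublists-sorted (sortedness F) i))))
            (cong g (restrict-sublist F i))))
         (signed-sum (g ∘ supp) (sortedness F)))

Σ⊆ : (FinSet → ℤ) → FinSet → ℤ
Σ⊆ k F = ζ (k ∘ supp) (elements F)

supp-sublist : ∀ {F m} → m ∈ sublists (elements F) → elements (supp m) ≡ m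
supp-sublist {F} i = elements-supp (sublists-sorted (sortedness F) i)

Σ⊆-mobius : ∀ g F → Σ⊆ (mobius g) F ≡ g F
Σ⊆-mobius g F = trans
  (sumℤ-map-≡ (sublists (elements F)) (λ {m} i → trans (mobius-μ g (supp m)) (cong (μ (g ∘ supp)) (supp-sublist {F} i))))
  (trans (ζ-μ (g ∘ supp) (elements F)) (cong g (supp-elements F)))

mobius-Σ⊆ : ∀ k F → mobius (Σ⊆ k) F ≡ k F
mobius-Σ⊆ k F = trans (mobius-μ (Σ⊆ k) F)
  (trans (μ-cong (elements F) (λ {m} i → cong (ζ (k ∘ supp)) (supp-sublist {F} i)))
  (trans (μ-ζ (k ∘ supp) (elements F)) (cong k (supp-elements F))))

φ-Σ⊆ν : ∀ X F → ℤ.+ φ X F ≡ Σ⊆ (λ E → ℤ.+ ν X E) F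
φ-Σ⊆ν X F = trans (cong ℤ.+_ (φ-ν X F)) (sym (sumℤ-map-pos (λ m → ν X (supp m)) (sublists (elements F))))

mobius-cong : ∀ {g h : FinSet → ℤ} → (∀ F → g F ≡ h F) → ∀ F → mobius g F ≡ mobius h F
mobius-cong e F = sumℤ-map-≡ (subsets F) (λ {E} _ → cong (λ z → -1ℤ ℤ.^ ∣ F ∖ E ∣ ℤ.* z) (e E))

mobius-φ : ∀ X F → mobius (λ E → ℤ.+ φ X E) F ≡ ℤ.+ ν X F
mobius-φ X F = trans (mobius-cong (φ-Σ⊆ν X) F) (mobius-Σ⊆ (λ E → ℤ.+ ν X E) F)

φ-determines-ν : ∀ {X Y} → (∀ F → φ X F ≡ φ Y F) → ∀ E → ν X E ≡ ν Y E
φ-determines-ν {X} {Y} e E = ℤ.+-injective (trans (sym (mobius-φ X E))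
  (trans (mobius-cong (λ F → cong ℤ.+_ (e F)) E) (mobius-φ Y E)))

-- Nonnegativity of Möbius transforms

-- Quantified over the sublists of a fixed list, so that an induction on the list can replace k by
-- its differences `Δ n k`.
MobiusNonneg : (List ℕ → ℤ) → List ℕ → Set
MobiusNonneg k l = ∀ m → m ∈ sublists l → 0ℤ ℤ.≤ μ k m

Δ : ℕ → (List ℕ → ℤ) → List ℕ → ℤ
Δ n k m = k (n ∷ m) ℤ.- k m

μ-- : ∀ k k′ l → μ (λ m → k m ℤ.- k′ m) l ≡ μ k l ℤ.- μ k′ l
μ-- k k′ []      = refl
μ-- k k′ (n ∷ l) = trans (cong₂ ℤ._-_ (μ-- (k ∘ (n ∷_)) (k′ ∘ (n ∷_)) l) (μ-- k k′ l)) (inter (μ (k ∘ (n ∷_)) l) _ _ _)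
  where
  inter : ∀ a b c d → (a ℤ.- b) ℤ.- (c ℤ.- d) ≡ (a ℤ.- c) ℤ.- (b ℤ.- d)
  inter = solve-∀

Δ-nonneg : ∀ k n l → MobiusNonneg k (n ∷ l) → MobiusNonneg (Δ n k) l
Δ-nonneg k n l p m i = subst (0ℤ ℤ.≤_) (sym (μ-- (k ∘ (n ∷_)) k m))
  (p (n ∷ m) (∈-++⁺ʳ (sublists l) (∈-map⁺ (n ∷_) i)))

tail-nonneg : ∀ k n l → MobiusNonneg k (n ∷ l) → MobiusNonneg k l
tail-nonneg k n l p m i = p m (∈-++⁺ˡ i)

*-nonneg : ∀ {i j} → 0ℤ ℤ.≤ i → 0ℤ ℤ.≤ j → 0ℤ ℤ.≤ i ℤ.* j
*-nonneg {ℤ.+ m} {ℤ.+ n} _ _ = subst (0ℤ ℤ.≤_) (ℤ.pos-* m n) (ℤ.+≤+ z≤n)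

-- A Leibniz rule: with Δ the difference in n, Δ(k k′) = k Δk′ + Δk k′ + Δk Δk′, and the induction
-- hypothesis applies to all three products.
MobiusNonneg-* : ∀ k k′ l → MobiusNonneg k l → MobiusNonneg k′ l → MobiusNonneg (λ m → k m ℤ.* k′ m) l
MobiusNonneg-* k k′ [] p q _ (here refl) = *-nonneg (p [] (here refl)) (q [] (here refl))
MobiusNonneg-* k k′ (n ∷ l) p q _ i with ∈-sublists-∷⁻ {n} {l} i
... | inj₁ j = MobiusNonneg-* k k′ l (tail-nonneg k n l p) (tail-nonneg k′ n l q) _ j
... | inj₂ (m , j , refl) = subst (0ℤ ℤ.≤_) (sym eq) (ℤ.+-mono-≤ (ℤ.+-mono-≤
    (MobiusNonneg-* k (Δ n k′) l (tail-nonneg k n l p) (Δ-nonneg k′ n l q) m j)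
    (MobiusNonneg-* (Δ n k) k′ l (Δ-nonneg k n l p) (tail-nonneg k′ n l q) m j))
    (MobiusNonneg-* (Δ n k) (Δ n k′) l (Δ-nonneg k n l p) (Δ-nonneg k′ n l q) m j))
  where
  open ≡-Reasoning
  expand : ∀ a a′ b b′ → a′ ℤ.* b′ ℤ.- a ℤ.* b ≡
           a ℤ.* (b′ ℤ.- b) ℤ.+ (a′ ℤ.- a) ℤ.* b ℤ.+ (a′ ℤ.- a) ℤ.* (b′ ℤ.- b)
  expand = solve-∀
  t₁ t₂ t₃ : List ℕ → ℤ
  t₁ m = k m ℤ.* Δ n k′ m
  t₂ m = Δ n k m ℤ.* k′ m
  t₃ m = Δ n k m ℤ.* Δ n k′ m
  eq : μ (λ m → k m ℤ.* k′ m) (n ∷ m) ≡ μ t₁ m ℤ.+ μ t₂ m ℤ.+ μ t₃ m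
  eq = begin
    μ (λ m → k m ℤ.* k′ m) (n ∷ m)
      ≡⟨ sym (μ-- (λ m → k (n ∷ m) ℤ.* k′ (n ∷ m)) (λ m → k m ℤ.* k′ m) m) ⟩
    μ (λ m → k (n ∷ m) ℤ.* k′ (n ∷ m) ℤ.- k m ℤ.* k′ m) m
      ≡⟨ μ-cong m (λ {m} _ → expand (k m) (k (n ∷ m)) (k′ m) (k′ (n ∷ m))) ⟩
    μ (λ m → t₁ m ℤ.+ t₂ m ℤ.+ t₃ m) m
      ≡⟨ μ-+ (λ m → t₁ m ℤ.+ t₂ m) t₃ m ⟩
    μ (λ m → t₁ m ℤ.+ t₂ m) m ℤ.+ μ t₃ m
      ≡⟨ cong (ℤ._+ μ t₃ m) (μ-+ t₁ t₂ m) ⟩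
    μ t₁ m ℤ.+ μ t₂ m ℤ.+ μ t₃ m ∎

-- A multiple of `h l`, because `l` is one of its own sublists. Unlike an arbitrary positive `h` it
-- has a nonnegative Möbius transform.
subsetProduct : (List ℕ → ℕ) → List ℕ → ℤ
subsetProduct h l = ℤ.+ product (map h (sublists l))

subsetProduct-∷ : ∀ h n m → subsetProduct h (n ∷ m) ≡ subsetProduct h m ℤ.* subsetProduct (h ∘ (n ∷_)) m
subsetProduct-∷ h n m = trans (cong ℤ.+_ (trans
  (cong product (List.map-++ h (sublists m) (map (n ∷_) (sublists m))))
  (trans (product-++ (map h (sublists m)) _)
    (cong (λ z → product (map h (sublists m)) * product z) (sym (List.map-∘ {g = h} {f = n ∷_} (sublists m)))))))
  (ℤ.pos-* (product (map h (sublists m))) _)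

-- The transform of the constant 1 vanishes except at the empty list, so only the value there is
-- affected.
pred-nonneg : ∀ k l → 1ℤ ℤ.≤ k [] → MobiusNonneg k l → MobiusNonneg (λ m → k m ℤ.- 1ℤ) l
pred-nonneg k l p q []      i = ℤ.i≤j⇒0≤j-i p
pred-nonneg k l p q (n ∷ m) i = subst (0ℤ ℤ.≤_)
  (sym (trans (cong₂ ℤ._-_ (μ-- (k ∘ (n ∷_)) (const 1ℤ) m) (μ-- k (const 1ℤ) m))
              (cancel (μ (k ∘ (n ∷_)) m) (μ k m) (μ (const 1ℤ) m)))) (q (n ∷ m) i)
  where
  cancel : ∀ a b c → (a ℤ.- c) ℤ.- (b ℤ.- c) ≡ a ℤ.- b
  cancel = solve-∀

-- The difference of the product at n ∷ m and at m is the product at m times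
-- (the product of h ∘ (n ∷_) at m) − 1.

subsetProduct-nonneg : ∀ h → (∀ m → 0 < h m) → ∀ l → MobiusNonneg (subsetProduct h) l
subsetProduct-nonneg h p []      _ (here refl) = ℤ.+≤+ z≤n
subsetProduct-nonneg h p (n ∷ l) _ i with ∈-sublists-∷⁻ {n} {l} i
... | inj₁ j              = subsetProduct-nonneg h p l _ j
... | inj₂ (m , j , refl) = subst (0ℤ ℤ.≤_)
  (trans (μ-cong m (λ {m} _ → trans (distrib (subsetProduct h m) (subsetProduct (h ∘ (n ∷_)) m))
                                    (cong (ℤ._- subsetProduct h m) (sym (subsetProduct-∷ h n m)))))
         (μ-- (subsetProduct h ∘ (n ∷_)) (subsetProduct h) m))
  (MobiusNonneg-* (subsetProduct h) (λ m → subsetProduct (h ∘ (n ∷_)) m ℤ.- 1ℤ) l (subsetProduct-nonneg h p l)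
    (pred-nonneg (subsetProduct (h ∘ (n ∷_))) l (ℤ.+≤+ (subst (1 ≤_) (sym (*-identityʳ (h (n ∷ [])))) (p (n ∷ []))))
                   (subsetProduct-nonneg (h ∘ (n ∷_)) (p ∘ (n ∷_)) l)) m j)
  where
  distrib : ∀ a b → a ℤ.* (b ℤ.- 1ℤ) ≡ a ℤ.* b ℤ.- a
  distrib = solve-∀

mobius-supp : ∀ g F {m} → m ∈ sublists (elements F) → mobius g (supp m) ≡ μ (g ∘ supp) m
mobius-supp g F {m} i = trans (mobius-μ g (supp m)) (cong (μ (g ∘ supp)) (supp-sublist {F} i))

mobius-* : ∀ {g h} → (∀ F → 0ℤ ℤ.≤ mobius g F) → (∀ F → 0ℤ ℤ.≤ mobius h F) →
           ∀ F → 0ℤ ℤ.≤ mobius (λ E → g E ℤ.* h E) F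
mobius-* {g} {h} p q F = subst (0ℤ ℤ.≤_) (sym (mobius-μ (λ E → g E ℤ.* h E) F))
  (MobiusNonneg-* (g ∘ supp) (h ∘ supp) (elements F) (λ m i → subst (0ℤ ℤ.≤_) (mobius-supp g F i) (p (supp m)))
    (λ m i → subst (0ℤ ℤ.≤_) (mobius-supp h F i) (q (supp m))) (elements F) (self (elements F)))
  where
  self : ∀ l → l ∈ sublists l
  self []      = here refl
  self (n ∷ l) = ∈-++⁺ʳ (sublists l) (∈-map⁺ (n ∷_) (self l))

-- Sets with prescribed counts

largest : FinSet → ℕ
largest F = foldr _⊔_ 0 (elements F)

Inhabited : FinSet → Set
Inhabited F = ∃[ i ] (i ∈ elements F)

largest-∈ : ∀ {F} → Inhabited F → largest F ∈ elements F
largest-∈ {F} (_ , i) = go (elements F) i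
  where
  go : ∀ xs {i} → i ∈ xs → foldr _⊔_ 0 xs ∈ xs
  go (x ∷ [])     _ = here (⊔-identityʳ x)
  go (x ∷ y ∷ xs) _ = [ here , (λ e → there (subst (_∈ y ∷ xs) (sym e) (go (y ∷ xs) (here refl)))) ]′
                        (⊔-sel x (foldr _⊔_ 0 (y ∷ xs)))

-- Repeating one component gives tuples of different lengths with one support. The largest is
-- repeated because only finitely many finite sets have a given largest element; repetitions of the
-- least could make the degree in one indeterminate unbounded.
repr : FinSet → ℕ → Tuple
repr F j = replicate j (largest F) ++ elements F

length-repr : ∀ F j → length (repr F j) ≡ j + length (elements F)
length-repr F j = trans (List.length-++ (replicate j (largest F))) (cong (_+ length (elements F)) (List.length-replicate j))

repr-⊆ : ∀ {F} j → Inhabited F → repr F j ⊆ᴸ elements F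
repr-⊆ {F} j i = All.++⁺ (All.replicate⁺ j (largest-∈ {F} i)) (All.tabulate id)

⊆-repr : ∀ F j → elements F ⊆ᴸ repr F j
⊆-repr F j = All.tabulate (∈-++⁺ʳ (replicate j (largest F)))

supp-repr : ∀ {F} j → Inhabited F → supp (repr F j) ≡ F
supp-repr {F} j i = supp-≡ {repr F j} {F} (repr-⊆ {F} j i) (⊆-repr F j)

repr-injective : ∀ {F i j} → repr F i ≡ repr F j → i ≡ j
repr-injective {F} {i} {j} e = +-cancelʳ-≡ (length (elements F)) i j
  (trans (sym (length-repr F i)) (trans (cong length e) (length-repr F j)))

supp-inhabited : ∀ {x} → x ≢ [] → Inhabited (supp x)
supp-inhabited {[]}    ≢[] = contradiction refl ≢[]
supp-inhabited {n ∷ x} _   = n , ∈-supp⁺ {n ∷ x} (here refl)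

-- Summation over all subsets of {0, ..., n} stands in for a maximum, as any upper bound will do.
boundBelow : (FinSet → ℕ) → ℕ → ℕ
boundBelow f n = sum (map (f ∘ supp) (sublists (upTo (suc n))))

≤boundBelow : ∀ f n F → All (_≤ n) (elements F) → f F ≤ boundBelow f n
≤boundBelow f n F b = subst (λ E → f E ≤ boundBelow f n) (supp-elements F)
  (∈⇒≤sum (f ∘ supp) (sublists (upTo (suc n))) (sorted-⊆⇒sublist (sortedness F)
    (AllPairs.applyUpTo⁺₁ id _ (λ lt _ → lt)) (All.map (λ le → ∈-upTo⁺ (s≤s le)) b)))

position : Tuple → List Tuple → ℕ
position x []       = 0
position x (y ∷ ys) = if does (List.≡-dec _≟_ x y) then 0 else suc (position x ys)

position-< : ∀ {x ys} → x ∈ ys → position x ys < length ys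
position-< {x} {y ∷ ys} i with List.≡-dec _≟_ x y | i
... | yes _ | _       = s≤s z≤n
... | no x≢ | here e  = contradiction e x≢
... | no _  | there j = s≤s (position-< j)

position-injective : ∀ {x y zs} → x ∈ zs → y ∈ zs → position x zs ≡ position y zs → x ≡ y
position-injective {x} {y} {z ∷ zs} i j e with List.≡-dec _≟_ x z | List.≡-dec _≟_ y z
... | yes p | yes q = trans p (sym q)
... | yes _ | no _  = contradiction e λ ()
... | no _  | yes _ = contradiction e λ ()
... | no p  | no q  = position-injective (tail p i) (tail q j) (suc-injective e)
  where
  tail : ∀ {x} → x ≢ z → x ∈ z ∷ zs → x ∈ zs
  tail p (here e)  = contradiction e p
  tail p (there k) = k

position-surjective : ∀ {ys} → Unique ys → ∀ {j} → j < length ys → ∃[ x ] (x ∈ ys × position x ys ≡ j)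
position-surjective {y ∷ ys} (a ∷ u) {zero}  _        = y , here refl ,
  cong (if_then 0 else suc (position y ys)) (dec-true (List.≡-dec _≟_ y y) refl)
position-surjective {y ∷ ys} (a ∷ u) {suc j} (s≤s lt) with position-surjective u lt
... | x , i , e = x , there i ,
  trans (cong (if_then 0 else suc (position x ys)) (dec-false (List.≡-dec _≟_ x y)
    (λ { refl → All.lookup a i refl }))) (cong suc e)

indicator-≢ : ∀ {x t} → x ≢ t → indicator x t ≡ 0
indicator-≢ {x} {t} ≢ = cong (if_then 1 else 0) (dec-false (x ≟ t) ≢)

indicator-≤ : ∀ x t → indicator x t ≤ 1
indicator-≤ x t with does (x ≟ t)
... | true  = ≤-refl
... | false = z≤n

occurrences-++ : ∀ x y t → occurrences (x ++ y) t ≡ occurrences x t + occurrences y t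
occurrences-++ x y t = trans (cong length (List.filter-++ (_≟ t) x y)) (List.length-++ (filter (_≟ t) x))

occurrences-unique : ∀ {xs} → Unique xs → ∀ t → occurrences xs t ≤ 1
occurrences-unique                []      t = z≤n
occurrences-unique {x ∷ xs} (a ∷ u) t = ≤-trans (≤-reflexive (occurrences-∷ x xs t)) (go (t ∈? xs))
  where
  go : Dec (t ∈ xs) → indicator x t + occurrences xs t ≤ 1
  go (yes i) = subst (λ z → z + occurrences xs t ≤ 1) (sym (indicator-≢ (All.lookup a i))) (occurrences-unique u t)
  go (no ∉)  = subst (_≤ 1) (sym (trans (cong (indicator x t +_) (occurrences-∉ xs ∉)) (+-identityʳ _))) (indicator-≤ x t)

posPart negPart : ℤ → ℕ
posPart (ℤ.+ n)    = n
posPart ℤ.-[1+ n ] = 0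
negPart (ℤ.+ n)    = 0
negPart ℤ.-[1+ n ] = suc n

pos-neg : ∀ z → ℤ.+ posPart z ℤ.- ℤ.+ negPart z ≡ z
pos-neg (ℤ.+ n)    = ℤ.+-identityʳ _
pos-neg ℤ.-[1+ n ] = refl

negPart-nonneg : ∀ {z} → 0ℤ ℤ.≤ z → negPart z ≡ 0
negPart-nonneg (ℤ.+≤+ _) = refl

module _ (em : ExcludedMiddle 0ℓ) where

  -- Excluded middle turns the predicate into the Boolean function that a subset has to be.
  comprehension : (P : Tuple → Set) → ¬ P [] →
    (∀ n → ∃[ h ] (∀ x → P x → All (_≤ n) x → length x ≤ h)) → 𝕎
  comprehension P ¬[] fin = record
    { mem      = λ x → does (em {P x})
    ; no-[]    = λ e → ¬[] (does-true em e)
    ; finitary = λ n → proj₁ (fin n) , λ x l b e → ≤⇒≯ (proj₂ (fin n) x (does-true em e) b) l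
    }

  module _ (lo n : FinSet → ℕ) where

    -- The offset `lo` shifts the numbers of repetitions, so that several blocks can be kept
    -- disjoint (`block-disjoint`).
    InBlock : Tuple → Set
    InBlock y = y ≢ [] × ∃[ j ] ((lo (supp y) ≤ j × j < lo (supp y) + n (supp y)) × repr (supp y) j ≡ y)

    private
      lengthBound : FinSet → ℕ
      lengthBound F = (lo F + n F) + length (elements F)

    block : 𝕎
    block = comprehension InBlock (λ (p , _) → p refl)
      (λ t → boundBelow lengthBound t , λ { y (_ , j , (_ , lt) , e) b → ≤-trans
        (≤-trans (≤-reflexive (trans (cong length (sym e)) (length-repr (supp y) j)))
          (+-monoˡ-≤ (length (elements (supp y))) (<⇒≤ lt)))
        (≤boundBelow lengthBound t (supp y) (All.tabulate (All.lookup b ∘ ∈-supp⁻))) })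

    ∈-block⁻ : ∀ {y} → y ∈ʷ block → InBlock y
    ∈-block⁻ = does-true em

    ∈-block⁺ : ∀ {F j} → Inhabited F → lo F ≤ j → j < lo F + n F → repr F j ∈ʷ block
    ∈-block⁺ {F} {j} i a b = dec-true em ( nonempty , j
                                         , subst (λ E → lo E ≤ j × j < lo E + n E) (sym e) (a , b)
                                         , cong (λ E → repr E j) e)
      where
      e = supp-repr j i
      nonempty : repr F j ≢ []
      nonempty r with () ← subst (proj₁ i ∈_) r (All.lookup (⊆-repr F j) (proj₂ i))

    -- An indeterminate other than that of the largest component occurs at most once.

    block-degreeBounded : DegreeBounded block
    block-degreeBounded t = suc (boundBelow lengthBound t) , λ y p → bounded y (∈-block⁻ p)
      where
      bounded : ∀ y → InBlock y → occurrences y t ≤ suc (boundBelow lengthBound t)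
      bounded y (_ , j , (_ , lt) , e) with t ≟ largest (supp y)
      ... | yes refl = ≤-trans (List.length-filter (_≟ t) y) (≤-trans
              (≤-trans (≤-reflexive (trans (cong length (sym e)) (length-repr (supp y) j)))
                       (+-monoˡ-≤ (length (elements (supp y))) (<⇒≤ lt)))
              (≤-trans (≤boundBelow lengthBound t (supp y) (All.tabulate (below-max (elements (supp y))))) (n≤1+n _)))
      ... | no t≢ = subst (λ z → occurrences z t ≤ _) e
              (≤-trans (≤-reflexive (trans (occurrences-++ (replicate j (largest (supp y))) (elements (supp y)) t)
                (cong (_+ occurrences (elements (supp y)) t)
                  (occurrences-∉ (replicate j (largest (supp y)))
                    (λ i → t≢ (All.lookup (All.replicate⁺ {P = _≡ largest (supp y)} j refl) i))))))
              (≤-trans (occurrences-unique (AllPairs.map <⇒≢ (sortedness (supp y))) t) (s≤s z≤n)))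

  block-disjoint : ∀ lo n lo′ n′ → (∀ F → lo F + n F ≤ lo′ F) → Disjoint (block lo n) (block lo′ n′)
  block-disjoint lo n lo′ n′ le y p q =
    let _ , j  , (_ , lt) , e  = ∈-block⁻ lo n p
        _ , j′ , (ge , _) , e′ = ∈-block⁻ lo′ n′ q
    in contradiction (repr-injective {supp y} {j} {j′} (trans e (sym e′)))
         (<⇒≢ (<-≤-trans lt (≤-trans (le (supp y)) ge)))

  ν-block : ∀ lo n {E} → Inhabited E → ν (block lo n) E ≡ n E
  ν-block lo n {E} i = trans (enum-length (withSupport-enum (block lo n) E)
      (enum-map (λ j → repr E (lo E + j)) (λ _ _ e → +-cancelˡ-≡ (lo E) _ _ (repr-injective {E} e))
        (upTo-enum (n E)))
      (λ { (p , refl) → to (∈-block⁻ lo n p) })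
      (λ { (j , lt , refl) → ∈-block⁺ lo n i (m≤m+n (lo E) j) (+-monoʳ-< (lo E) lt) , supp-repr (lo E + j) i }))
    (trans (List.length-map (λ j → repr E (lo E + j)) (upTo (n E))) (List.length-upTo (n E)))
    where
    to : ∀ {y} → InBlock lo n y → ∃[ j ] (j < n (supp y) × repr (supp y) (lo (supp y) + j) ≡ y)
    to {y} (_ , j , (ge , lt) , e) = j ∸ lo (supp y)
      , +-cancelˡ-< (lo (supp y)) _ _ (subst (_< lo (supp y) + n (supp y)) (sym (m+[n∸m]≡n ge)) lt)
      , trans (cong (repr (supp y)) (m+[n∸m]≡n ge)) e

  ν-empty : ∀ X {E} → ¬ Inhabited E → ν X E ≡ 0
  ν-empty X {E} ¬i = enum-length (withSupport-enum X E) (enum-self {xs = []} [])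
    (λ { {[]}    (p , _)    → contradiction p (𝕎.no-[] X)
       ; {y ∷ x} (p , refl) → contradiction (y , ∈-supp⁺ {y ∷ x} (here refl)) ¬i }) (λ ())

  -- The bijection of X with a block lists, for each support, its tuples in X.

  module _ (X : 𝕎) (lo n : FinSet → ℕ) (n≡ν : ∀ E → n E ≡ ν X E) where

    private
      pos : Tuple → ℕ
      pos x = position x (withSupport X (supp x))

      listed : ∀ {x} → x ∈ʷ X → x ∈ withSupport X (supp x)
      listed p = complete (withSupport-enum X _) (p , refl)

      inhabited : ∀ {x} → x ∈ʷ X → Inhabited (supp x)
      inhabited {x} p = supp-inhabited {x} (λ { refl → 𝕎.no-[] X p })

    toBlock : Tuple → Tuple
    toBlock x = repr (supp x) (lo (supp x) + pos x)

    toBlock-preserves : SupportPreserving X toBlock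
    toBlock-preserves x p i = mk⇔ (∈-supp⁻ {x} ∘ All.lookup (repr-⊆ {supp x} (lo (supp x) + pos x) (inhabited p)))
                                  (All.lookup (⊆-repr (supp x) (lo (supp x) + pos x)) ∘ ∈-supp⁺ {x})

    toBlock-injective : InjectiveOn X toBlock
    toBlock-injective {x} {y} p q e = position-injective (listed p) (subst (λ E → y ∈ withSupport X E) (sym s) (listed q))
      (+-cancelˡ-≡ (lo (supp x)) (pos x) (position y (withSupport X (supp x))) (repr-injective {supp x}
        (trans e (cong (λ E → repr E (lo E + position y (withSupport X E))) (sym s)))))
      where
      s : supp x ≡ supp y
      s = trans (sym (supp-repr {supp x} (lo (supp x) + pos x) (inhabited p)))
            (trans (cong supp e) (supp-repr {supp y} (lo (supp y) + pos y) (inhabited q)))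

    toBlock-image : IsImage toBlock X (block lo n)
    toBlock-image y = mk⇔ (λ p → to (∈-block⁻ lo n p))
      λ { (x , p , refl) → ∈-block⁺ lo n (inhabited p) (m≤m+n _ _)
           (+-monoʳ-< (lo (supp x)) (subst (pos x <_) (sym (n≡ν (supp x))) (position-< (listed p)))) }
      where
      to : InBlock lo n y → ∃[ x ] (x ∈ʷ X × toBlock x ≡ y)
      to (_ , j , (ge , lt) , e) =
        let x , m , r = position-surjective (unique (withSupport-enum X (supp y)))
              (+-cancelˡ-< (lo (supp y)) (j ∸ lo (supp y)) _
                (subst₂ (λ a b → a < lo (supp y) + b) (sym (m+[n∸m]≡n ge)) (n≡ν (supp y)) lt))
            p , s = sound (withSupport-enum X (supp y)) m
        in x , p , trans (cong (λ E → repr E (lo E + position x (withSupport X E))) s)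
                     (trans (cong (repr (supp y)) (trans (cong (lo (supp y) +_) r) (m+[n∸m]≡n ge))) e)

    φ-block : ∀ F → φ (block lo n) F ≡ φ X F
    φ-block F = sym (φ-image {X} {block lo n} {toBlock} toBlock-injective toBlock-preserves toBlock-image F)

  module _ (k : FinSet → ℤ) where

    posBlock negBlock : 𝕎
    posBlock = block (const 0) (posPart ∘ mobius k)
    negBlock = block (const 0) (negPart ∘ mobius k)

    -- The positive and negative parts of the Möbius transform are realized separately as numbers of
    -- tuples by support. At the empty set nothing can be realized, as no tuple is empty; hence the
    -- hypothesis.
    φ-posBlock-negBlock : k (supp []) ≡ 0ℤ → ∀ F → ℤ.+ φ posBlock F ℤ.- ℤ.+ φ negBlock F ≡ k F
    φ-posBlock-negBlock z F = begin
      ℤ.+ φ posBlock F ℤ.- ℤ.+ φ negBlock F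
        ≡⟨ cong₂ ℤ._-_ (φ-Σ⊆ν posBlock F) (φ-Σ⊆ν negBlock F) ⟩
      Σ⊆ (λ E → ℤ.+ ν posBlock E) F ℤ.- Σ⊆ (λ E → ℤ.+ ν negBlock E) F
        ≡⟨ sym (sumℤ-map-- (λ m → ℤ.+ ν posBlock (supp m)) (λ m → ℤ.+ ν negBlock (supp m)) (sublists (elements F))) ⟩
      Σ⊆ (λ E → ℤ.+ ν posBlock E ℤ.- ℤ.+ ν negBlock E) F
        ≡⟨ sumℤ-map-≡ (sublists (elements F)) (λ {m} _ → pointwise m) ⟩
      Σ⊆ (mobius k) F
        ≡⟨ Σ⊆-mobius k F ⟩
      k F ∎
      where
      open ≡-Reasoning
      pointwise : ∀ m → ℤ.+ ν posBlock (supp m) ℤ.- ℤ.+ ν negBlock (supp m) ≡ mobius k (supp m)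
      pointwise []      = trans (cong₂ (λ a b → ℤ.+ a ℤ.- ℤ.+ b) (ν-empty posBlock {supp []} (λ ()))
        (ν-empty negBlock {supp []} (λ ())))
        (sym (trans (mobius-μ k (supp [])) z))
      pointwise (n ∷ m) = trans (cong₂ (λ a b → ℤ.+ a ℤ.- ℤ.+ b)
          (ν-block (const 0) (posPart ∘ mobius k) i) (ν-block (const 0) (negPart ∘ mobius k) i))
        (pos-neg (mobius k (supp (n ∷ m))))
        where
        i : Inhabited (supp (n ∷ m))
        i = n , ∈-supp⁺ {n ∷ m} (here refl)

    φ-negBlock : (∀ F → 0ℤ ℤ.≤ mobius k F) → ∀ F → φ negBlock F ≡ 0
    φ-negBlock p F = trans (φ-same {negBlock} {∅}
      (λ y q → let _ , j , (_ , lt) , _ = ∈-block⁻ (const 0) (negPart ∘ mobius k) q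
               in contradiction (subst (j <_) (negPart-nonneg (p (supp y))) lt) λ ()) (λ _ ()) F) (φ-∅ F)

-- Products

∈-｛｝⁻ : ∀ n x → x ∈ʷ ｛ n ｝ → x ≡ n ∷ []
∈-｛｝⁻ n x = does-true (List.≡-dec _≟_ x (n ∷ []))

∈-｛｝⁺ : ∀ n → (n ∷ []) ∈ʷ ｛ n ｝
∈-｛｝⁺ n = dec-true (List.≡-dec _≟_ (n ∷ []) (n ∷ [])) refl

multipliable-｛｝ : ∀ A n → Multipliable A ｛ n ｝
multipliable-｛｝ A n {a} {a′} {b} {b′} _ _ p q e with ∈-｛｝⁻ n b p | ∈-｛｝⁻ n b′ q
... | refl | refl = cong (_, n ∷ []) (List.∷ʳ-injectiveˡ a a′ e)

φ-｛｝-∈ : ∀ {n F} → n ∈ elements F → φ ｛ n ｝ F ≡ 1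
φ-｛｝-∈ {n} {F} i = enum-length (tuplesIn-enum ｛ n ｝ F) (enum-self {xs = (n ∷ []) ∷ []} ([] ∷ []))
  (λ {x} (p , _) → here (∈-｛｝⁻ n x p)) (λ { (here refl) → ∈-｛｝⁺ n , i ∷ [] })

φ-｛｝-∉ : ∀ {n F} → ¬ (n ∈ elements F) → φ ｛ n ｝ F ≡ 0
φ-｛｝-∉ {n} {F} n∉ = enum-length (tuplesIn-enum ｛ n ｝ F) (enum-self {xs = []} [])
  (λ {x} (p , s) → contradiction (All.lookup (subst (_⊆ᴸ elements F) (∈-｛｝⁻ n x p) s) (here refl)) n∉) (λ ())

-- The components 0 and 1 are the delimiters of the prefix code, so `⊗` is multiplicative on these
-- sets. They are enough by `φ-ext-big` for equinumerosities and by `AE-big` for fine ultrafilters.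
record Big (F : FinSet) : Set where
  constructor big
  field
    0∈ : 0 ∈ elements F
    1∈ : 1 ∈ elements F

Big? : Decidable Big
Big? F = map′ (λ (i , j) → big i j) (λ (big i j) → i , j) ((0 ∈? elements F) ×-dec (1 ∈? elements F))

-- Its counting function is the characteristic function of `Big`.
corner : 𝕎
corner = ｛ 0 ｝ ×ʷ ｛ 1 ｝

φ-corner : ∀ F → φ corner F ≡ φ ｛ 0 ｝ F * φ ｛ 1 ｝ F
φ-corner = φ-×ʷ ｛ 0 ｝ ｛ 1 ｝ (multipliable-｛｝ ｛ 0 ｝ 1)

φ-corner-big : ∀ {F} → Big F → φ corner F ≡ 1
φ-corner-big {F} (big i j) = trans (φ-corner F) (cong₂ _*_ (φ-｛｝-∈ {0} {F} i) (φ-｛｝-∈ {1} {F} j))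

φ-corner-small : ∀ {F} → ¬ Big F → φ corner F ≡ 0
φ-corner-small {F} ¬b with 0 ∈? elements F | 1 ∈? elements F
... | yes i | yes j = contradiction (big i j) ¬b
... | no i  | _     = trans (φ-corner F) (cong (_* φ ｛ 1 ｝ F) (φ-｛｝-∉ {0} {F} i))
... | yes _ | no j  = trans (φ-corner F) (trans (cong (φ ｛ 0 ｝ F *_) (φ-｛｝-∉ {1} {F} j)) (*-zeroʳ (φ ｛ 0 ｝ F)))

-- Equinumerous with X by (UP), while every tuple now contains 0 and 1.
adjoin : 𝕎 → 𝕎
adjoin X = X ×ʷ ｛ 0 ｝ ×ʷ ｛ 1 ｝

φ-adjoin : ∀ X F → φ (adjoin X) F ≡ φ X F * φ corner F
φ-adjoin X F = trans (φ-×ʷ (X ×ʷ ｛ 0 ｝) ｛ 1 ｝ (multipliable-｛｝ (X ×ʷ ｛ 0 ｝) 1) F)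
  (trans (cong (_* φ ｛ 1 ｝ F) (φ-×ʷ X ｛ 0 ｝ (multipliable-｛｝ X 0) F))
  (trans (*-assoc (φ X F) (φ ｛ 0 ｝ F) (φ ｛ 1 ｝ F)) (cong (φ X F *_) (sym (φ-corner F)))))

φ-adjoin-big : ∀ X {F} → Big F → φ (adjoin X) F ≡ φ X F
φ-adjoin-big X {F} b = trans (φ-adjoin X F) (trans (cong (φ X F *_) (φ-corner-big {F} b)) (*-identityʳ (φ X F)))

φ-adjoin-small : ∀ X {F} → ¬ Big F → φ (adjoin X) F ≡ 0
φ-adjoin-small X {F} b = trans (φ-adjoin X F) (trans (cong (φ X F *_) (φ-corner-small {F} b)) (*-zeroʳ (φ X F)))

adjoin-components : ∀ X {x} → x ∈ʷ adjoin X → 0 ∈ x × 1 ∈ x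
adjoin-components X {x} p with ∈-×ʷ⁻ {X ×ʷ ｛ 0 ｝} {｛ 1 ｝} {x} p
... | y , z , (q , r) , refl with ∈-×ʷ⁻ {X} {｛ 0 ｝} {y} q | ∈-｛｝⁻ 1 z r
... | w , v , (_ , s) , refl | refl with ∈-｛｝⁻ 0 v s
... | refl = ∈-++⁺ˡ (∈-++⁺ʳ w (here refl)) , ∈-++⁺ʳ (w ++ 0 ∷ []) (here refl)

-- A prefix code: the leading zeros announce the length.  Hence products with
-- encoded sets are always multipliable; supports are kept if they contain 0 and 1.

announce : Tuple → Tuple
announce x = replicate (length x) 0 ++ 1 ∷ x

zeros-injective : ∀ m n {u v : Tuple} → replicate m 0 ++ 1 ∷ u ≡ replicate n 0 ++ 1 ∷ v → m ≡ n × u ≡ v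
zeros-injective zero    zero    refl = refl , refl
zeros-injective (suc m) (suc n) e    =
  let p , q = zeros-injective m n (List.∷-injectiveʳ e) in cong suc p , q
zeros-injective zero    (suc n) ()
zeros-injective (suc m) zero    ()

++-cancel-length : ∀ {x y u v : Tuple} → length x ≡ length y → x ++ u ≡ y ++ v → x ≡ y × u ≡ v
++-cancel-length {[]}    {[]}    _ e = refl , e
++-cancel-length {_ ∷ _} {_ ∷ _} l e =
  let p , q = ++-cancel-length (suc-injective l) (List.∷-injectiveʳ e)
  in cong₂ _∷_ (List.∷-injectiveˡ e) p , q

announce-prefix : ∀ {x y u v} → announce x ++ u ≡ announce y ++ v → x ≡ y × u ≡ v
announce-prefix {x} {y} {u} {v} e =
  let l , q = zeros-injective (length x) (length y)
                (trans (sym (List.++-assoc (replicate (length x) 0) (1 ∷ x) u))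
                  (trans e (List.++-assoc (replicate (length y) 0) (1 ∷ y) v)))
  in ++-cancel-length l q

announce-injective : ∀ {x y} → announce x ≡ announce y → x ≡ y
announce-injective {x} {y} e = proj₁ (announce-prefix {x} {y} {[]} {[]} (cong (_++ []) e))

⊆-announce : ∀ x → x ⊆ᴸ announce x
⊆-announce x = All.tabulate (∈-++⁺ʳ (replicate (length x) 0) ∘ there)

module _ (em : ExcludedMiddle 0ℓ) where

  ⊊-inhabited : ∀ {A B} → B ⊊ A → ∃[ x ] (x ∈ʷ (A ∖ʷ B))
  ⊊-inhabited {A} {B} (_ , ¬s) with em {∃[ x ] (x ∈ʷ (A ∖ʷ B))}
  ... | yes p = p
  ... | no ¬p = contradiction (λ x a → Bool.¬-not (λ b → ¬p (x , cong₂ _∧_ a (cong not b)))) ¬s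

  prefixFree : 𝕎 → 𝕎
  prefixFree X = comprehension em (λ y → ∃[ x ] (x ∈ʷ adjoin X × announce x ≡ y))
    (λ (x , _ , e) → contradiction (subst (1 ∈_) e (∈-++⁺ʳ (replicate (length x) 0) (here refl))) λ ())
    -- `announce` takes length k to 2k + 1.
    (λ n → let h = proj₁ (𝕎.finitary (adjoin X) n) in h + suc h , λ { y (x , p , refl) b →
      let le = ≮⇒≥ (λ lt → proj₂ (𝕎.finitary (adjoin X) n) x lt (All.tabulate (All.lookup b ∘ All.lookup (⊆-announce x))) p)
      in ≤-trans (≤-reflexive (trans (List.length-++ (replicate (length x) 0))
        (cong (_+ suc (length x)) (List.length-replicate (length x)))))
           (+-mono-≤ le (s≤s le)) })

  announce-preserves : ∀ X → SupportPreserving (adjoin X) announce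
  announce-preserves X x p i = mk⇔
    (λ j → [ (λ k → subst (_∈ x) (sym (All.lookup (All.replicate⁺ {P = _≡ 0} (length x) refl) k))
      (proj₁ (adjoin-components X p)))
           , (λ { (here refl) → proj₂ (adjoin-components X p) ; (there k) → k }) ]′ (∈-++⁻ (replicate (length x) 0) j))
    (All.lookup (⊆-announce x))

  announce-image : ∀ X → IsImage announce (adjoin X) (prefixFree X)
  announce-image X y = mk⇔ (does-true em) (dec-true em)

  φ-prefixFree : ∀ X F → φ (prefixFree X) F ≡ φ X F * φ corner F
  φ-prefixFree X F = trans (sym (φ-image {adjoin X} {prefixFree X} {announce} (λ {x} {y} _ _ → announce-injective {x} {y})
    (announce-preserves X) (announce-image X) F)) (φ-adjoin X F)

  prefixFree-multipliable : ∀ X B → Multipliable (prefixFree X) B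
  prefixFree-multipliable X B {a} {a′} p p′ _ _ e
    with Equivalence.to (announce-image X a) p | Equivalence.to (announce-image X a′) p′
  ... | x , _ , refl | x′ , _ , refl = let q , r = announce-prefix {x} {x′} e in cong₂ (λ z w → announce z , w) q r

  infixl 6 _⊕_
  infixl 7 _⊗_

  _⊗_ : 𝕎 → 𝕎 → 𝕎
  A ⊗ B = prefixFree A ×ʷ B

  φ-⊗ : ∀ A B {F} → Big F → φ (A ⊗ B) F ≡ φ A F * φ B F
  φ-⊗ A B {F} b = trans (φ-×ʷ (prefixFree A) B (prefixFree-multipliable A B) F)
    (cong (_* φ B F) (trans (φ-prefixFree A F) (trans (cong (φ A F *_) (φ-corner-big {F} b)) (*-identityʳ (φ A F)))))

  pos-φ-⊗ : ∀ A B {F} → Big F → ℤ.+ φ (A ⊗ B) F ≡ ℤ.+ φ A F ℤ.* ℤ.+ φ B F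
  pos-φ-⊗ A B {F} b = trans (cong ℤ.+_ (φ-⊗ A B b)) (ℤ.pos-* (φ A F) (φ B F))

  -- Moves a set away from others without altering its counting function.
  copy : (FinSet → ℕ) → 𝕎 → 𝕎
  copy lo X = block em lo (ν X)

  φ-copy : ∀ lo X F → φ (copy lo X) F ≡ φ X F
  φ-copy lo X = φ-block em X lo (ν X) (λ _ → refl)

  copy-disjoint : ∀ A B → Disjoint (copy (const 0) A) (copy (ν A) B)
  copy-disjoint A B = block-disjoint em (const 0) (ν A) (ν A) (ν B) (λ _ → ≤-refl)

  -- For each support, the copy of B starts where that of A ends.
  _⊕_ : 𝕎 → 𝕎 → 𝕎
  A ⊕ B = copy (const 0) A ∪ copy (ν A) B

  φ-⊕ : ∀ A B F → φ (A ⊕ B) F ≡ φ A F + φ B F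
  φ-⊕ A B F = trans (φ-∪ (copy (const 0) A) (copy (ν A) B) (copy-disjoint A B) F)
    (cong₂ _+_ (φ-copy (const 0) A F) (φ-copy (ν A) B F))

  pos-φ-⊕ : ∀ A B F → ℤ.+ φ (A ⊕ B) F ≡ ℤ.+ φ A F ℤ.+ ℤ.+ φ B F
  pos-φ-⊕ A B F = trans (cong ℤ.+_ (φ-⊕ A B F)) (ℤ.pos-+ (φ A F) (φ B F))

  ⊕-inhabited : ∀ A B {x} → x ∈ʷ A → ∃[ y ] (y ∈ʷ (A ⊕ B))
  ⊕-inhabited A B {x} p = φ-positive⁻ (A ⊕ B) (supp x) (≤-trans (φ-positive A (supp x) p (All.tabulate ∈-supp⁺))
    (≤-trans (m≤m+n _ _) (≤-reflexive (sym (φ-⊕ A B (supp x))))))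

  module _ (f : FinSet → ℤ) where

    private
      -- The factor `φ corner` makes the value at the empty set 0, as `φ-posBlock-negBlock` demands,
      -- and leaves `f` unchanged on big sets.
      k : FinSet → ℤ
      k F = f F ℤ.* ℤ.+ φ corner F

      k-∅ : k (supp []) ≡ 0ℤ
      k-∅ = trans (cong (λ n → f (supp []) ℤ.* ℤ.+ n) (φ-corner-small {supp []} (λ { (big () _) })))
        (ℤ.*-zeroʳ (f (supp [])))

    plusSet minusSet : 𝕎
    plusSet  = posBlock em k
    minusSet = negBlock em k

    φ-plus-minus : ∀ {F} → Big F → ℤ.+ φ plusSet F ℤ.- ℤ.+ φ minusSet F ≡ f F
    φ-plus-minus {F} b = trans (φ-posBlock-negBlock em k k-∅ F)
      (trans (cong (λ n → f F ℤ.* ℤ.+ n) (φ-corner-big {F} b)) (ℤ.*-identityʳ (f F)))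

    -- Multiplication by `φ corner` keeps the transform nonnegative, by `mobius-*`; the negative
    -- block is then empty.
    φ-plus-nonneg : (∀ F → 0ℤ ℤ.≤ mobius f F) → ∀ {F} → Big F → ℤ.+ φ plusSet F ≡ f F
    φ-plus-nonneg p {F} b = trans (sym (trans (cong (λ n → ℤ.+ φ plusSet F ℤ.- ℤ.+ n) (φ-negBlock em k nonneg F))
      (ℤ.+-identityʳ _)))
      (φ-plus-minus b)
      where
      nonneg : ∀ F → 0ℤ ℤ.≤ mobius k F
      nonneg = mobius-* {f} {λ E → ℤ.+ φ corner E} p (λ F → subst (0ℤ ℤ.≤_) (sym (mobius-φ corner F)) (ℤ.+≤+ z≤n))

-- The ideal and the ultrafilter of a natural equinumerosity

δ : 𝕎 → 𝕎 → FinSet → ℤ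
δ X Y F = ℤ.+ φ X F ℤ.- ℤ.+ φ Y F

δ-≡ : ∀ a b c d → ℤ.+ a ℤ.- ℤ.+ b ≡ ℤ.+ c ℤ.- ℤ.+ d → a + d ≡ c + b
δ-≡ a b c d e = ℤ.+-injective (begin
  ℤ.+ (a + d)                              ≡⟨ ℤ.pos-+ a d ⟩
  ℤ.+ a ℤ.+ ℤ.+ d                          ≡⟨ lhs (ℤ.+ a) (ℤ.+ b) (ℤ.+ d) ⟩
  (ℤ.+ a ℤ.- ℤ.+ b) ℤ.+ (ℤ.+ d ℤ.+ ℤ.+ b)  ≡⟨ cong (ℤ._+ (ℤ.+ d ℤ.+ ℤ.+ b)) e ⟩
  (ℤ.+ c ℤ.- ℤ.+ d) ℤ.+ (ℤ.+ d ℤ.+ ℤ.+ b)  ≡⟨ rhs (ℤ.+ c) (ℤ.+ d) (ℤ.+ b) ⟩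
  ℤ.+ c ℤ.+ ℤ.+ b                          ≡⟨ sym (ℤ.pos-+ c b) ⟩
  ℤ.+ (c + b) ∎)
  where
  open ≡-Reasoning
  lhs : ∀ a b d → a ℤ.+ d ≡ (a ℤ.- b) ℤ.+ (d ℤ.+ b)
  lhs = solve-∀
  rhs : ∀ c d b → (c ℤ.- d) ℤ.+ (d ℤ.+ b) ≡ c ℤ.+ b
  rhs = solve-∀

not-intro : ∀ {b} → ¬ (b ≡ true) → not b ≡ true
not-intro {true}  p = contradiction refl p
not-intro {false} _ = refl

∈-∖⁺ : ∀ A B x → x ∈ʷ A → ¬ (x ∈ʷ B) → x ∈ʷ (A ∖ʷ B)
∈-∖⁺ A B x p q = cong₂ _∧_ p (not-intro q)

∈-∖⁻ : ∀ A B x → x ∈ʷ (A ∖ʷ B) → x ∈ʷ A × ¬ (x ∈ʷ B)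
∈-∖⁻ A B x p = let q , r = ∧-true {mem A x} p in q , not-true r

-- A common part disjoint from A drops out of the difference; (AP) turns this into additive
-- cancellation.
∪-∖-∪ : ∀ A B C → Disjoint A C → (A ∪ C) ∖ʷ (B ∪ C) ⊆ʷ A ∖ʷ B × A ∖ʷ B ⊆ʷ (A ∪ C) ∖ʷ (B ∪ C)
∪-∖-∪ A B C d =
  (λ x p → let q , r = ∈-∖⁻ (A ∪ C) (B ∪ C) x p in
     [ (λ a → ∈-∖⁺ A B x a (r ∘ ∨-introˡ))
     , (λ c → contradiction (∨-introʳ {mem B x} c) r) ]′ (∨-true {mem A x} q)) ,
  (λ x p → let q , r = ∈-∖⁻ A B x p in
     ∈-∖⁺ (A ∪ C) (B ∪ C) x (∨-introˡ q) (λ s → [ r , d x q ]′ (∨-true {mem B x} s)))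

Trichotomous : Rel 𝕎 0ℓ → 𝕎 → 𝕎 → Set
Trichotomous _≈_ A B = (A ≈ B     × ¬ Succ _≈_ A B × ¬ Prec _≈_ A B)
                     ⊎ (¬ (A ≈ B) × Succ _≈_ A B   × ¬ Prec _≈_ A B)
                     ⊎ (¬ (A ≈ B) × ¬ Succ _≈_ A B × Prec _≈_ A B)

χ : Subset FinSet → FinSet → ℤ
χ A F = if A F then 1ℤ else 0ℤ

subsetProduct-mobius : ∀ h → (∀ F → 0 < h F) → ∀ F → 0ℤ ℤ.≤ mobius (λ E → subsetProduct (h ∘ supp) (elements E)) F
subsetProduct-mobius h p F = subst (0ℤ ℤ.≤_) (sym (trans (mobius-μ (λ E → subsetProduct (h ∘ supp) (elements E)) F)
    (μ-cong (elements F) (λ i → cong (subsetProduct (h ∘ supp)) (supp-sublist {F} i)))))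
  (subsetProduct-nonneg (h ∘ supp) (p ∘ supp) (elements F) (elements F) (supp-⊆ {F} {F} (All.tabulate id)))

module Natural (em : ExcludedMiddle 0ℓ) (_≈_ : Rel 𝕎 0ℓ) (nat : IsNaturalEquinumerosity _≈_) where

  open IsNaturalEquinumerosity nat
  open IsEquinumerosity isEquinumerosity
  open IsEquivalence isEquivalence renaming (refl to ≈-refl; sym to ≈-sym; trans to ≈-trans)

  infixl 6 _⊞_
  infixl 7 _⊠_

  _⊞_ _⊠_ : 𝕎 → 𝕎 → 𝕎
  _⊞_ = _⊕_ em
  _⊠_ = _⊗_ em

  -- Equal counting functions have equal Möbius transforms, so both sets are in support-preserving
  -- bijection with the same block, and naturality applies to either bijection.
  φ-ext : ∀ {X Y} → (∀ F → φ X F ≡ φ Y F) → X ≈ Y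
  φ-ext {X} {Y} e = ≈-trans (toCopy X (λ E → sym (φ-determines-ν {X} {Y} e E))) (≈-sym (toCopy Y (λ _ → refl)))
    where
    toCopy : ∀ Z → (∀ E → ν Y E ≡ ν Z E) → Z ≈ block em (const 0) (ν Y)
    toCopy Z e = natural Z (block em (const 0) (ν Y)) (toBlock em Z (const 0) (ν Y) e)
      (toBlock-injective em Z (const 0) (ν Y) e) (toBlock-preserves em Z (const 0) (ν Y) e)
      (toBlock-image em Z (const 0) (ν Y) e)

  ≈-same : ∀ {X Y} → X ⊆ʷ Y × Y ⊆ʷ X → X ≈ Y
  ≈-same {X} {Y} (p , q) = φ-ext (φ-same {X} {Y} p q)

  ≈-copy : ∀ lo X → X ≈ copy em lo X
  ≈-copy lo X = φ-ext (λ F → sym (φ-copy em lo X F))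

  ≈-adjoin : ∀ X → adjoin X ≈ X
  ≈-adjoin X = ≈-trans (UP (X ×ʷ ｛ 0 ｝) 1) (UP X 0)

  -- By (UP) both sets may be replaced by their images under `adjoin`, whose counting functions
  -- vanish on sets that are not big.
  φ-ext-big : ∀ {X Y} → (∀ {F} → Big F → φ X F ≡ φ Y F) → X ≈ Y
  φ-ext-big {X} {Y} e = ≈-trans (≈-sym (≈-adjoin X)) (≈-trans (φ-ext same) (≈-adjoin Y))
    where
    same : ∀ F → φ (adjoin X) F ≡ φ (adjoin Y) F
    same F with Big? F
    ... | yes b = trans (φ-adjoin-big X b) (trans (e b) (sym (φ-adjoin-big Y b)))
    ... | no ¬b = trans (φ-adjoin-small X ¬b) (sym (φ-adjoin-small Y ¬b))

  -- (AP) sees only the differences, from which a copy of C disjoint from the copies of A and B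
  -- disappears.
  ⊞-cancelʳ : ∀ A B C → (A ≈ B → (A ⊞ C) ≈ (B ⊞ C)) × ((A ⊞ C) ≈ (B ⊞ C) → A ≈ B)
  ⊞-cancelʳ A B C =
    (λ p → ≈-trans (viaA) (≈-trans (Equivalence.from (AP (A₀ ∪ D) (B₀ ∪ D))
      (≈-trans (≈-same (∪-∖-∪ A₀ B₀ D dA)) (≈-trans
        (Equivalence.to (AP A₀ B₀) (≈-trans (≈-sym (≈-copy (const 0) A)) (≈-trans p (≈-copy (const 0) B))))
        (≈-sym (≈-same (∪-∖-∪ B₀ A₀ D dB)))))) (≈-sym viaB))) ,
    (λ p → ≈-trans (≈-copy (const 0) A) (≈-trans (Equivalence.from (AP A₀ B₀)
      (≈-trans (≈-sym (≈-same (∪-∖-∪ A₀ B₀ D dA))) (≈-trans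
        (Equivalence.to (AP (A₀ ∪ D) (B₀ ∪ D)) (≈-trans (≈-sym viaA) (≈-trans p viaB)))
        (≈-same (∪-∖-∪ B₀ A₀ D dB))))) (≈-sym (≈-copy (const 0) B))))
    where
    lo : FinSet → ℕ
    -- Beyond the copies of A and of B, both of which start at 0.
    lo E = ν A E + ν B E
    A₀ = copy em (const 0) A
    B₀ = copy em (const 0) B
    D  = copy em lo C
    dA : Disjoint A₀ D
    dA = block-disjoint em (const 0) (ν A) lo (ν C) (λ E → m≤m+n (ν A E) (ν B E))
    dB : Disjoint B₀ D
    dB = block-disjoint em (const 0) (ν B) lo (ν C) (λ E → m≤n+m (ν B E) (ν A E))
    via : ∀ Z → Disjoint (copy em (const 0) Z) D → (Z ⊞ C) ≈ (copy em (const 0) Z ∪ D)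
    via Z d = φ-ext (λ F → trans (φ-⊕ em Z C F) (sym (trans (φ-∪ (copy em (const 0) Z) D d F)
      (cong₂ _+_ (φ-copy em (const 0) Z F) (φ-copy em lo C F)))))
    viaA = via A dA
    viaB = via B dB

  ⊞-comm : ∀ A B → (A ⊞ B) ≈ (B ⊞ A)
  ⊞-comm A B = φ-ext (λ F → trans (φ-⊕ em A B F) (trans (+-comm (φ A F) (φ B F)) (sym (φ-⊕ em B A F))))

  ⊞-cong : ∀ {A A′ B B′} → A ≈ A′ → B ≈ B′ → (A ⊞ B) ≈ (A′ ⊞ B′)
  ⊞-cong {A} {A′} {B} {B′} p q = ≈-trans (proj₁ (⊞-cancelʳ A A′ B) p) (≈-trans (⊞-comm A′ B)
    (≈-trans (proj₁ (⊞-cancelʳ B B′ A′) q) (⊞-comm B′ A′)))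

  ⊠-congˡ : ∀ P {X Y} → X ≈ Y → (P ⊠ X) ≈ (P ⊠ Y)
  ⊠-congˡ P {X} {Y} p = PP {prefixFree em P} {X} {prefixFree em P} {Y} (prefixFree-multipliable em P X)
    (prefixFree-multipliable em P Y) ≈-refl p

  -- The ideal of functions that represent 0 in the ring of differences of numerosities.

  Ker : (FinSet → ℤ) → Set
  Ker f = ∃₂ λ X Y → X ≈ Y × (∀ {F} → Big F → f F ≡ δ X Y F)

  Ker-cong : ∀ {f g} → (∀ {F} → Big F → f F ≡ g F) → Ker f → Ker g
  Ker-cong e (X , Y , p , q) = X , Y , p , λ b → trans (sym (e b)) (q b)

  -- `Ker` provides some representing pair A ≈ B, here exchanged for the given one: X ⊞ B and A ⊞ Y
  -- have equal counts on big sets, and B cancels.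
  Ker-δ : ∀ {X Y} → Ker (δ X Y) → X ≈ Y
  Ker-δ {X} {Y} (A , B , p , q) = proj₂ (⊞-cancelʳ X Y B) (≈-trans
    (φ-ext-big (λ {F} b → trans (φ-⊕ em X B F) (trans (δ-≡ (φ X F) (φ Y F) (φ A F) (φ B F) (q b)) (sym (φ-⊕ em A Y F)))))
    (≈-trans (proj₁ (⊞-cancelʳ A B Y) p) (⊞-comm B Y)))

  ≈⇒Ker : ∀ {X Y} → X ≈ Y → Ker (δ X Y)
  ≈⇒Ker p = _ , _ , p , λ _ → refl

  Ker-0 : Ker (const 0ℤ)
  Ker-0 = ∅ , ∅ , ≈-refl , λ {F} _ → sym (ℤ.+-inverseʳ (ℤ.+ φ ∅ F))

  Ker-+ : ∀ {f g} → Ker f → Ker g → Ker (λ F → f F ℤ.+ g F)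
  Ker-+ (X , Y , p , q) (X′ , Y′ , p′ , q′) = X ⊞ X′ , Y ⊞ Y′ , ⊞-cong p p′ , λ {F} b → trans (cong₂ ℤ._+_ (q b) (q′ b))
    (trans (inter (ℤ.+ φ X F) (ℤ.+ φ Y F) (ℤ.+ φ X′ F) (ℤ.+ φ Y′ F))
      (sym (cong₂ ℤ._-_ (pos-φ-⊕ em X X′ F) (pos-φ-⊕ em Y Y′ F))))
    where
    inter : ∀ a b c d → (a ℤ.- b) ℤ.+ (c ℤ.- d) ≡ (a ℤ.+ c) ℤ.- (b ℤ.+ d)
    inter = solve-∀

  Ker-neg : ∀ {f} → Ker f → Ker (λ F → ℤ.- f F)
  Ker-neg (X , Y , p , q) = Y , X , ≈-sym p , λ {F} b → trans (cong ℤ.-_ (q b)) (flip (ℤ.+ φ X F) (ℤ.+ φ Y F))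
    where
    flip : ∀ a b → ℤ.- (a ℤ.- b) ≡ b ℤ.- a
    flip = solve-∀

  Ker-- : ∀ {f g} → Ker f → Ker g → Ker (λ F → f F ℤ.- g F)
  Ker-- p q = Ker-+ p (Ker-neg q)

  -- On big sets every integer function is a difference of two counting functions, so the factor h
  -- is arbitrary. In particular it may be the characteristic function of any family of finite sets.
  Ker-* : ∀ h {f} → Ker f → Ker (λ F → h F ℤ.* f F)
  Ker-* h (X , Y , p , q) = (P ⊠ X) ⊞ (M ⊠ Y) , (P ⊠ Y) ⊞ (M ⊠ X) ,
    ⊞-cong (⊠-congˡ P p) (⊠-congˡ M (≈-sym p)) ,
    λ {F} b → trans (cong₂ ℤ._*_ (sym (φ-plus-minus em h b)) (q b))
      (trans (expand (ℤ.+ φ P F) (ℤ.+ φ M F) (ℤ.+ φ X F) (ℤ.+ φ Y F))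
        (sym (cong₂ ℤ._-_ (cast P X M Y b) (cast P Y M X b))))
    where
    P = plusSet em h
    M = minusSet em h
    cast : ∀ A B C D {F} → Big F → ℤ.+ φ ((A ⊠ B) ⊞ (C ⊠ D)) F ≡ ℤ.+ φ A F ℤ.* ℤ.+ φ B F ℤ.+ ℤ.+ φ C F ℤ.* ℤ.+ φ D F
    cast A B C D {F} b = trans (pos-φ-⊕ em (A ⊠ B) (C ⊠ D) F) (cong₂ ℤ._+_ (pos-φ-⊗ em A B b) (pos-φ-⊗ em C D b))
    expand : ∀ p m x y → (p ℤ.- m) ℤ.* (x ℤ.- y) ≡ (p ℤ.* x ℤ.+ m ℤ.* y) ℤ.- (p ℤ.* y ℤ.+ m ℤ.* x)
    expand = solve-∀

  -- A nonempty set exceeds the empty one, so by (ZP) it is not equinumerous with it.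
  inhabited⇒¬Ker : ∀ {W x} → x ∈ʷ W → ¬ Ker (λ F → ℤ.+ φ W F)
  inhabited⇒¬Ker {W} {x} i k = exclusive (ZP W ∅)
    where
    W≈∅ : W ≈ ∅
    W≈∅ = Ker-δ (Ker-cong (λ {F} _ → sym (trans (cong (λ n → ℤ.+ φ W F ℤ.- ℤ.+ n) (φ-∅ F)) (ℤ.+-identityʳ _))) k)
    W≻∅ : Succ _≈_ W ∅
    W≻∅ = W , ∅ , ((λ _ ()) , λ s → contradiction (s x i) λ ()) , ≈-refl , ≈-refl
    exclusive : Trichotomous _≈_ W ∅ → ⊥
    exclusive (inj₁ (_ , ¬≻ , _))        = ¬≻ W≻∅
    exclusive (inj₂ (inj₁ (¬≈ , _)))     = ¬≈ W≈∅
    exclusive (inj₂ (inj₂ (¬≈ , _)))     = ¬≈ W≈∅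

  -- Zero, positive or negative modulo `Ker`, where the positive elements are the counting functions
  -- of nonempty sets.
  Signed : (FinSet → ℤ) → Set
  Signed f = Ker f ⊎ ∃₂ λ W x → x ∈ʷ W × (Ker (λ F → f F ℤ.- ℤ.+ φ W F) ⊎ Ker (λ F → f F ℤ.+ ℤ.+ φ W F))

  -- On big sets f is a difference of two counting functions, and (ZP) compares the two sets. In a
  -- strict case they are equinumerous with sets B ⊊ A, and the nonempty A ∖ B represents f or its
  -- negative.
  trichotomy : ∀ f → Signed f
  trichotomy f = go (ZP P M)
    where
    P = plusSet em f
    M = minusSet em f
    minus : ∀ p q a b w → a ≡ b ℤ.+ w → (p ℤ.- a) ℤ.- (q ℤ.- b) ≡ (p ℤ.- q) ℤ.- w
    minus p q _ b w refl = rearrange p q b w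
      where
      rearrange : ∀ p q b w → (p ℤ.- (b ℤ.+ w)) ℤ.- (q ℤ.- b) ≡ (p ℤ.- q) ℤ.- w
      rearrange = solve-∀
    plus : ∀ p q a b w → a ≡ b ℤ.+ w → (p ℤ.- b) ℤ.- (q ℤ.- a) ≡ (p ℤ.- q) ℤ.+ w
    plus p q _ b w refl = rearrange p q b w
      where
      rearrange : ∀ p q b w → (p ℤ.- b) ℤ.- (q ℤ.- (b ℤ.+ w)) ≡ (p ℤ.- q) ℤ.+ w
      rearrange = solve-∀
    split : ∀ A B → B ⊆ʷ A → ∀ F → ℤ.+ φ A F ≡ ℤ.+ φ B F ℤ.+ ℤ.+ φ (A ∖ʷ B) F
    split A B s F = trans (cong ℤ.+_ (φ-⊆ A B s F)) (ℤ.pos-+ (φ B F) (φ (A ∖ʷ B) F))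
    go : Trichotomous _≈_ P M → Signed f
    go (inj₁ (p , _)) = inj₁ (P , M , p , λ b → sym (φ-plus-minus em f b))
    go (inj₂ (inj₁ (_ , (A , B , s , p , q) , _))) = let x , i = ⊊-inhabited em {A} {B} s in
      inj₂ (A ∖ʷ B , x , i , inj₁ (Ker-cong
        (λ {F} b → trans (minus (ℤ.+ φ P F) (ℤ.+ φ M F) (ℤ.+ φ A F) (ℤ.+ φ B F) (ℤ.+ φ (A ∖ʷ B) F) (split A B (proj₁ s) F))
                         (cong (ℤ._- ℤ.+ φ (A ∖ʷ B) F) (φ-plus-minus em f b)))
        (Ker-- (≈⇒Ker p) (≈⇒Ker q))))
    go (inj₂ (inj₂ (_ , _ , (A , B , s , p , q)))) = let x , i = ⊊-inhabited em {A} {B} s in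
      inj₂ (A ∖ʷ B , x , i , inj₂ (Ker-cong
        (λ {F} b → trans (plus (ℤ.+ φ P F) (ℤ.+ φ M F) (ℤ.+ φ A F) (ℤ.+ φ B F) (ℤ.+ φ (A ∖ʷ B) F) (split A B (proj₁ s) F))
                         (cong (ℤ._+ ℤ.+ φ (A ∖ʷ B) F) (φ-plus-minus em f b)))
        (Ker-- (≈⇒Ker q) (≈⇒Ker p))))

  ⊠-inhabited : ∀ A B {x y} → x ∈ʷ A → y ∈ʷ B → ∃[ z ] (z ∈ʷ (A ⊠ B))
  ⊠-inhabited A B {x} {y} p q = φ-positive⁻ (A ⊠ B) F (subst (0 <_) (sym (φ-⊗ em A B {F} big-F))
    (*-mono-≤ (φ-positive A F p (All.tabulate (λ i → ∈-supp⁺ {z} (there (there (∈-++⁺ˡ i))))))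
              (φ-positive B F q (All.tabulate (λ i → ∈-supp⁺ {z} (there (there (∈-++⁺ʳ x i))))))))
    where
    -- The support of this tuple is big and contains a tuple of each factor.
    z = 0 ∷ 1 ∷ x ++ y
    F = supp z
    big-F : Big F
    big-F = big (∈-supp⁺ {z} (here refl)) (∈-supp⁺ {z} (there (here refl)))

  -- A multiple of h is the counting function of a nonempty set.

  positive⇒¬Ker : ∀ h → (∀ F → 0 < h F) → ¬ Ker (λ F → ℤ.+ h F)
  positive⇒¬Ker h p k = inhabited⇒¬Ker {W} (proj₂ inhabitant)
    (Ker-cong (λ {F} b → trans (sym (multiple F)) (sym (φ-plus-nonneg em Π (subsetProduct-mobius h p) b)))
      (Ker-* (λ F → ℤ.+ quotient F) k))
    where
    Π : FinSet → ℤ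
    Π E = subsetProduct (h ∘ supp) (elements E)
    W = plusSet em Π
    divisor : ∀ F → h F ∣ product (map (h ∘ supp) (sublists (elements F)))
    divisor F = subst (λ E → h E ∣ product (map (h ∘ supp) (sublists (elements F)))) (supp-elements F)
      (∈⇒∣product (∈-map⁺ (h ∘ supp) (supp-⊆ {F} {F} (All.tabulate id))))
    quotient : FinSet → ℕ
    quotient F = _∣_.quotient (divisor F)
    multiple : ∀ F → Π F ≡ ℤ.+ quotient F ℤ.* ℤ.+ h F
    multiple F = trans (cong ℤ.+_ (_∣_.equality (divisor F))) (ℤ.pos-* (quotient F) (h F))
    -- It is enough to count at one big set, where `Π` is a product of positive numbers.
    F₀ : FinSet
    F₀ = supp (0 ∷ 1 ∷ [])
    big-F₀ : Big F₀
    big-F₀ = big (∈-supp⁺ {0 ∷ 1 ∷ []} (here refl)) (∈-supp⁺ {0 ∷ 1 ∷ []} (there (here refl)))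
    inhabitant : ∃[ x ] (x ∈ʷ W)
    inhabitant = φ-positive⁻ W F₀ (subst (0 <_) (sym (ℤ.+-injective (φ-plus-nonneg em Π (subsetProduct-mobius h p) big-F₀)))
      (>-nonZero⁻¹ (product (map (h ∘ supp) (sublists (elements F₀))))
        {{product≢0 (All.map⁺ {f = h ∘ supp} (All.universal (λ m → >-nonZero (p (supp m))) (sublists (elements F₀))))}}))

  -- A negative idempotent is impossible: f ≡ -w and f² = f give w + w² ≡ 0, while w + w² counts a
  -- nonempty set on big sets.
  idempotent : ∀ f → (∀ F → f F ℤ.* f F ≡ f F) →
               Ker f ⊎ ∃₂ λ W x → x ∈ʷ W × Ker (λ F → f F ℤ.- ℤ.+ φ W F)
  idempotent f sq = go (trichotomy f)
    where
    go : Signed f →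
         Ker f ⊎ ∃₂ λ W x → x ∈ʷ W × Ker (λ F → f F ℤ.- ℤ.+ φ W F)
    go (inj₁ k)                     = inj₁ k
    go (inj₂ (W , x , i , inj₁ k)) = inj₂ (W , x , i , k)
    go (inj₂ (W , x , i , inj₂ k)) = contradiction
      (Ker-cong (λ {F} b → trans (combine (f F) (ℤ.+ φ W F) (sq F)) (sym (cast b)))
        (Ker-- k (Ker-* (λ F → f F ℤ.- ℤ.+ φ W F) k)))
      (inhabited⇒¬Ker {W ⊞ (W ⊠ W)} (proj₂ (⊕-inhabited em W (W ⊠ W) i)))
      where
      combine : ∀ f w → f ℤ.* f ≡ f → (f ℤ.+ w) ℤ.- (f ℤ.- w) ℤ.* (f ℤ.+ w) ≡ w ℤ.+ w ℤ.* w
      combine f w e = trans (rearrange f w) (trans (cong (λ z → (f ℤ.- z) ℤ.+ (w ℤ.+ w ℤ.* w)) e)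
        (trans (cong (ℤ._+ (w ℤ.+ w ℤ.* w)) (ℤ.+-inverseʳ f)) (ℤ.+-identityˡ _)))
        where
        rearrange : ∀ f w → (f ℤ.+ w) ℤ.- (f ℤ.- w) ℤ.* (f ℤ.+ w) ≡ (f ℤ.- f ℤ.* f) ℤ.+ (w ℤ.+ w ℤ.* w)
        rearrange = solve-∀
      cast : ∀ {F} → Big F → ℤ.+ φ (W ⊞ (W ⊠ W)) F ≡ ℤ.+ φ W F ℤ.+ ℤ.+ φ W F ℤ.* ℤ.+ φ W F
      cast {F} b = trans (pos-φ-⊕ em W (W ⊠ W) F) (cong (λ z → ℤ.+ φ W F ℤ.+ z) (pos-φ-⊗ em W W b))

  𝒰 : Pred (Subset FinSet) 0ℓ
  𝒰 A = Ker (χ (not ∘ A))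

  private
    χ-idempotent : ∀ A F → χ A F ℤ.* χ A F ≡ χ A F
    χ-idempotent A F with A F
    ... | true  = refl
    ... | false = refl

    -- The characteristic functions of A and of its complement are idempotents with product 0. If
    -- neither were in `Ker`, both would be positive, and their product would be congruent to the
    -- count of a nonempty set.
    𝒰-ultra : ∀ A → 𝒰 A ⊎ 𝒰 (not ∘ A)
    𝒰-ultra A = go (idempotent (χ A) (χ-idempotent A)) (idempotent (χ (not ∘ A)) (χ-idempotent (not ∘ A)))
      where
      double : ∀ F → χ A F ≡ χ (not ∘ not ∘ A) F
      double F = cong (if_then 1ℤ else 0ℤ) (sym (Bool.not-involutive (A F)))
      disjoint : ∀ F → χ A F ℤ.* χ (not ∘ A) F ≡ 0ℤ
      disjoint F with A F
      ... | true  = refl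
      ... | false = refl
      combine : ∀ f g w v → f ℤ.* g ≡ 0ℤ → ℤ.- (f ℤ.* (g ℤ.- v) ℤ.+ v ℤ.* (f ℤ.- w)) ≡ w ℤ.* v
      combine f g w v e = trans (rearrange f g w v) (trans (cong (λ z → w ℤ.* v ℤ.- z) e) (ℤ.+-identityʳ _))
        where
        rearrange : ∀ f g w v → ℤ.- (f ℤ.* (g ℤ.- v) ℤ.+ v ℤ.* (f ℤ.- w)) ≡ w ℤ.* v ℤ.- f ℤ.* g
        rearrange = solve-∀
      go : Ker (χ A) ⊎ (∃₂ λ W x → x ∈ʷ W × Ker (λ F → χ A F ℤ.- ℤ.+ φ W F)) →
           Ker (χ (not ∘ A)) ⊎ (∃₂ λ W x → x ∈ʷ W × Ker (λ F → χ (not ∘ A) F ℤ.- ℤ.+ φ W F)) →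
           𝒰 A ⊎ 𝒰 (not ∘ A)
      go (inj₁ k) _        = inj₂ (Ker-cong (λ {F} _ → double F) k)
      go (inj₂ _) (inj₁ k) = inj₁ k
      go (inj₂ (W , _ , i , k)) (inj₂ (V , _ , j , l)) = contradiction
        (Ker-cong (λ {F} b → trans (combine (χ A F) (χ (not ∘ A) F) (ℤ.+ φ W F) (ℤ.+ φ V F) (disjoint F))
            (sym (pos-φ-⊗ em W V b)))
          (Ker-neg (Ker-+ (Ker-* (χ A) l) (Ker-* (λ F → ℤ.+ φ V F) k))))
        (inhabited⇒¬Ker {W ⊠ V} (proj₂ (⊠-inhabited W V i j)))

  𝒰-isUltrafilter : IsUltrafilter 𝒰
  𝒰-isUltrafilter = record
    { upward   = λ {A} {B} s → Ker-cong (λ {F} _ → up (A F) (B F) (s F)) ∘ Ker-* (χ (not ∘ B))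
    -- The complement of A ∩ B is the disjoint union of the complement of A and of A ∖ B.
    ; ∩-closed = λ {A} {B} p q → Ker-cong (λ {F} _ → meet (A F) (B F)) (Ker-+ p (Ker-* (χ A) q))
    ; whole    = Ker-0
    ; proper   = positive⇒¬Ker (const 1) (λ _ → s≤s z≤n)
    ; ultra    = 𝒰-ultra
    }
    where
    [_] : Bool → ℤ
    [ b ] = if b then 1ℤ else 0ℤ
    up : ∀ a b → (a ≡ true → b ≡ true) → [ not b ] ℤ.* [ not a ] ≡ [ not b ]
    up true  true  _ = refl
    up true  false s = contradiction (s refl) λ ()
    up false true  _ = refl
    up false false _ = refl
    meet : ∀ a b → [ not a ] ℤ.+ [ a ] ℤ.* [ not b ] ≡ [ not (a ∧ b) ]
    meet true  true  = refl
    meet true  false = refl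
    meet false true  = refl
    meet false false = refl

  zeros : (FinSet → ℤ) → Subset FinSet
  zeros f F = does (f F ℤ.≟ 0ℤ)

  -- Otherwise the characteristic function of the zeros of f lies in `Ker`. Adding f², also in
  -- `Ker`, gives a function with all values at least 1.
  Ker⇒𝒰 : ∀ f → Ker f → 𝒰 (zeros f)
  Ker⇒𝒰 f k with 𝒰-ultra (zeros f)
  ... | inj₁ u = u
  ... | inj₂ u = contradiction (Ker-cong (λ {F} _ → square F) (Ker-+ (Ker-* f k) u)) (positive⇒¬Ker h h>0)
    where
    h : FinSet → ℕ
    h F = ℤ.∣ f F ∣ * ℤ.∣ f F ∣ + (if does (f F ℤ.≟ 0ℤ) then 1 else 0)
    square : ∀ F → f F ℤ.* f F ℤ.+ χ (not ∘ not ∘ zeros f) F ≡ ℤ.+ h F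
    square F = trans (cong₂ ℤ._+_ (sq (f F)) (indicatorℤ (zeros f F)))
                     (sym (ℤ.pos-+ (ℤ.∣ f F ∣ * ℤ.∣ f F ∣) _))
      where
      sq : ∀ z → z ℤ.* z ≡ ℤ.+ (ℤ.∣ z ∣ * ℤ.∣ z ∣)
      sq (ℤ.+ n)    = sym (ℤ.pos-* n n)
      sq ℤ.-[1+ n ] = refl
      indicatorℤ : ∀ b → (if not (not b) then 1ℤ else 0ℤ) ≡ ℤ.+ (if b then 1 else 0)
      indicatorℤ true  = refl
      indicatorℤ false = refl
    h>0 : ∀ F → 0 < h F
    h>0 F with f F
    ... | ℤ.+ zero   = s≤s z≤n
    ... | ℤ.+ suc n  = s≤s z≤n
    ... | ℤ.-[1+ n ] = s≤s z≤n

  -- f equals its product with the characteristic function of its nonzero set, which is in `Ker` by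
  -- the definition of `𝒰`.
  𝒰⇒Ker : ∀ f → 𝒰 (zeros f) → Ker f
  𝒰⇒Ker f = Ker-cong (λ {F} _ → vanish F) ∘ Ker-* f
    where
    vanish : ∀ F → f F ℤ.* χ (not ∘ zeros f) F ≡ f F
    vanish F with f F ℤ.≟ 0ℤ
    ... | yes e = trans (ℤ.*-zeroʳ (f F)) (sym e)
    ... | no _  = ℤ.*-identityʳ (f F)

  ≈⇔𝒰 : ∀ X Y → X ≈ Y ⇔ 𝒰 (Agree X Y)
  ≈⇔𝒰 X Y = mk⇔
    (λ p → upward (λ F z → Agree⁺ X Y F (ℤ.+-injective (ℤ.i-j≡0⇒i≡j (ℤ.+ φ X F) (ℤ.+ φ Y F) (does-true (δ X Y F ℤ.≟ 0ℤ) z))))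
                  (Ker⇒𝒰 (δ X Y) (≈⇒Ker p)))
    (λ u → Ker-δ (𝒰⇒Ker (δ X Y) (upward (λ F a → dec-true (δ X Y F ℤ.≟ 0ℤ) (ℤ.i≡j⇒i-j≡0 (cong ℤ.+_ (Agree⁻ X Y F a)))) u)))
    where open IsUltrafilter 𝒰-isUltrafilter using (upward)

-- Lagrange's four-square theorem

Σ² : (a b c d : ℤ) → ℤ
Σ² a b c d = a ℤ.* a ℤ.+ b ℤ.* b ℤ.+ c ℤ.* c ℤ.+ d ℤ.* d

record FourSquares (z : ℤ) : Set where
  constructor fourSquares
  field
    r₁ r₂ r₃ r₄ : ℤ
    sum-≡       : z ≡ Σ² r₁ r₂ r₃ r₄

euler : ∀ a b c d x y z w →
  (a ℤ.* a ℤ.+ b ℤ.* b ℤ.+ c ℤ.* c ℤ.+ d ℤ.* d) ℤ.* (x ℤ.* x ℤ.+ y ℤ.* y ℤ.+ z ℤ.* z ℤ.+ w ℤ.* w) ≡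
  (a ℤ.* x ℤ.+ b ℤ.* y ℤ.+ c ℤ.* z ℤ.+ d ℤ.* w) ℤ.* (a ℤ.* x ℤ.+ b ℤ.* y ℤ.+ c ℤ.* z ℤ.+ d ℤ.* w) ℤ.+
  (a ℤ.* y ℤ.- b ℤ.* x ℤ.+ c ℤ.* w ℤ.- d ℤ.* z) ℤ.* (a ℤ.* y ℤ.- b ℤ.* x ℤ.+ c ℤ.* w ℤ.- d ℤ.* z) ℤ.+
  (a ℤ.* z ℤ.- c ℤ.* x ℤ.+ d ℤ.* y ℤ.- b ℤ.* w) ℤ.* (a ℤ.* z ℤ.- c ℤ.* x ℤ.+ d ℤ.* y ℤ.- b ℤ.* w) ℤ.+
  (a ℤ.* w ℤ.- d ℤ.* x ℤ.+ b ℤ.* z ℤ.- c ℤ.* y) ℤ.* (a ℤ.* w ℤ.- d ℤ.* x ℤ.+ b ℤ.* z ℤ.- c ℤ.* y)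
euler = solve-∀

fourSquares-* : ∀ {m n} → FourSquares m → FourSquares n → FourSquares (m ℤ.* n)
fourSquares-* (fourSquares a b c d p) (fourSquares x y z w q) = fourSquares
  (a ℤ.* x ℤ.+ b ℤ.* y ℤ.+ c ℤ.* z ℤ.+ d ℤ.* w) (a ℤ.* y ℤ.- b ℤ.* x ℤ.+ c ℤ.* w ℤ.- d ℤ.* z)
  (a ℤ.* z ℤ.- c ℤ.* x ℤ.+ d ℤ.* y ℤ.- b ℤ.* w) (a ℤ.* w ℤ.- d ℤ.* x ℤ.+ b ℤ.* z ℤ.- c ℤ.* y)
  (trans (cong₂ ℤ._*_ p q) (euler a b c d x y z w))

symmetricResidue : ∀ x m .{{_ : NonZero m}} → ∃₂ λ y k → x ≡ y ℤ.+ ℤ.+ m ℤ.* k × 2 * ℤ.∣ y ∣ ≤ m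
symmetricResidue x m with x ℤ.%ℕ m | x ℤ./ℕ m | ℤ.a≡a%ℕn+[a/ℕn]*n x m | ℤ.n%ℕd<d x m
... | r | q | e | lt with 2 * r ≤? m
...   | yes le = ℤ.+ r , q , trans e (cong (λ z → ℤ.+ r ℤ.+ z) (ℤ.*-comm q (ℤ.+ m))) , le
-- A remainder above m/2 is replaced by r - m, which raises the quotient by 1.
...   | no ≰   = ℤ.- ℤ.+ (m ∸ r) , q ℤ.+ 1ℤ ,
  trans e (trans (rearrange (ℤ.+ r) q (ℤ.+ m))
    (cong (λ z → z ℤ.+ ℤ.+ m ℤ.* (q ℤ.+ 1ℤ)) (sym (trans
      (cong ℤ.-_ (trans (sym (ℤ.⊖-≥ (<⇒≤ lt))) (sym (ℤ.m-n≡m⊖n m r)))) (flip (ℤ.+ m) (ℤ.+ r)))))) ,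
  ≤-trans (≤-reflexive (cong (2 *_) (ℤ.∣-i∣≡∣i∣ (ℤ.+ (m ∸ r))))) (half m r (<⇒≤ lt) (≰⇒≥ ≰))
  where
  rearrange : ∀ r q m → r ℤ.+ q ℤ.* m ≡ (r ℤ.- m) ℤ.+ m ℤ.* (q ℤ.+ 1ℤ)
  rearrange = solve-∀
  flip : ∀ m r → ℤ.- (m ℤ.- r) ≡ r ℤ.- m
  flip = solve-∀
  half : ∀ m r → r ≤ m → m ≤ 2 * r → 2 * (m ∸ r) ≤ m
  half m r r≤m m≤2r = +-cancelʳ-≤ (2 * r) _ _ (begin
    2 * (m ∸ r) + 2 * r ≡⟨ sym (*-distribˡ-+ 2 (m ∸ r) r) ⟩
    2 * (m ∸ r + r)     ≡⟨ cong (2 *_) (m∸n+n≡m r≤m) ⟩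
    2 * m               ≡⟨ cong (m +_) (+-identityʳ m) ⟩
    m + m               ≤⟨ +-monoʳ-≤ m m≤2r ⟩
    m + 2 * r           ∎)
    where open ≤-Reasoning

square-abs : ∀ y → y ℤ.* y ≡ ℤ.+ (ℤ.∣ y ∣ * ℤ.∣ y ∣)
square-abs (ℤ.+ n)    = sym (ℤ.pos-* n n)
square-abs ℤ.-[1+ n ] = refl

sumℕ : (a b c d : ℕ) → ℕ
sumℕ a b c d = a * a + b * b + c * c + d * d

Σ²-abs : ∀ a b c d → Σ² a b c d ≡ ℤ.+ sumℕ ℤ.∣ a ∣ ℤ.∣ b ∣ ℤ.∣ c ∣ ℤ.∣ d ∣
Σ²-abs a b c d = cong₂ ℤ._+_ (cong₂ ℤ._+_ (cong₂ ℤ._+_ (square-abs a) (square-abs b)) (square-abs c)) (square-abs d)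

doubled : ∀ a b c d → sumℕ (2 * a) (2 * b) (2 * c) (2 * d) ≡ 4 * sumℕ a b c d
doubled = ℕsolve
  where
  ℕsolve : ∀ a b c d → (2 * a) * (2 * a) + (2 * b) * (2 * b) + (2 * c) * (2 * c) + (2 * d) * (2 * d) ≡
           4 * (a * a + b * b + c * c + d * d)
  ℕsolve = ℕ-Solver.solve-∀

sumℕ-mono : ∀ {a b c d m} → a ≤ m → b ≤ m → c ≤ m → d ≤ m → sumℕ a b c d ≤ sumℕ m m m m
sumℕ-mono p q r s = +-mono-≤ (+-mono-≤ (+-mono-≤ (*-mono-≤ p p) (*-mono-≤ q q)) (*-mono-≤ r r)) (*-mono-≤ s s)

quadruple : ∀ m → sumℕ m m m m ≡ 4 * (m * m)
quadruple = solveℕ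
  where
  solveℕ : ∀ m → m * m + m * m + m * m + m * m ≡ 4 * (m * m)
  solveℕ = ℕ-Solver.solve-∀

+-tight : ∀ {a b c d} → a ≤ c → b ≤ d → a + b ≡ c + d → a ≡ c × b ≡ d
+-tight {a} {b} {c} {d} p q e = u , +-cancelˡ-≡ c b d (trans (cong (_+ b) (sym u)) e)
  where
  u : a ≡ c
  u = ≤-antisym p (+-cancelʳ-≤ d c a (≤-trans (≤-reflexive (sym e)) (+-monoʳ-≤ a q)))

square-tight : ∀ {a m} → a ≤ m → a * a ≡ m * m → a ≡ m
square-tight {a} {m} p e with m≤n⇒m<n∨m≡n p
... | inj₁ lt = contradiction e (<⇒≢ (*-mono-< lt lt))
... | inj₂ r  = r

sumℕ-tight : ∀ {a b c d m} → a ≤ m → b ≤ m → c ≤ m → d ≤ m → sumℕ a b c d ≡ sumℕ m m m m →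
             a ≡ m × b ≡ m × c ≡ m × d ≡ m
sumℕ-tight p q r s e =
  let e₁ , d≡ = +-tight (+-mono-≤ (+-mono-≤ (*-mono-≤ p p) (*-mono-≤ q q)) (*-mono-≤ r r)) (*-mono-≤ s s) e
      e₂ , c≡ = +-tight (+-mono-≤ (*-mono-≤ p p) (*-mono-≤ q q)) (*-mono-≤ r r) e₁
      a≡ , b≡ = +-tight (*-mono-≤ p p) (*-mono-≤ q q) e₂
  in square-tight p a≡ , square-tight q b≡ , square-tight r c≡ , square-tight s d≡

-- For the case of the descent in which the residues have the extreme absolute value m/2; twice such
-- a residue is ± m.
signOf : ∀ y {m} → 2 * ℤ.∣ y ∣ ≡ m → ∃[ s ] (ℤ.+ 2 ℤ.* y ≡ ℤ.+ m ℤ.* s)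
signOf (ℤ.+ n)    refl = 1ℤ , trans (sym (ℤ.pos-* 2 n)) (sym (ℤ.*-identityʳ _))
signOf ℤ.-[1+ n ] refl = ℤ.-1ℤ , sym (trans (ℤ.*-comm _ ℤ.-1ℤ) (ℤ.-1*i≡-i _))

-- The factors 2a, 2b, 2c, 2d are kept intact because in the two degenerate cases of the descent
-- each of them is a multiple of m.
expand : ∀ m a b c d i j k l →
  (a ℤ.+ m ℤ.* i) ℤ.* (a ℤ.+ m ℤ.* i) ℤ.+ (b ℤ.+ m ℤ.* j) ℤ.* (b ℤ.+ m ℤ.* j) ℤ.+
  (c ℤ.+ m ℤ.* k) ℤ.* (c ℤ.+ m ℤ.* k) ℤ.+ (d ℤ.+ m ℤ.* l) ℤ.* (d ℤ.+ m ℤ.* l) ≡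
  (a ℤ.* a ℤ.+ b ℤ.* b ℤ.+ c ℤ.* c ℤ.+ d ℤ.* d) ℤ.+
  m ℤ.* ((ℤ.+ 2 ℤ.* a) ℤ.* i ℤ.+ (ℤ.+ 2 ℤ.* b) ℤ.* j ℤ.+ (ℤ.+ 2 ℤ.* c) ℤ.* k ℤ.+ (ℤ.+ 2 ℤ.* d) ℤ.* l ℤ.+
         m ℤ.* (i ℤ.* i ℤ.+ j ℤ.* j ℤ.+ k ℤ.* k ℤ.+ l ℤ.* l))
expand = solve-∀

-- For numbers and their residues modulo m, every term of Euler's identity is divisible by m, the
-- first because the squares of the residues sum to m r. Hence m² splits off.
eulerResidue : ∀ m a b c d i j k l r → a ℤ.* a ℤ.+ b ℤ.* b ℤ.+ c ℤ.* c ℤ.+ d ℤ.* d ≡ m ℤ.* r →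
  Σ² (a ℤ.+ m ℤ.* i) (b ℤ.+ m ℤ.* j) (c ℤ.+ m ℤ.* k) (d ℤ.+ m ℤ.* l) ℤ.* Σ² a b c d ≡
  m ℤ.* m ℤ.* Σ² (r ℤ.+ (i ℤ.* a ℤ.+ j ℤ.* b ℤ.+ k ℤ.* c ℤ.+ l ℤ.* d))
                 (i ℤ.* b ℤ.- j ℤ.* a ℤ.+ k ℤ.* d ℤ.- l ℤ.* c)
                 (i ℤ.* c ℤ.- k ℤ.* a ℤ.+ l ℤ.* b ℤ.- j ℤ.* d)
                 (i ℤ.* d ℤ.- l ℤ.* a ℤ.+ j ℤ.* c ℤ.- k ℤ.* b)
eulerResidue m a b c d i j k l r e = trans
  (euler (a ℤ.+ m ℤ.* i) (b ℤ.+ m ℤ.* j) (c ℤ.+ m ℤ.* k) (d ℤ.+ m ℤ.* l) a b c d)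
  (trans (cong₂ ℤ._+_ (cong₂ ℤ._+_ (cong₂ ℤ._+_
      (cong (λ z → z ℤ.* z) (trans (z₁ m a b c d i j k l) (cong (λ z → z ℤ.+ m ℤ.* _) e)))
      (cong (λ z → z ℤ.* z) (z₂ m a b c d i j k l)))
      (cong (λ z → z ℤ.* z) (z₂ m a c d b i k l j)))
      (cong (λ z → z ℤ.* z) (z₂ m a d b c i l j k)))
    (factor m r _ _ _ _))
  where
  z₁ : ∀ m a b c d i j k l → (a ℤ.+ m ℤ.* i) ℤ.* a ℤ.+ (b ℤ.+ m ℤ.* j) ℤ.* b ℤ.+ (c ℤ.+ m ℤ.* k) ℤ.* c ℤ.+
    (d ℤ.+ m ℤ.* l) ℤ.* d
       ≡ (a ℤ.* a ℤ.+ b ℤ.* b ℤ.+ c ℤ.* c ℤ.+ d ℤ.* d) ℤ.+ m ℤ.* (i ℤ.* a ℤ.+ j ℤ.* b ℤ.+ k ℤ.* c ℤ.+ l ℤ.* d)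
  z₁ = solve-∀
  z₂ : ∀ m a b c d i j k l → (a ℤ.+ m ℤ.* i) ℤ.* b ℤ.- (b ℤ.+ m ℤ.* j) ℤ.* a ℤ.+ (c ℤ.+ m ℤ.* k) ℤ.* d ℤ.-
    (d ℤ.+ m ℤ.* l) ℤ.* c
       ≡ m ℤ.* (i ℤ.* b ℤ.- j ℤ.* a ℤ.+ k ℤ.* d ℤ.- l ℤ.* c)
  z₂ = solve-∀
  factor : ∀ m r A B C D → (m ℤ.* r ℤ.+ m ℤ.* A) ℤ.* (m ℤ.* r ℤ.+ m ℤ.* A) ℤ.+ (m ℤ.* B) ℤ.* (m ℤ.* B) ℤ.+
           (m ℤ.* C) ℤ.* (m ℤ.* C) ℤ.+ (m ℤ.* D) ℤ.* (m ℤ.* D) ≡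
           m ℤ.* m ℤ.* ((r ℤ.+ A) ℤ.* (r ℤ.+ A) ℤ.+ B ℤ.* B ℤ.+ C ℤ.* C ℤ.+ D ℤ.* D)
  factor = solve-∀

sumℕ-zero : ∀ {a b c d} → sumℕ a b c d ≡ 0 → a ≡ 0 × b ≡ 0 × c ≡ 0 × d ≡ 0
sumℕ-zero {a} {b} {c} {d} e =
  let e₁ = m+n≡0⇒m≡0 (a * a + b * b + c * c) e ; e₂ = m+n≡0⇒m≡0 (a * a + b * b) e₁
  in sq (m+n≡0⇒m≡0 (a * a) e₂) , sq (m+n≡0⇒n≡0 (a * a) e₂)
   , sq (m+n≡0⇒n≡0 (a * a + b * b) e₁) , sq (m+n≡0⇒n≡0 (a * a + b * b + c * c) e)
  where
  sq : ∀ {a} → a * a ≡ 0 → a ≡ 0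
  sq {zero} _ = refl

zeroSign : ∀ y m → ℤ.∣ y ∣ ≡ 0 → ∃[ s ] (ℤ.+ 2 ℤ.* y ≡ ℤ.+ m ℤ.* s)
zeroSign (ℤ.+ .0) m refl = 0ℤ , sym (ℤ.*-zeroʳ (ℤ.+ m))

multiple-∤ : ∀ p m t → Prime p → 1 < m → m < p → ¬ (ℤ.+ p ≡ ℤ.+ m ℤ.* t)
multiple-∤ p m t pr 1<m m<p e with prime⇒irreducible pr {m} (divides ℤ.∣ t ∣ (trans (cong ℤ.∣_∣ e)
                                     (trans (ℤ.abs-* (ℤ.+ m) t) (*-comm m ℤ.∣ t ∣))))
... | inj₁ r = <⇒≢ 1<m (sym r)
... | inj₂ r = <⇒≢ m<p r

-- The residues have sum of squares m r; both r = 0 and r = m would make m a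
-- divisor of p.

descend : ∀ p m → Prime p → 1 < m → m < p → FourSquares (ℤ.+ m ℤ.* ℤ.+ p) →
          ∃[ r ] (0 < r × r < m × FourSquares (ℤ.+ r ℤ.* ℤ.+ p))
descend p m@(suc m′) pr 1<m m<p (fourSquares x₁ x₂ x₃ x₄ e)
  with symmetricResidue x₁ m | symmetricResidue x₂ m | symmetricResidue x₃ m | symmetricResidue x₄ m
... | a , i , refl , ha | b , j , refl , hb | c , k , refl , hc | d , l , refl , hd =
  -- Expanding the four squares around the residues leaves m (p - C) = Y, so the new multiplier is r
  -- = p - C.
  go (ℤ.+ p ℤ.- C) refl (shift (ℤ.+ m) (ℤ.+ p) C Y e₁)
  where
  Y = Σ² a b c d
  K = i ℤ.* i ℤ.+ j ℤ.* j ℤ.+ k ℤ.* k ℤ.+ l ℤ.* l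
  C = (ℤ.+ 2 ℤ.* a) ℤ.* i ℤ.+ (ℤ.+ 2 ℤ.* b) ℤ.* j ℤ.+ (ℤ.+ 2 ℤ.* c) ℤ.* k ℤ.+ (ℤ.+ 2 ℤ.* d) ℤ.* l ℤ.+ ℤ.+ m ℤ.* K
  S = sumℕ ℤ.∣ a ∣ ℤ.∣ b ∣ ℤ.∣ c ∣ ℤ.∣ d ∣
  e₁ : ℤ.+ m ℤ.* ℤ.+ p ≡ Y ℤ.+ ℤ.+ m ℤ.* C
  e₁ = trans e (expand (ℤ.+ m) a b c d i j k l)
  shift : ∀ m p C Y → m ℤ.* p ≡ Y ℤ.+ m ℤ.* C → m ℤ.* (p ℤ.- C) ≡ Y
  shift m p C Y e = trans (dist m p C) (trans (cong (ℤ._- m ℤ.* C) e) (cancel Y (m ℤ.* C)))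
    where
    dist : ∀ m p C → m ℤ.* (p ℤ.- C) ≡ m ℤ.* p ℤ.- m ℤ.* C
    dist = solve-∀
    cancel : ∀ a b → a ℤ.+ b ℤ.- b ≡ a
    cancel = solve-∀
  Signs : Set
  Signs = (∃[ s ] (ℤ.+ 2 ℤ.* a ≡ ℤ.+ m ℤ.* s)) × (∃[ s ] (ℤ.+ 2 ℤ.* b ≡ ℤ.+ m ℤ.* s)) ×
          (∃[ s ] (ℤ.+ 2 ℤ.* c ≡ ℤ.+ m ℤ.* s)) × (∃[ s ] (ℤ.+ 2 ℤ.* d ≡ ℤ.+ m ℤ.* s))
  impossible : ∀ ε → ℤ.+ p ℤ.- C ≡ ℤ.+ m ℤ.* ε → Signs → ⊥
  impossible ε e ((s , p₁) , (t , p₂) , (u , p₃) , (v , p₄)) =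
    multiple-∤ p m (ε ℤ.+ (s ℤ.* i ℤ.+ t ℤ.* j ℤ.+ u ℤ.* k ℤ.+ v ℤ.* l ℤ.+ K)) pr 1<m m<p
      (trans (recover (ℤ.+ p) C) (trans (cong₂ ℤ._+_ e (cong (ℤ._+ ℤ.+ m ℤ.* K)
          (cong₂ ℤ._+_ (cong₂ ℤ._+_ (cong₂ ℤ._+_ (cong (ℤ._* i) p₁) (cong (ℤ._* j) p₂)) (cong (ℤ._* k) p₃))
            (cong (ℤ._* l) p₄))))
        (collect (ℤ.+ m) ε s t u v i j k l K)))
    where
    recover : ∀ p C → p ≡ p ℤ.- C ℤ.+ C
    recover = solve-∀
    collect : ∀ m ε s t u v i j k l K → m ℤ.* ε ℤ.+ (m ℤ.* s ℤ.* i ℤ.+ m ℤ.* t ℤ.* j ℤ.+ m ℤ.* u ℤ.* k ℤ.+ m ℤ.* v ℤ.*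
      l ℤ.+ m ℤ.* K)
              ≡ m ℤ.* (ε ℤ.+ (s ℤ.* i ℤ.+ t ℤ.* j ℤ.+ u ℤ.* k ℤ.+ v ℤ.* l ℤ.+ K))
    collect = solve-∀
  go : ∀ R → ℤ.+ p ℤ.- C ≡ R → ℤ.+ m ℤ.* R ≡ Y → ∃[ r ] (0 < r × r < m × FourSquares (ℤ.+ r ℤ.* ℤ.+ p))
  go ℤ.-[1+ n ] _   h = contradiction (trans h (Σ²-abs a b c d)) λ ()
  go (ℤ.+ r)    eqR h with r ≟ 0 | r ≟ m
  ... | yes refl | _ = ⊥-elim (impossible 0ℤ (trans eqR (sym (ℤ.*-zeroʳ (ℤ.+ m))))
      (zeroSign a m (proj₁ zs) , zeroSign b m (proj₁ (proj₂ zs)) , zeroSign c m (proj₁ (proj₂ (proj₂ zs))) , zeroSign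
        d m (proj₂ (proj₂ (proj₂ zs)))))
    where
    zs = sumℕ-zero (ℤ.+-injective (trans (sym (trans h (Σ²-abs a b c d))) (ℤ.*-zeroʳ (ℤ.+ m))))
  ... | no _ | yes refl = ⊥-elim (impossible 1ℤ (trans eqR (sym (ℤ.*-identityʳ (ℤ.+ m))))
      (signOf a (proj₁ ts) , signOf b (proj₁ (proj₂ ts)) , signOf c (proj₁ (proj₂ (proj₂ ts))) , signOf d
        (proj₂ (proj₂ (proj₂ ts)))))
    where
    ts = sumℕ-tight ha hb hc hd (trans (doubled ℤ.∣ a ∣ ℤ.∣ b ∣ ℤ.∣ c ∣ ℤ.∣ d ∣)
      (trans (cong (4 *_) (ℤ.+-injective (trans (sym (trans h (Σ²-abs a b c d))) (sym (ℤ.pos-* m m))))) (sym (quadruple m))))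
  ... | no r≢0 | no r≢m = r , n≢0⇒n>0 r≢0 , ≤∧≢⇒< r≤m r≢m , fourSquares
      (ℤ.+ r ℤ.+ (i ℤ.* a ℤ.+ j ℤ.* b ℤ.+ k ℤ.* c ℤ.+ l ℤ.* d)) (i ℤ.* b ℤ.- j ℤ.* a ℤ.+ k ℤ.* d ℤ.- l ℤ.* c)
      (i ℤ.* c ℤ.- k ℤ.* a ℤ.+ l ℤ.* b ℤ.- j ℤ.* d) (i ℤ.* d ℤ.- l ℤ.* a ℤ.+ j ℤ.* c ℤ.- k ℤ.* b)
      (ℤ.*-cancelˡ-≡ (ℤ.+ m ℤ.* ℤ.+ m) _ _ (trans (regroup (ℤ.+ m) (ℤ.+ r) (ℤ.+ p))
        (trans (cong₂ ℤ._*_ e h) (eulerResidue (ℤ.+ m) a b c d i j k l (ℤ.+ r) (sym h)))))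
    where
    regroup : ∀ m r p → m ℤ.* m ℤ.* (r ℤ.* p) ≡ (m ℤ.* p) ℤ.* (m ℤ.* r)
    regroup = solve-∀
    r≤m : r ≤ m
    r≤m = *-cancelˡ-≤ m (*-cancelˡ-≤ 4 (begin
      4 * (m * r)   ≡⟨ cong (4 *_) (ℤ.+-injective (trans (ℤ.pos-* m r) (trans h (Σ²-abs a b c d)))) ⟩
      4 * S         ≡⟨ sym (doubled ℤ.∣ a ∣ ℤ.∣ b ∣ ℤ.∣ c ∣ ℤ.∣ d ∣) ⟩
      sumℕ (2 * ℤ.∣ a ∣) (2 * ℤ.∣ b ∣) (2 * ℤ.∣ c ∣) (2 * ℤ.∣ d ∣) ≤⟨ sumℕ-mono ha hb hc hd ⟩
      sumℕ m m m m  ≡⟨ quadruple m ⟩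
      4 * (m * m)   ∎))
      where open ≤-Reasoning

-- `n` bounds m, which shrinks at each step; this makes the recursion structural.
descent : ∀ n p m → m ≤ n → Prime p → 0 < m → m < p → FourSquares (ℤ.+ m ℤ.* ℤ.+ p) → FourSquares (ℤ.+ p)
descent n       p (suc zero)      _        pr _ _   s = subst FourSquares (ℤ.*-identityˡ (ℤ.+ p)) s
descent (suc n) p m@(suc (suc _)) (s≤s m≤) pr _ m<p s with descend p m pr (s≤s (s≤s z≤n)) m<p s
... | r , r>0 , r<m , s′ = descent n p r (≤-trans (≤-pred r<m) m≤) pr r>0 (<-trans r<m m<p) s′

%-≡ : ∀ u v p .{{_ : NonZero p}} → u % p ≡ v % p → ∃[ t ] (ℤ.+ u ℤ.- ℤ.+ v ≡ t ℤ.* ℤ.+ p)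
%-≡ u v p e = ℤ.+ (u / p) ℤ.- ℤ.+ (v / p) , trans (cong₂ ℤ._-_ (div u)
  (trans (div v) (cong (λ r → ℤ.+ r ℤ.+ ℤ.+ (v / p) ℤ.* ℤ.+ p) (sym e))))
  (factor (ℤ.+ (u % p)) (ℤ.+ (u / p)) (ℤ.+ (v / p)) (ℤ.+ p))
  where
  div : ∀ u → ℤ.+ u ≡ ℤ.+ (u % p) ℤ.+ ℤ.+ (u / p) ℤ.* ℤ.+ p
  div u = trans (cong ℤ.+_ (m≡m%n+[m/n]*n u p)) (trans (ℤ.pos-+ (u % p) _)
    (cong (λ z → ℤ.+ (u % p) ℤ.+ z) (ℤ.pos-* (u / p) p)))
  factor : ∀ r q q′ p → (r ℤ.+ q ℤ.* p) ℤ.- (r ℤ.+ q′ ℤ.* p) ≡ (q ℤ.- q′) ℤ.* p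
  factor = solve-∀

-- j² - i² = (j - i)(j + i), and both factors are positive and smaller than p.
squares-incongruent : ∀ p i j t → Prime p → i < j → i + j < p →
                      ¬ (ℤ.+ j ℤ.* ℤ.+ j ℤ.- ℤ.+ i ℤ.* ℤ.+ i ≡ t ℤ.* ℤ.+ p)
squares-incongruent p i j t pr i<j i+j<p e with m≤n⇒∃[o]m+o≡n i<j
... | o , refl = [ tooSmall (s≤s z≤n) (≤-<-trans (≤-trans (s≤s (m≤n+m o i)) (m≤n+m _ i)) i+j<p)
                 , tooSmall (≤-trans (s≤s z≤n) (m≤n+m (suc i + o) i)) i+j<p ]′
  (euclidsLemma (suc o) (i + (suc i + o)) pr (divides ℤ.∣ t ∣ (trans
    (cong ℤ.∣_∣ {ℤ.+ (suc o * (i + (suc i + o)))} {t ℤ.* ℤ.+ p} (trans (sym difference) e)) (ℤ.abs-* t (ℤ.+ p)))))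
  where
  tooSmall : ∀ {x} → 0 < x → x < p → ¬ (p ∣ x)
  tooSmall {suc x} _ lt d = <⇒≱ lt (∣⇒≤ d)
  difference : ℤ.+ (suc i + o) ℤ.* ℤ.+ (suc i + o) ℤ.- ℤ.+ i ℤ.* ℤ.+ i ≡ ℤ.+ (suc o * (i + (suc i + o)))
  difference = trans (cong (λ z → z ℤ.* z ℤ.- ℤ.+ i ℤ.* ℤ.+ i) cast) (trans (factor (ℤ.+ i) (ℤ.+ (suc o)))
    (sym (trans (ℤ.pos-* (suc o) _) (cong (λ z → ℤ.+ (suc o) ℤ.* z) (trans (ℤ.pos-+ i _) (cong (λ z → ℤ.+ i ℤ.+ z) cast))))))
    where
    cast : ℤ.+ (suc i + o) ≡ ℤ.+ i ℤ.+ ℤ.+ (suc o)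
    cast = trans (cong ℤ.+_ (sym (+-suc i o))) (ℤ.pos-+ i (suc o))
    factor : ∀ i d → (i ℤ.+ d) ℤ.* (i ℤ.+ d) ℤ.- i ℤ.* i ≡ d ℤ.* (i ℤ.+ (i ℤ.+ d))
    factor = solve-∀

module PrimeMultiple (p : ℕ) (pr : Prime p) where
  instance
    p≢0 : NonZero p
    p≢0 = prime⇒nonZero pr

  h = p / 2

  p≡ : p ≡ p % 2 + h * 2
  p≡ = m≡m%n+[m/n]*n p 2

  2h≤p : h + h ≤ p
  2h≤p = ≤-trans (≤-reflexive (trans (cong (h +_) (sym (+-identityʳ h))) (*-comm 2 h)))
    (≤-trans (m≤n+m (h * 2) (p % 2)) (≤-reflexive (sym p≡)))

  p<2h+2 : p < suc h + suc h
  p<2h+2 = ≤-trans (≤-reflexive (cong suc p≡)) (≤-trans (+-monoˡ-≤ (h * 2) (m%n<n p 2))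
    (≤-reflexive (trans (cong (2 +_) (trans (*-comm h 2) (cong (h +_) (+-identityʳ h)))) (cong suc (sym (+-suc h h))))))

  1<p : 1 < p
  1<p = nonTrivial⇒n>1 p {{prime⇒nonTrivial pr}}

  0<h : 0 < h
  0<h with h in e
  ... | zero  = contradiction (subst (_< 2) (sym (trans p≡
    (trans (cong (λ z → p % 2 + z * 2) e) (+-identityʳ (p % 2))))) (m%n<n p 2)) (≤⇒≯ 1<p)
  ... | suc _ = s≤s z≤n

  -- The squares i² and the numbers − 1 − b², for i, b ≤ h.

  negative : ℕ → ℕ
  negative b = pred p * suc (b * b)

  val : ℕ → ℕ
  val n with n ≤? h
  ... | yes _ = n * n
  ... | no _  = negative (n ∸ suc h)

  val-low : ∀ {n} → n ≤ h → val n ≡ n * n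
  val-low {n} le with n ≤? h
  ... | yes _ = refl
  ... | no ≰  = contradiction le ≰

  val-high : ∀ {n} → ¬ (n ≤ h) → val n ≡ negative (n ∸ suc h)
  val-high {n} ≰ with n ≤? h
  ... | yes le = contradiction le ≰
  ... | no _   = refl

  residue : Fin (suc h + suc h) → Fin p
  residue i = fromℕ< (m%n<n (val (toℕ i)) p)

  small-sum : ∀ {i j} → i < j → j ≤ h → i + j < p
  small-sum i<j j≤h = <-≤-trans (+-mono-<-≤ (<-≤-trans i<j j≤h) j≤h) 2h≤p

  -- p - 1 stands for -1 modulo p, which keeps `negative` within ℕ.
  negativeℤ : ∀ b → ℤ.+ negative b ≡ (ℤ.+ p ℤ.- 1ℤ) ℤ.* (1ℤ ℤ.+ ℤ.+ b ℤ.* ℤ.+ b)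
  negativeℤ b = trans (ℤ.pos-* (pred p) (suc (b * b))) (cong₂ ℤ._*_
    (trans (simplify (ℤ.+ pred p)) (cong (ℤ._- 1ℤ) (trans (sym (ℤ.pos-+ 1 (pred p))) (cong ℤ.+_ (suc-pred p)))))
    (trans (ℤ.pos-+ 1 (b * b)) (cong (λ z → 1ℤ ℤ.+ z) (ℤ.pos-* b b))))
    where
    simplify : ∀ z → z ≡ 1ℤ ℤ.+ z ℤ.- 1ℤ
    simplify = solve-∀

  Result : Set
  Result = ∃[ m ] (0 < m × m < p × FourSquares (ℤ.+ m ℤ.* ℤ.+ p))

  mixed : ∀ i b → i ≤ h → b ≤ h → (i * i) % p ≡ negative b % p → Result
  mixed i b i≤h b≤h e with %-≡ (i * i) (negative b) p e
  ... | t , eq = fromDivisor (divides ℤ.∣ t ℤ.+ (1ℤ ℤ.+ ℤ.+ b ℤ.* ℤ.+ b) ∣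
    (trans (cong ℤ.∣_∣ eqℤ) (ℤ.abs-* (t ℤ.+ (1ℤ ℤ.+ ℤ.+ b ℤ.* ℤ.+ b)) (ℤ.+ p))))
    where
    N = i * i + b * b + 1
    castN : ℤ.+ N ≡ ℤ.+ i ℤ.* ℤ.+ i ℤ.+ ℤ.+ b ℤ.* ℤ.+ b ℤ.+ 1ℤ
    castN = trans (ℤ.pos-+ (i * i + b * b) 1) (cong (ℤ._+ 1ℤ)
      (trans (ℤ.pos-+ (i * i) (b * b)) (cong₂ ℤ._+_ (ℤ.pos-* i i) (ℤ.pos-* b b))))
    rearrange : ∀ x y p → x ℤ.+ y ℤ.+ 1ℤ ≡ (x ℤ.- (p ℤ.- 1ℤ) ℤ.* (1ℤ ℤ.+ y)) ℤ.+ (1ℤ ℤ.+ y) ℤ.* p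
    rearrange = solve-∀
    factor : ∀ t y p → t ℤ.* p ℤ.+ (1ℤ ℤ.+ y) ℤ.* p ≡ (t ℤ.+ (1ℤ ℤ.+ y)) ℤ.* p
    factor = solve-∀
    eqℤ : ℤ.+ N ≡ (t ℤ.+ (1ℤ ℤ.+ ℤ.+ b ℤ.* ℤ.+ b)) ℤ.* ℤ.+ p
    eqℤ = trans castN (trans (rearrange (ℤ.+ i ℤ.* ℤ.+ i) (ℤ.+ b ℤ.* ℤ.+ b) (ℤ.+ p))
      (trans (cong (ℤ._+ (1ℤ ℤ.+ ℤ.+ b ℤ.* ℤ.+ b) ℤ.* ℤ.+ p) (trans (sym (cong₂ ℤ._-_ (ℤ.pos-* i i) (negativeℤ b))) eq))
             (factor t (ℤ.+ b ℤ.* ℤ.+ b) (ℤ.+ p))))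
    N<p² : N < p * p
    -- Here N ≤ 2h² + 1 < 4h² ≤ p², so the quotient of N by p is smaller than p.
    N<p² = begin-strict
      i * i + b * b + 1                 ≤⟨ +-monoˡ-≤ 1 (+-mono-≤ (*-mono-≤ i≤h i≤h) (*-mono-≤ b≤h b≤h)) ⟩
      h * h + h * h + 1                 <⟨ +-monoʳ-< (h * h + h * h) (s≤s (*-mono-≤ 0<h 0<h)) ⟩
      h * h + h * h + suc (h * h)       ≤⟨ +-monoʳ-≤ (h * h + h * h) (+-monoˡ-≤ (h * h) (*-mono-≤ 0<h 0<h)) ⟩
      h * h + h * h + (h * h + h * h)   ≡⟨ cong₂ _+_ (sym (*-distribˡ-+ h h h)) (sym (*-distribˡ-+ h h h)) ⟩
      h * (h + h) + h * (h + h)         ≡⟨ sym (*-distribʳ-+ (h + h) h h) ⟩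
      (h + h) * (h + h)                 ≤⟨ *-mono-≤ 2h≤p 2h≤p ⟩
      p * p ∎
      where open ≤-Reasoning
    fromDivisor : p ∣ N → Result
    fromDivisor (divides q e) = q
      , n≢0⇒n>0 (λ { refl → contradiction (subst (1 ≤_) e (m≤n+m 1 (i * i + b * b))) λ () })
      , *-cancelʳ-< p q p (subst (_< p * p) e N<p²)
      , fourSquares (ℤ.+ i) (ℤ.+ b) 1ℤ 0ℤ (trans (sym (ℤ.pos-* q p))
        (trans (cong ℤ.+_ (sym e)) (trans castN (sym (ℤ.+-identityʳ _)))))

  low : ∀ i j → i < j → j ≤ h → ¬ ((j * j) % p ≡ (i * i) % p)
  low i j i<j j≤h e with %-≡ (j * j) (i * i) p e
  ... | t , eq = squares-incongruent p i j t pr i<j (small-sum i<j j≤h)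
    (trans (sym (cong₂ ℤ._-_ (ℤ.pos-* j j) (ℤ.pos-* i i))) eq)

  high : ∀ i j → i < j → j ≤ h → ¬ (negative j % p ≡ negative i % p)
  high i j i<j j≤h e with %-≡ (negative j) (negative i) p e
  ... | t , eq = squares-incongruent p i j (x ℤ.- t) pr i<j (small-sum i<j j≤h)
    (trans (rearrange (ℤ.+ p) (ℤ.+ j ℤ.* ℤ.+ j) (ℤ.+ i ℤ.* ℤ.+ i))
      (trans (cong (λ z → x ℤ.* ℤ.+ p ℤ.- z) (trans (sym (cong₂ ℤ._-_ (negativeℤ j) (negativeℤ i))) eq))
        (factor x t (ℤ.+ p))))
    where
    x = ℤ.+ j ℤ.* ℤ.+ j ℤ.- ℤ.+ i ℤ.* ℤ.+ i
    rearrange : ∀ p a b → a ℤ.- b ≡ (a ℤ.- b) ℤ.* p ℤ.- ((p ℤ.- 1ℤ) ℤ.* (1ℤ ℤ.+ a) ℤ.- (p ℤ.- 1ℤ) ℤ.* (1ℤ ℤ.+ b))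
    rearrange = solve-∀
    factor : ∀ x t p → x ℤ.* p ℤ.- t ℤ.* p ≡ (x ℤ.- t) ℤ.* p
    factor = solve-∀

  below : ∀ {j} → j < suc h + suc h → j ∸ suc h ≤ h
  below {j} lt = ≤-pred (m<n+o⇒m∸n<o j (suc h) lt)

  collision : (i j : ℕ) → i < j → j < suc h + suc h → val i % p ≡ val j % p → Result
  collision i j i<j j< e = go (i ≤? h) (j ≤? h)
    where
    go : Dec (i ≤ h) → Dec (j ≤ h) → Result
    go (yes p₁) (yes p₂) = contradiction (trans (cong (_% p) (sym (val-low p₂)))
      (trans (sym e) (cong (_% p) (val-low p₁)))) (low i j i<j p₂)
    go (yes p₁) (no p₂)  = mixed i (j ∸ suc h) p₁ (below j<)
      (trans (cong (_% p) (sym (val-low p₁))) (trans e (cong (_% p) (val-high p₂))))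
    go (no p₁)  (yes p₂) = contradiction (≤-trans (<⇒≤ i<j) p₂) p₁
    go (no p₁)  (no p₂)  = contradiction
      (trans (cong (_% p) (sym (val-high p₂))) (trans (sym e) (cong (_% p) (val-high p₁))))
      (high (i ∸ suc h) (j ∸ suc h) (∸-monoˡ-< i<j (≰⇒> p₁)) (below j<))

  -- There are 2h + 2 > p numbers in the two families, so two of them agree modulo p. By `low` and
  -- `high` they come from different families, and then p divides i² + b² + 1.
  prime-multiple : ∃[ m ] (0 < m × m < p × FourSquares (ℤ.+ m ℤ.* ℤ.+ p))
  prime-multiple with Fin.pigeonhole p<2h+2 residue
  ... | i , j , i<j , e = collision (toℕ i) (toℕ j) i<j (Fin.toℕ<n j)
    (trans (sym (Fin.toℕ-fromℕ< (m%n<n (val (toℕ i)) p))) (trans (cong toℕ e) (Fin.toℕ-fromℕ< (m%n<n (val (toℕ j)) p))))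

fourSquares-prime : ∀ p → Prime p → FourSquares (ℤ.+ p)
fourSquares-prime p pr = let m , m>0 , m<p , s = PrimeMultiple.prime-multiple p pr in descent m p m ≤-refl pr m>0 m<p s

fourSquares-product : ∀ ps → All Prime ps → FourSquares (ℤ.+ product ps)
fourSquares-product []       []       = fourSquares 1ℤ 0ℤ 0ℤ 0ℤ refl
fourSquares-product (p ∷ ps) (q ∷ qs) = subst FourSquares (sym (ℤ.pos-* p (product ps)))
  (fourSquares-* (fourSquares-prime p q) (fourSquares-product ps qs))

lagrange : ∀ n → FourSquares (ℤ.+ n)
lagrange zero      = fourSquares 0ℤ 0ℤ 0ℤ 0ℤ refl
lagrange n@(suc _) = subst (λ m → FourSquares (ℤ.+ m)) (sym (PrimeFactorisation.isFactorisation f))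
  (fourSquares-product (PrimeFactorisation.factors f) (PrimeFactorisation.factorsPrime f))
  where
  f = factorise n

-- The equinumerosity of a gauge ultrafilter

module Ultra (em : ExcludedMiddle 0ℓ) (𝒰 : Pred (Subset FinSet) 0ℓ) (uf : IsUltrafilter 𝒰) where

  open IsUltrafilter uf

  -- "Almost everywhere": `𝒰` is a family of Boolean functions, and excluded middle lets
  -- propositions be used in their place.
  AE : (FinSet → Set) → Set
  AE P = 𝒰 (λ F → does (em {P F}))

  module _ {P : FinSet → Set} where

    AE-intro : ∀ {A} → (∀ F → F ∈ˢ A → P F) → 𝒰 A → AE P
    AE-intro s = upward (λ F i → dec-true em (s F i))

    AE-elim : ∀ {A} → (∀ F → P F → F ∈ˢ A) → AE P → 𝒰 A
    AE-elim s = upward (λ F i → s F (does-true em i))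

    AE-all : (∀ F → P F) → AE P
    AE-all p = AE-intro (λ F _ → p F) whole

    AE-mono : ∀ {Q : FinSet → Set} → (∀ F → P F → Q F) → AE P → AE Q
    AE-mono f = upward (λ F i → dec-true em (f F (does-true em i)))

    AE-∩ : ∀ {Q : FinSet → Set} → AE P → AE Q → AE (λ F → P F × Q F)
    AE-∩ p q = upward (λ F i → let a , b = ∧-true i in dec-true em (does-true em a , does-true em b)) (∩-closed p q)

    AE-witness : AE P → ∃[ F ] P F
    AE-witness p with em {∃[ F ] P F}
    ... | yes w = w
    ... | no ¬w = contradiction (upward (λ F i → contradiction (F , does-true em i) ¬w) p) proper

    AE-ultra : AE P ⊎ AE (λ F → ¬ P F)
    AE-ultra with ultra (λ F → does (em {P F}))
    ... | inj₁ p = inj₁ p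
    ... | inj₂ p = inj₂ (upward (λ F i → dec-true em (λ q → not-true i (dec-true em q))) p)

  AE-map₂ : ∀ {P Q R : FinSet → Set} → (∀ F → P F → Q F → R F) → AE P → AE Q → AE R
  AE-map₂ f p q = AE-mono (λ F (a , b) → f F a b) (AE-∩ p q)

  Agree⇒AE : ∀ X Y → 𝒰 (Agree X Y) → AE (λ F → φ X F ≡ φ Y F)
  Agree⇒AE X Y = AE-intro (Agree⁻ X Y)

  AE⇒Agree : ∀ X Y → AE (λ F → φ X F ≡ φ Y F) → 𝒰 (Agree X Y)
  AE⇒Agree X Y = AE-elim (Agree⁺ X Y)

  module Fine (fine : ∀ n → 𝒰 (λ F → does (n ∈ᶠ? F))) where

    AE-∈ : ∀ n → AE (λ F → n ∈ elements F)
    AE-∈ n = AE-intro (λ F → does-true (n ∈ᶠ? F)) (fine n)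

    AE-⊆ : ∀ x → AE (λ F → x ⊆ᴸ elements F)
    AE-⊆ []      = AE-all (λ _ → [])
    AE-⊆ (n ∷ x) = AE-map₂ (λ _ → _∷_) (AE-∈ n) (AE-⊆ x)

    AE-big : AE Big
    AE-big = AE-map₂ (λ _ → big) (AE-∈ 0) (AE-∈ 1)

    suitable : SuitableUltrafilter 𝐱 𝒰
    suitable k = go (upTo (suc k))
      where
      go : ∀ ns → 𝒰 (λ F → all (λ n → does (at (𝐱 F) n ≟ 1)) ns)
      go []       = whole
      go (n ∷ ns) = ∩-closed (AE-elim (λ F i → dec-true (at (𝐱 F) n ≟ 1) (at-∈ {F} i)) (AE-∈ n)) (go ns)

    countingSet : IsCountingSet 𝐱
    countingSet k = AE-witness (AE-intro {P = λ F → F ∈ˢ Initial 𝐱 k} (λ _ i → i) (suitable k))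

    -- Some tuple lies in A but not in B. By fineness almost every F contains its components, and
    -- there `φ A` exceeds `φ B`.
    Succ⇒AE-< : ∀ {_≈_ : Rel 𝕎 0ℓ} → (∀ X Y → X ≈ Y → 𝒰 (Agree X Y)) →
                ∀ X Y → Succ _≈_ X Y → AE (λ F → φ Y F < φ X F)
    Succ⇒AE-< to X Y (A , B , s , p , q) = let x , i = ⊊-inhabited em {A} {B} s in AE-map₂
      (λ F (e , e′) c → subst₂ _<_ (sym e′) (sym e)
        (subst (φ B F <_) (sym (φ-⊆ A B (proj₁ s) F)) (m<m+n (φ B F) (φ-positive (A ∖ʷ B) F i c))))
      (AE-∩ (Agree⇒AE X A (to X A p)) (Agree⇒AE Y B (to Y B q))) (AE-⊆ x)

  module _ (gauge : IsGaugeUltrafilter 𝒰) where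

    open IsGaugeUltrafilter gauge using (squares)
    open Fine (IsGaugeUltrafilter.fine gauge)

    -- The gauge property supplies a function with nonnegative Möbius transform, and on big sets
    -- every such function counts a point set.
    squareSet : (f : FinSet → ℤ) → ∃[ W ] AE (λ F → f F ℤ.* f F ≡ ℤ.+ φ W F)
    squareSet f = let g , u , p = squares f in plusSet em g
      , AE-map₂ (λ F e b → trans e (sym (φ-plus-nonneg em g p b)))
          (AE-intro (λ F → does-true (f F ℤ.* f F ℤ.≟ g F)) u) AE-big

    -- The four roots are chosen separately for each F; this is allowed because the gauge property
    -- holds for arbitrary functions.
    natSet : (f : FinSet → ℕ) → ∃[ W ] AE (λ F → f F ≡ φ W F)
    natSet f = W , AE-map₂ (λ F (e₁ , e₂) (e₃ , e₄) → ℤ.+-injective (trans (sum-≡ (lagrange (f F)))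
                     (trans (cong₂ ℤ._+_ (cong₂ ℤ._+_ (cong₂ ℤ._+_ e₁ e₂) e₃) e₄) (sym (cast F)))))
                   (AE-∩ (proj₂ S₁) (proj₂ S₂)) (AE-∩ (proj₂ S₃) (proj₂ S₄))
      where
      open FourSquares
      S₁ = squareSet (λ F → r₁ (lagrange (f F)))
      S₂ = squareSet (λ F → r₂ (lagrange (f F)))
      S₃ = squareSet (λ F → r₃ (lagrange (f F)))
      S₄ = squareSet (λ F → r₄ (lagrange (f F)))
      _⊞_ = _⊕_ em
      W₁₂ = proj₁ S₁ ⊞ proj₁ S₂
      W₁₂₃ = W₁₂ ⊞ proj₁ S₃
      W = W₁₂₃ ⊞ proj₁ S₄
      cast : ∀ F → ℤ.+ φ W F ≡ ℤ.+ φ (proj₁ S₁) F ℤ.+ ℤ.+ φ (proj₁ S₂) F ℤ.+ ℤ.+ φ (proj₁ S₃) F ℤ.+ ℤ.+ φ (proj₁ S₄) F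
      cast F = trans (pos-φ-⊕ em W₁₂₃ (proj₁ S₄) F) (cong (ℤ._+ ℤ.+ φ (proj₁ S₄) F)
        (trans (pos-φ-⊕ em W₁₂ (proj₁ S₃) F) (cong (ℤ._+ ℤ.+ φ (proj₁ S₃) F) (pos-φ-⊕ em (proj₁ S₁) (proj₁ S₂) F))))

    private
      _≈_ : Rel 𝕎 0ℓ
      X ≈ Y = 𝒰 (Agree X Y)

      same : ∀ X Y → (∀ F → φ X F ≡ φ Y F) → X ≈ Y
      same X Y e = AE⇒Agree X Y (AE-all e)

    -- By `natSet` the excess of X over Y is counted by a set W. Then X is equinumerous with Y ⊞ W,
    -- which contains a copy of Y, properly because the excess is positive somewhere.
    AE-<⇒Succ : ∀ X Y → AE (λ F → φ Y F < φ X F) → Succ _≈_ X Y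
    AE-<⇒Succ X Y lt = Y ⊞ W , copy em (const 0) Y ,
      ((λ _ → ∨-introˡ) , λ s → copy-disjoint em Y W (proj₁ extra)
        (s (proj₁ extra) (∨-introʳ {mem (copy em (const 0) Y) (proj₁ extra)} (proj₂ extra))) (proj₂ extra)) ,
      AE⇒Agree X (Y ⊞ W) (AE-map₂ (λ F l e → sym (trans (φ-⊕ em Y W F)
        (trans (cong (φ Y F +_) (sym e)) (m+[n∸m]≡n (<⇒≤ l))))) lt (proj₂ S)) ,
      same Y (copy em (const 0) Y) (λ F → sym (φ-copy em (const 0) Y F))
      where
      _⊞_ = _⊕_ em
      S = natSet (λ F → φ X F ∸ φ Y F)
      W = proj₁ S
      extra : ∃[ x ] (x ∈ʷ copy em (ν Y) W)
      extra = let F , l , e = AE-witness (AE-∩ lt (proj₂ S)) in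
        φ-positive⁻ (copy em (ν Y) W) F (subst (0 <_) (trans e (sym (φ-copy em (ν Y) W F))) (m<n⇒0<n∸m l))

    gauge⇒natural : IsNaturalEquinumerosity _≈_
    gauge⇒natural = record
      { isEquinumerosity = record
        { isEquivalence = record
          { refl  = λ {X} → same X X (λ _ → refl)
          ; sym   = λ {X} {Y} p → AE⇒Agree Y X (AE-mono (λ _ → sym) (Agree⇒AE X Y p))
          ; trans = λ {X} {Y} {Z} p q → AE⇒Agree X Z (AE-map₂ (λ _ → trans) (Agree⇒AE X Y p) (Agree⇒AE Y Z q)) }
        ; AP = λ A B → mk⇔
            (λ p → AE⇒Agree (A ∖ʷ B) (B ∖ʷ A) (AE-mono (λ F e → sym (+-cancelˡ-≡ (φ A F) _ _
              (trans (balance A B F) (cong (_+ φ (A ∖ʷ B) F) (sym e))))) (Agree⇒AE A B p)))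
            (λ p → AE⇒Agree A B (AE-mono (λ F e → +-cancelʳ-≡ (φ (B ∖ʷ A) F) _ _
              (trans (balance A B F) (cong (φ B F +_) e))) (Agree⇒AE (A ∖ʷ B) (B ∖ʷ A) p)))
        ; ZP = zp
        ; TP = λ A B τ inj perm im → same A B (φ-image {A} {B} {τ} inj
            (λ a p i → mk⇔ (∈-resp-↭ (perm a p)) (∈-resp-↭ (↭.↭-sym (perm a p)))) im)
        ; UP = λ A n → AE⇒Agree (A ×ʷ ｛ n ｝) A (AE-mono
            (λ F i → trans (φ-×ʷ A ｛ n ｝ (multipliable-｛｝ A n) F)
              (trans (cong (φ A F *_) (φ-｛｝-∈ {n} {F} i)) (*-identityʳ (φ A F))))
            (AE-∈ n))
        ; PP = λ {A} {B} {A′} {B′} m m′ p q → AE⇒Agree (A ×ʷ B) (A′ ×ʷ B′) (AE-map₂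
            (λ F e e′ → trans (φ-×ʷ A B m F) (trans (cong₂ _*_ e e′) (sym (φ-×ʷ A′ B′ m′ F))))
            (Agree⇒AE A A′ p) (Agree⇒AE B B′ q))
        }
      ; natural = λ X Y τ inj pres im → same X Y (φ-image {X} {Y} {τ} inj pres im)
      }
      where
      -- Either side counts A ∪ B, once starting from A and once from B.
      balance : ∀ A B F → φ A F + φ (B ∖ʷ A) F ≡ φ B F + φ (A ∖ʷ B) F
      balance A B F = trans (sym (φ-∪-∖ A B F)) (trans (φ-same {A ∪ B} {B ∪ A} (swap∪ A B) (swap∪ B A) F) (φ-∪-∖ B A F))
        where
        swap∪ : ∀ A B → A ∪ B ⊆ʷ B ∪ A
        swap∪ A B x p = [ ∨-introʳ {mem B x} , ∨-introˡ ]′ (∨-true {mem A x} p)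
      succ-< : ∀ X Y → Succ _≈_ X Y → AE (λ F → φ Y F < φ X F)
      succ-< = Succ⇒AE-< {_≈_} (λ _ _ p → p)
      incompatible : ∀ {P Q : FinSet → Set} → (∀ F → P F → Q F → ⊥) → AE P → AE Q → ⊥
      incompatible f p q = let F , a , b = AE-witness (AE-∩ p q) in f F a b
      zp : ∀ A B → Trichotomous _≈_ A B
      zp A B with AE-ultra {λ F → φ A F ≡ φ B F} | AE-ultra {λ F → φ B F < φ A F}
      ... | inj₁ e | _      = inj₁ (AE⇒Agree A B e
                            , (λ s → incompatible (λ _ p q → <⇒≢ q (sym p)) e (succ-< A B s))
                            , (λ s → incompatible (λ _ p q → <⇒≢ q p) e (succ-< B A s)))
      ... | inj₂ n | inj₁ l = inj₂ (inj₁ ((λ p → incompatible (λ _ q r → q r) n (Agree⇒AE A B p))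
                            , AE-<⇒Succ A B l
                            , (λ s → incompatible (λ _ → <-asym) l (succ-< B A s))))
      ... | inj₂ n | inj₂ g = inj₂ (inj₂ ((λ p → incompatible (λ _ q r → q r) n (Agree⇒AE A B p))
                            , (λ s → incompatible (λ _ q r → q r) g (succ-< A B s))
                            , AE-<⇒Succ B A (AE-map₂ (λ _ ≢ ≮ → ≤∧≢⇒< (≮⇒≥ ≮) ≢) n g)))

-- The gauge property, uniqueness and the ultrapower

module Numerosity (em : ExcludedMiddle 0ℓ) (_≈_ : Rel 𝕎 0ℓ) (nat : IsNaturalEquinumerosity _≈_)
                  (𝒰 : Pred (Subset FinSet) 0ℓ) (uf : IsUltrafilter 𝒰)
                  (≈⇔𝒰 : ∀ X Y → X ≈ Y ⇔ 𝒰 (Agree X Y)) where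

  open Natural em _≈_ nat hiding (𝒰; ≈⇔𝒰)
  open Ultra em 𝒰 uf

  ≈⇒AE : ∀ {X Y} → X ≈ Y → AE (λ F → φ X F ≡ φ Y F)
  ≈⇒AE {X} {Y} p = Agree⇒AE X Y (Equivalence.to (≈⇔𝒰 X Y) p)

  AE⇒≈ : ∀ {X Y} → AE (λ F → φ X F ≡ φ Y F) → X ≈ Y
  AE⇒≈ {X} {Y} p = Equivalence.from (≈⇔𝒰 X Y) (AE⇒Agree X Y p)

  -- If almost no F contained n, the counting function of the singleton of (n) would vanish almost
  -- everywhere, making it equinumerous with the empty set.
  isFine : ∀ n → 𝒰 (λ F → does (n ∈ᶠ? F))
  isFine n with AE-ultra {λ F → n ∈ elements F}
  ... | inj₁ p = AE-elim (λ F → dec-true (n ∈ᶠ? F)) p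
  ... | inj₂ p = contradiction
    (Ker-cong (λ {F} _ → trans (cong (λ k → ℤ.+ φ ｛ n ｝ F ℤ.- ℤ.+ k) (φ-∅ F)) (ℤ.+-identityʳ _))
      (≈⇒Ker {｛ n ｝} {∅} (AE⇒≈ (AE-mono (λ F n∉ → trans (φ-｛｝-∉ {n} {F} n∉) (sym (φ-∅ F))) p))))
    (inhabited⇒¬Ker {｛ n ｝} {n ∷ []} (∈-｛｝⁺ n))

  open Fine isFine public

  Ker⇒AE : ∀ {f} → Ker f → AE (λ F → f F ≡ 0ℤ)
  Ker⇒AE {f} (X , Y , p , q) = AE-map₂
    (λ F b e → trans (q b) (ℤ.i≡j⇒i-j≡0 (cong ℤ.+_ e))) AE-big (≈⇒AE p)

  -- Yields the gauge property, with squares for f, and surjectivity onto the ultrapower. In the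
  -- negative case f + φ_W vanishes almost everywhere; as both terms are nonnegative, so does f.
  nonnegative : ∀ f → (∀ F → 0ℤ ℤ.≤ f F) → ∃[ W ] AE (λ F → f F ≡ ℤ.+ φ W F)
  nonnegative f f≥0 = go (trichotomy f)
    where
    zero-case : AE (λ F → f F ≡ 0ℤ) → ∃[ W ] AE (λ F → f F ≡ ℤ.+ φ W F)
    zero-case p = ∅ , AE-mono (λ F e → trans e (cong ℤ.+_ (sym (φ-∅ F)))) p
    sum-zero : ∀ {i} n → 0ℤ ℤ.≤ i → i ℤ.+ ℤ.+ n ≡ 0ℤ → i ≡ 0ℤ
    sum-zero {ℤ.+ m} n _ e = cong ℤ.+_ (m+n≡0⇒m≡0 m (ℤ.+-injective (trans (ℤ.pos-+ m n) e)))
    go : Signed f →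
         ∃[ W ] AE (λ F → f F ≡ ℤ.+ φ W F)
    go (inj₁ k)                    = zero-case (Ker⇒AE k)
    go (inj₂ (W , _ , _ , inj₁ k)) = W , AE-mono (λ F → ℤ.i-j≡0⇒i≡j (f F) (ℤ.+ φ W F)) (Ker⇒AE k)
    go (inj₂ (W , _ , _ , inj₂ k)) = zero-case (AE-mono (λ F → sum-zero (φ W F) (f≥0 F)) (Ker⇒AE k))

  isGauge : IsGaugeUltrafilter 𝒰
  isGauge = record
    { isUltrafilter = uf
    ; fine          = isFine
    ; squares       = λ f → let W , p = nonnegative (λ F → f F ℤ.* f F) (λ F → square-nonneg (f F)) in
        (λ F → ℤ.+ φ W F) , AE-elim (λ F → dec-true (f F ℤ.* f F ℤ.≟ ℤ.+ φ W F)) p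
        , λ F → subst (0ℤ ℤ.≤_) (sym (mobius-φ W F)) (ℤ.+≤+ z≤n)
    }
    where
    square-nonneg : ∀ z → 0ℤ ℤ.≤ z ℤ.* z
    square-nonneg z = subst (0ℤ ℤ.≤_) (sym (square-abs z)) (ℤ.+≤+ z≤n)

  -- The right-hand side does not involve 𝒰, whence uniqueness.

  𝒰⇔≈ : ∀ A → 𝒰 A ⇔ (plusSet em (χ A) ≈ (｛ 0 ｝ ⊞ minusSet em (χ A)))
  𝒰⇔≈ A = mk⇔
    (λ u → AE⇒≈ (AE-map₂ (λ F i b → ℤ.+-injective (trans (solve₁ (ℤ.+ φ P F) (ℤ.+ φ M F))
        (trans (cong (λ z → z ℤ.+ ℤ.+ φ M F) (trans (φ-plus-minus em (χ A) b) (cong (if_then 1ℤ else 0ℤ) i)))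
          (sym (rhs F b)))))
      (AE-intro {P = λ F → F ∈ˢ A} (λ _ i → i) u) AE-big))
    (λ p → AE-elim {P = λ F → F ∈ˢ A} (λ _ i → i) (AE-map₂ (λ F e b → χ-one F (trans (sym (φ-plus-minus em (χ A) b))
        (trans (cong (λ z → z ℤ.- ℤ.+ φ M F) (trans (cong ℤ.+_ e) (rhs F b))) (solve₂ (ℤ.+ φ M F))))) (≈⇒AE p) AE-big))
    where
    P = plusSet em (χ A)
    M = minusSet em (χ A)
    rhs : ∀ F → Big F → ℤ.+ φ (｛ 0 ｝ ⊞ M) F ≡ 1ℤ ℤ.+ ℤ.+ φ M F
    rhs F (big i _) = trans (cong ℤ.+_ (trans (φ-⊕ em ｛ 0 ｝ M F) (cong (_+ φ M F) (φ-｛｝-∈ {0} {F} i)))) (ℤ.pos-+ 1 (φ M F))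
    solve₁ : ∀ p m → p ≡ (p ℤ.- m) ℤ.+ m
    solve₁ = solve-∀
    solve₂ : ∀ m → (1ℤ ℤ.+ m) ℤ.- m ≡ 1ℤ
    solve₂ = solve-∀
    χ-one : ∀ F → χ A F ≡ 1ℤ → F ∈ˢ A
    χ-one F e with A F
    ... | true = refl

  operations : NumerosityOperations _≈_
  operations = record
    { _+ᴺ_   = _⊞_
    ; _*ᴺ_   = _⊠_
    ; +-reps = λ A B → copy em (const 0) A , copy em (ν A) B , ≈-copy (const 0) A , ≈-copy (ν A) B , copy-disjoint em A B
    ; *-reps = λ A B → prefixFree em A , B
        , φ-ext-big (λ {F} b → sym (trans (φ-prefixFree em A F) (trans (cong (φ A F *_) (φ-corner-big b)) (*-identityʳ _))))
        , φ-ext (λ _ → refl) , prefixFree-multipliable em A B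
    ; +-spec = λ {A} {B} {A′} {B′} p q d → AE⇒≈ (AE-map₂
        (λ F e e′ → trans (φ-⊕ em A B F) (trans (cong₂ _+_ e e′) (sym (φ-∪ A′ B′ d F)))) (≈⇒AE p) (≈⇒AE q))
    ; *-spec = λ {A} {B} {A′} {B′} p q m → AE⇒≈ (AE-map₂
        (λ F b (e , e′) → trans (φ-⊗ em A B b) (trans (cong₂ _*_ e e′) (sym (φ-×ʷ A′ B′ m F))))
        AE-big (AE-∩ (≈⇒AE p) (≈⇒AE q)))
    }

  private
    pointwise : ∀ {f g : FinSet → ℕ} → AE (λ F → f F ≡ g F) → 𝒰 (λ F → does (f F ≟ g F))
    pointwise {f} {g} = AE-elim (λ F → dec-true (f F ≟ g F))

    pointwise⁻ : ∀ {f g : FinSet → ℕ} → 𝒰 (λ F → does (f F ≟ g F)) → AE (λ F → f F ≡ g F)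
    pointwise⁻ {f} {g} = AE-intro (λ F → does-true (f F ≟ g F))

    order : ∀ X Y → Prec _≈_ X Y ⇔ _<ᵁ_ 𝒰 (φ X) (φ Y)
    order X Y = mk⇔ (λ s → AE-elim (λ F → dec-true (φ X F <? φ Y F)) (lt Y X s))
                    (λ u → decide (IsEquinumerosity.ZP (IsNaturalEquinumerosity.isEquinumerosity nat) X Y)
                                   (AE-intro (λ F → does-true (φ X F <? φ Y F)) u))
      where
      lt : ∀ X Y → Succ _≈_ X Y → AE (λ F → φ Y F < φ X F)
      lt = Succ⇒AE-< {_≈_} (λ X Y → Equivalence.to (≈⇔𝒰 X Y))
      decide : Trichotomous _≈_ X Y → AE (λ F → φ X F < φ Y F) → Prec _≈_ X Y
      decide (inj₁ (p , _))            l = let F , a , b = AE-witness (AE-∩ (≈⇒AE p) l) in contradiction a (<⇒≢ b)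
      decide (inj₂ (inj₁ (_ , s , _))) l = let F , a , b = AE-witness (AE-∩ (lt X Y s) l) in contradiction a (<-asym b)
      decide (inj₂ (inj₂ (_ , _ , s))) l = s

  isomorphism : ΦInducesIsomorphism 𝒰 _≈_
  isomorphism = record
    { operations = operations
    ; φ          = φ
    ; induced    = λ X F → sym (Φ-𝕊 X F)
    ; isSemiringIsomorphism = record
      { isSemiringMonomorphism = record
        { isSemiringHomomorphism = record
          { isNearSemiringHomomorphism = record
            { +-isMonoidHomomorphism = record
              { isMagmaHomomorphism = record
                { isRelHomomorphism = record { cong = λ {X} {Y} p → pointwise {φ X} {φ Y} (≈⇒AE p) }
                ; homo = λ X Y → pointwise {φ (X ⊞ Y)} (AE-all (φ-⊕ em X Y)) }
              ; ε-homo = pointwise {φ ∅} (AE-all φ-∅) }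
            ; *-homo = λ X Y → pointwise {φ (X ⊠ Y)} (AE-mono (λ F b → φ-⊗ em X Y b) AE-big) }
          ; 1#-homo = pointwise {φ ｛ 0 ｝} (AE-mono (λ F → φ-｛｝-∈ {0} {F}) (AE-∈ 0)) }
        ; injective = λ {X} {Y} u → AE⇒≈ (pointwise⁻ {φ X} {φ Y} u) }
      ; surjective = λ f → let W , p = nonnegative (λ F → ℤ.+ f F) (λ _ → ℤ.+≤+ z≤n) in
          W , λ {Z} q → pointwise {φ Z} {f} (AE-map₂ (λ F e r → trans e (sym (ℤ.+-injective r))) (≈⇒AE q) p)
      }
    ; order = order
    }

𝒰-unique : ∀ (em : ExcludedMiddle 0ℓ) (_≈_ : Rel 𝕎 0ℓ) (nat : IsNaturalEquinumerosity _≈_) {𝒰 𝒱 : Pred (Subset FinSet) 0ℓ} →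
           IsUltrafilter 𝒰 → (∀ X Y → X ≈ Y ⇔ 𝒰 (Agree X Y)) →
           IsUltrafilter 𝒱 → (∀ X Y → X ≈ Y ⇔ 𝒱 (Agree X Y)) → ∀ A → 𝒰 A ⇔ 𝒱 A
𝒰-unique em _≈_ nat {𝒰} {𝒱} uf e vf e′ A = mk⇔ (from (V.𝒰⇔≈ A) ∘ to (U.𝒰⇔≈ A)) (from (U.𝒰⇔≈ A) ∘ to (V.𝒰⇔≈ A))
  where
  open Equivalence using (to; from)
  module U = Numerosity em _≈_ nat 𝒰 uf e
  module V = Numerosity em _≈_ nat 𝒱 vf e′

-- Membership in ℛ

∈ℛ-resp : ∀ {S T} → S ≐ T → S ∈ℛ → T ∈ℛ
∈ℛ-resp e r = record
  { boundedDegrees = let d , p = _∈ℛ.boundedDegrees r in d , λ a g → trans (sym (e a)) (p a g)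
  ; boundedCoeffs  = let b , p = _∈ℛ.boundedCoeffs r in
      b , λ a → subst (λ z → ℤ.∣ z ∣ * factorials a ≤ b * degree a !) (e a) (p a)
  }

∈ℛ-- : ∀ {S T} → S ∈ℛ → T ∈ℛ → (S -ˢ T) ∈ℛ
∈ℛ-- {S} {T} r s = record
  { boundedDegrees = (λ n → d n + d′ n) , λ a (n , g) → cong₂ ℤ._-_
      (p a (n , ≤-<-trans (m≤m+n (d n) (d′ n)) g)) (p′ a (n , ≤-<-trans (m≤n+m (d′ n) (d n)) g))
  ; boundedCoeffs  = b + b′ , λ a → let P = factorials a in begin
      ℤ.∣ coeff S a ℤ.- coeff T a ∣ * P             ≤⟨ *-monoˡ-≤ P (ℤ.∣i-j∣≤∣i∣+∣j∣ (coeff S a) (coeff T a)) ⟩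
      (ℤ.∣ coeff S a ∣ + ℤ.∣ coeff T a ∣) * P       ≡⟨ *-distribʳ-+ P ℤ.∣ coeff S a ∣ ℤ.∣ coeff T a ∣ ⟩
      ℤ.∣ coeff S a ∣ * P + ℤ.∣ coeff T a ∣ * P     ≤⟨ +-mono-≤ (q a) (q′ a) ⟩
      b * degree a ! + b′ * degree a !              ≡⟨ sym (*-distribʳ-+ (degree a !) b b′) ⟩
      (b + b′) * degree a !                         ∎
  }
  where
  open ≤-Reasoning
  d  = proj₁ (_∈ℛ.boundedDegrees r)
  p  = proj₂ (_∈ℛ.boundedDegrees r)
  d′ = proj₁ (_∈ℛ.boundedDegrees s)
  p′ = proj₂ (_∈ℛ.boundedDegrees s)
  b  = proj₁ (_∈ℛ.boundedCoeffs r)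
  q  = proj₂ (_∈ℛ.boundedCoeffs r)
  b′ = proj₁ (_∈ℛ.boundedCoeffs s)
  q′ = proj₂ (_∈ℛ.boundedCoeffs s)

scale : ℤ → Series → Series
scale c S = record
  { coeff    = λ a → c ℤ.* coeff S a
  ; finitary = λ n → let h , p = Series.finitary S n in
      h , λ a w l → trans (cong (c ℤ.*_) (p a w l)) (ℤ.*-zeroʳ c)
  }

∈ℛ-scale : ∀ c {S} → S ∈ℛ → scale c S ∈ℛ
∈ℛ-scale c {S} r = record
  { boundedDegrees = let d , p = _∈ℛ.boundedDegrees r in
      d , λ a g → trans (cong (c ℤ.*_) (p a g)) (ℤ.*-zeroʳ c)
  ; boundedCoeffs  = let b , p = _∈ℛ.boundedCoeffs r in ℤ.∣ c ∣ * b , λ a → let P = factorials a in begin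
      ℤ.∣ c ℤ.* coeff S a ∣ * P        ≡⟨ cong (_* P) (ℤ.abs-* c (coeff S a)) ⟩
      ℤ.∣ c ∣ * ℤ.∣ coeff S a ∣ * P    ≡⟨ *-assoc ℤ.∣ c ∣ ℤ.∣ coeff S a ∣ P ⟩
      ℤ.∣ c ∣ * (ℤ.∣ coeff S a ∣ * P)  ≤⟨ *-monoʳ-≤ ℤ.∣ c ∣ (p a) ⟩
      ℤ.∣ c ∣ * (b * degree a !)       ≡⟨ sym (*-assoc ℤ.∣ c ∣ b (degree a !)) ⟩
      ℤ.∣ c ∣ * b * degree a !         ∎
  }
  where open ≤-Reasoning

coeff-1ˢ-zero : ∀ a → a ≢ exponentOf [] → coeff 1ˢ a ≡ 0ℤ
coeff-1ˢ-zero a ≢ = cong (if_then 1ℤ else 0ℤ) (dec-false (a ≟ᴬ exponentOf []) ≢)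

coeff-1ˢ-one : coeff 1ˢ (exponentOf []) ≡ 1ℤ
coeff-1ˢ-one = cong (if_then 1ℤ else 0ℤ) (dec-true (exponentOf [] ≟ᴬ exponentOf []) refl)

1ˢ-∈ℛ : 1ˢ ∈ℛ
1ˢ-∈ℛ = record
  { boundedDegrees = const 0 , λ { a (n , g) → coeff-1ˢ-zero a (λ { refl → contradiction g λ () }) }
  ; boundedCoeffs  = 1 , bound
  }
  where
  bound : ∀ a → ℤ.∣ coeff 1ˢ a ∣ * factorials a ≤ 1 * degree a !
  bound a with a ≟ᴬ exponentOf []
  ... | yes refl = ≤-reflexive (cong (λ z → ℤ.∣ z ∣ * 1) coeff-1ˢ-one)
  ... | no ≢     = ≤-trans (≤-reflexive (cong (λ z → ℤ.∣ z ∣ * factorials a) (coeff-1ˢ-zero a ≢))) z≤n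

-- The product with a constant

zeros : List ℕ → List ℕ
zeros l = map (const 0) l

-- Only the split with zero first part survives; it comes first, as `upTo` starts at 0.
sumℤ-splits : ∀ (k : List ℕ × List ℕ → ℤ) l →
  (∀ b c i → 0 < entry b i → k (b , c) ≡ 0ℤ) → sumℤ (map k (splits l)) ≡ k (zeros l , l)
sumℤ-splits k []      z = ℤ.+-identityʳ _
sumℤ-splits k (n ∷ l) z = trans (cong sumℤ (List.map-++ k (map (pair 0) (splits l)) rest))
  (trans (sumℤ-++ (map k (map (pair 0) (splits l))) (map k rest)) (trans (cong₂ ℤ._+_
    (trans (cong sumℤ (sym (List.map-∘ {g = k} {f = pair 0} (splits l))))
      (sumℤ-splits (k ∘ pair 0) l (λ b c i p → z (0 ∷ b) (n ∷ c) (suc i) p)))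
    (sumℤ-zero k (All.tabulate (λ {x} i → vanish (∈-cartesianProductWith⁻ pair tail (splits l) i)))))
    (ℤ.+-identityʳ _)))
  where
  pair : ℕ → List ℕ × List ℕ → List ℕ × List ℕ
  pair i (b , c) = i ∷ b , (n ∸ i) ∷ c
  tail = applyUpTo suc n
  rest = cartesianProductWith pair tail (splits l)
  vanish : ∀ {x} → (∃₂ λ i s → i ∈ tail × s ∈ splits l × x ≡ pair i s) → k x ≡ 0ℤ
  vanish (i , (b , c) , m , _ , refl) with ∈-applyUpTo⁻ suc m
  ... | j , _ , refl = z (suc j ∷ b) ((n ∸ suc j) ∷ c) 0 (s≤s z≤n)

trim-zeros : ∀ l → ⟦ zeros l ⟧ ≡ exponentOf []
trim-zeros l = 𝐀-entries (trim-zero (zeros l) (go l))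
  where
  go : ∀ l i → entry (zeros l) i ≡ 0
  go []      i       = refl
  go (_ ∷ l) zero    = refl
  go (_ ∷ l) (suc i) = go l i

-- Ideals are closed under products of series, so integer multiples of their members are reached
-- through the constant series.
constant-* : ∀ c T → (scale c 1ˢ *ˢ T) ≐ scale c T
constant-* c T a = trans (sumℤ-splits (term (scale c 1ˢ) T) (entries a)
    (λ b d i p → trans (cong (ℤ._* coeff T ⟦ d ⟧) (trans (cong (c ℤ.*_) (coeff-1ˢ-zero ⟦ b ⟧
      (λ e → contradiction (subst (0 <_) (trans (sym (entry-trim b i)) (cong (λ a → entry (entries a) i) e)) p) λ ())))
      (ℤ.*-zeroʳ c))) (ℤ.*-zeroˡ (coeff T ⟦ d ⟧))))
  (cong₂ ℤ._*_ (trans (cong (λ e → c ℤ.* coeff 1ˢ e) (trim-zeros (entries a)))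
    (trans (cong (c ℤ.*_) coeff-1ˢ-one) (ℤ.*-identityʳ c)))
               (cong (coeff T) (⟦entries⟧ a)))

value-scale : ∀ c S x → value (scale c S) x ≡ c ℤ.* value S x
value-scale c S x = trans (sumℤ-map-≡ vs (λ {v} _ → ℤ.*-assoc c (coeff S ⟦ v ⟧) (ℤ.+ power (at x) v))) (sumℤ-map-*ˡ vs)
  where
  vs = box (Point.bound x) (proj₁ (Series.finitary S (Point.bound x)))
  sumℤ-map-*ˡ : ∀ vs → sumℤ (map (λ v → c ℤ.* monomialValue S x v) vs) ≡ c ℤ.* sumℤ (map (monomialValue S x) vs)
  sumℤ-map-*ˡ []       = sym (ℤ.*-zeroʳ c)
  sumℤ-map-*ˡ (v ∷ vs) = trans (cong (λ z → c ℤ.* monomialValue S x v ℤ.+ z) (sumℤ-map-*ˡ vs))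
    (sym (ℤ.*-distribˡ-+ c (monomialValue S x v) _))

value-1ˢ : ∀ x → value 1ˢ x ≡ 1ℤ
value-1ˢ x = trans (sumℤ-support (monomialValue 1ˢ x) (box-enum N h)
    (enum-self {xs = replicate N 0 ∷ []} ([] ∷ []))
    (λ {v} (l , _) nz → here (only v l nz))
    (λ { (here refl) _ → List.length-replicate N , All.replicate⁺ N z≤n }))
  (trans (ℤ.+-identityʳ _) (cong₂ (λ a p → a ℤ.* ℤ.+ p)
    (trans (cong (coeff 1ˢ) (𝐀-entries {⟦ replicate N 0 ⟧} {exponentOf []}
      (trim-zero (replicate N 0) (entry-replicate N)))) coeff-1ˢ-one)
    (power-one (at x) (replicate N 0) (λ i p → contradiction (subst (0 <_) (entry-replicate N i) p) λ ()))))
  where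
  N = Point.bound x
  h = proj₁ (Series.finitary 1ˢ N)
  entry-replicate : ∀ N i → entry (replicate N 0) i ≡ 0
  entry-replicate zero    i       = refl
  entry-replicate (suc N) zero    = refl
  entry-replicate (suc N) (suc i) = entry-replicate N i
  only : ∀ v → length v ≡ N → monomialValue 1ˢ x v ≢ 0ℤ → v ≡ replicate N 0
  only v l nz with ⟦ v ⟧ ≟ᴬ exponentOf []
  ... | yes e = entry-ext (trans l (sym (List.length-replicate N)))
                  (λ i → trans (trans (sym (entry-trim v i)) (cong (λ a → entry (entries a) i) e))
                    (sym (entry-replicate N i)))
  ... | no ≢  = contradiction (trans (cong (ℤ._* ℤ.+ power (at x) v) (coeff-1ˢ-zero ⟦ v ⟧ ≢))
    (ℤ.*-zeroˡ (ℤ.+ power (at x) v))) nz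

𝕊-｛｝ : ∀ n → 𝕊 ｛ n ｝ ≐ t n
𝕊-｛｝ n a with a ≟ᴬ exponentOf (n ∷ [])
... | yes refl = trans (coeff-𝕊 ｛ n ｝ a) (trans (cong ℤ.+_ (enum-length (members-enum ｛ n ｝ a)
        (enum-self {xs = (n ∷ []) ∷ []} ([] ∷ [])) (λ {x} (p , _) → here (∈-｛｝⁻ n x p))
          (λ { (here refl) → ∈-｛｝⁺ n , refl })))
      (sym (cong (if_then 1ℤ else 0ℤ) (dec-true (a ≟ᴬ a) refl))))
... | no ≢     = trans (coeff-𝕊 ｛ n ｝ a) (trans (cong ℤ.+_ (enum-length (members-enum ｛ n ｝ a)
        (enum-self {xs = []} []) (λ {x} (p , e) → contradiction (trans (sym e) (cong exponentOf (∈-｛｝⁻ n x p))) ≢) (λ ())))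
      (sym (cong (if_then 1ℤ else 0ℤ) (dec-false (a ≟ᴬ exponentOf (n ∷ [])) ≢))))

degreeBounded-｛｝ : ∀ n → DegreeBounded ｛ n ｝
degreeBounded-｛｝ n i = 1 , λ x p → subst (λ y → occurrences y i ≤ 1) (sym (∈-｛｝⁻ n x p)) (List.length-filter (_≟ i) (n ∷ []))

t-∈ℛ : ∀ n → t n ∈ℛ
t-∈ℛ n = ∈ℛ-resp {𝕊 ｛ n ｝} {t n} (𝕊-｛｝ n) (𝕊-∈ℛ ｛ n ｝ (degreeBounded-｛｝ n))

degreeBounded-∪ : ∀ A B → DegreeBounded A → DegreeBounded B → DegreeBounded (A ∪ B)
degreeBounded-∪ A B p q n = proj₁ (p n) + proj₁ (q n) , λ x i →
  [ (λ j → ≤-trans (proj₂ (p n) x j) (m≤m+n (proj₁ (p n)) (proj₁ (q n))))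
  , (λ j → ≤-trans (proj₂ (q n) x j) (m≤n+m (proj₁ (q n)) (proj₁ (p n)))) ]′ (∨-true {mem A x} i)

coeff-𝕊-∪ : ∀ A B → Disjoint A B → ∀ a → coeff (𝕊 (A ∪ B)) a ≡ coeff (𝕊 A) a ℤ.+ coeff (𝕊 B) a
coeff-𝕊-∪ A B d a = trans (coeff-𝕊 (A ∪ B) a) (trans (cong ℤ.+_ (trans
    (enum-length (members-enum (A ∪ B) a)
      (enum-++ (λ {x} (p , _) (q , _) → d x p q) (members-enum A a) (members-enum B a))
      (λ {x} (p , e) → [ (λ q → inj₁ (q , e)) , (λ q → inj₂ (q , e)) ]′ (∨-true {mem A x} p))
      (λ {x} → [ (λ (p , e) → ∨-introˡ p , e) , (λ (p , e) → ∨-introʳ {mem A x} p , e) ]′))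
    (List.length-++ (members A a))))
  (trans (ℤ.pos-+ (length (members A a)) (length (members B a))) (cong₂ ℤ._+_ (sym (coeff-𝕊 A a)) (sym (coeff-𝕊 B a)))))

-- Transfer of series in a gauge ideal to point sets

module _ (em : ExcludedMiddle 0ℓ) where

  -- Realizes the numbers `n a`, capped by the number of arrangements, by taking initial
  -- arrangements. Only exponents with nonzero coefficient in S occur, so finitariness and degree
  -- bounds come from S; the vanishing constant term keeps `[]` out.
  module Clip (S : Series) (n : 𝐀 → ℕ) (n-zero : ∀ a → coeff S a ≡ 0ℤ → n a ≡ 0)
              (constant : coeff S (exponentOf []) ≡ 0ℤ) where

    Chosen : Tuple → Set
    Chosen x = x ∈ take (n (exponentOf x)) (arrangements (exponentOf x))

    chosen⇒≢0 : ∀ {x} → Chosen x → coeff S (exponentOf x) ≢ 0ℤ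
    chosen⇒≢0 {x} i z with () ← subst (λ k → x ∈ take k (arrangements (exponentOf x))) (n-zero (exponentOf x) z) i

    clip : 𝕎
    clip = comprehension em Chosen (λ i → chosen⇒≢0 {[]} i constant)
      (λ m → proj₁ (Series.finitary S (suc m)) , λ x i b → ≮⇒≥ (λ lt → chosen⇒≢0 {x} i
        (proj₂ (Series.finitary S (suc m)) (exponentOf x) (narrow x b) (subst (_ <_) (sym (degree-exponentOf x)) lt))))
      where
      max≤ : ∀ {m} x → All (_≤ m) x → foldr _⊔_ 0 x ≤ m
      max≤ []      []      = z≤n
      max≤ (i ∷ x) (p ∷ b) = ⊔-lub p (max≤ x b)
      narrow : ∀ {m} x → All (_≤ m) x → width (exponentOf x) ≤ suc m
      narrow x b = ≤-trans (length-trim (map (occurrences x) (upTo (suc (foldr _⊔_ 0 x)))))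
        (≤-trans (≤-reflexive (trans (List.length-map (occurrences x) (upTo (suc (foldr _⊔_ 0 x))))
          (List.length-upTo (suc (foldr _⊔_ 0 x)))))
                 (s≤s (max≤ x b)))

    coeff-clip : ∀ a → coeff (𝕊 clip) a ≡ ℤ.+ (n a ⊓ length (arrangements a))
    coeff-clip a = trans (coeff-𝕊 clip a) (cong ℤ.+_ (trans
      (enum-length (members-enum clip a)
        (enum-self (Unique.take⁺ (n a) (unique (arrangements-enum a))))
        (λ { {x} (p , refl) → does-true em p })
        (λ {x} i → from x i (sound (arrangements-enum a) (take-⊆ (n a) (arrangements a) i))))
      (List.length-take (n a) (arrangements a))))
      where
      take-⊆ : ∀ k xs {x : Tuple} → x ∈ take k xs → x ∈ xs
      take-⊆ (suc k) (y ∷ xs) (here e)  = here e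
      take-⊆ (suc k) (y ∷ xs) (there i) = there (take-⊆ k xs i)
      from : ∀ x → x ∈ take (n a) (arrangements a) → exponentOf x ≡ a → x ∈ʷ clip × exponentOf x ≡ a
      from x i refl = dec-true em i , refl

    clip-degreeBounded : (d : ℕ → ℕ) → (∀ a → (∃[ i ] (entry (entries a) i > d i)) → coeff S a ≡ 0ℤ) → DegreeBounded clip
    clip-degreeBounded d p i = d i , λ x q → ≮⇒≥ (λ lt → chosen⇒≢0 {x} (does-true em q)
      (p (exponentOf x) (i , subst (d i <_) (sym (entry-exponentOf x i)) lt)))

  module _ (_≈_ : Rel 𝕎 0ℓ) (𝔍 : Pred Series 0ℓ) (nat : IsNaturalEquinumerosity _≈_)
           (gauge : IsGaugeIdeal 𝔍) (represents : Represents 𝔍 _≈_) where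

    open Natural em _≈_ nat
    open IsGaugeIdeal gauge using (isIdeal; ⊇𝔍₀)
    open IsIdeal isIdeal
      renaming (resp to 𝔍-resp; 0-closed to 𝔍-0; +-closed to 𝔍-+; *-closed to 𝔍-*)

    private
      𝔍-≈ : ∀ {X Y} → DegreeBounded X → DegreeBounded Y → X ≈ Y → 𝔍 (𝕊 X -ˢ 𝕊 Y)
      𝔍-≈ {X} {Y} p q = Equivalence.to (represents X Y (𝕊-∈ℛ X p) (𝕊-∈ℛ Y q))

      copy-bounded : ∀ lo X → DegreeBounded (copy em lo X)
      copy-bounded lo X = block-degreeBounded em lo (ν X)

      coeff-⊞ : ∀ A B a → coeff (𝕊 (A ⊞ B)) a ≡ coeff (𝕊 (copy em (const 0) A)) a ℤ.+ coeff (𝕊 (copy em (ν A) B)) a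
      coeff-⊞ A B = coeff-𝕊-∪ (copy em (const 0) A) (copy em (ν A) B) (copy-disjoint em A B)

    -- Membership in 𝔍 says nothing yet about zeros, which are the aim; so equality of values is
    -- recorded next to the congruence.
    Realization : Series → Set
    Realization S = ∃₂ λ X Y → (DegreeBounded X × DegreeBounded Y) × 𝔍 ((𝕊 X -ˢ 𝕊 Y) -ˢ S) ×
                    (∀ F → Φ S F ≡ δ X Y F)

    -- `⊞` replaces sets by disjoint copies with different series. The differences belong to 𝔍,
    -- because copies are equinumerous with the originals and all these series lie in ℛ.
    realization-step : ∀ S {A B} → DegreeBounded A → DegreeBounded B →
                       Realization (S -ˢ (𝕊 A -ˢ 𝕊 B)) → Realization S
    realization-step S {A} {B} bA bB (X , Y , (bX , bY) , j , v) = X ⊞ A , Y ⊞ B ,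
      (bounded X A , bounded Y B) ,
      𝔍-resp {R +ˢ ((D₁ +ˢ D₂) +ˢ (D₃ +ˢ D₄))} {(𝕊 (X ⊞ A) -ˢ 𝕊 (Y ⊞ B)) -ˢ S}
        (λ a → sym (trans
             (cong₂ (λ p q → (p ℤ.- q) ℤ.- coeff S a) (coeff-⊞ X A a) (coeff-⊞ Y B a))
             (regroup (coeff (𝕊 cX) a) (coeff (𝕊 cA) a) (coeff (𝕊 cY) a) (coeff (𝕊 cB) a)
                      (coeff (𝕊 X) a) (coeff (𝕊 A) a) (coeff (𝕊 Y) a) (coeff (𝕊 B) a) (coeff S a))))
        (𝔍-+ {R} {(D₁ +ˢ D₂) +ˢ (D₃ +ˢ D₄)} j (𝔍-+ {D₁ +ˢ D₂} {D₃ +ˢ D₄}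
          (𝔍-+ {D₁} {D₂} (𝔍-≈ {cX} {X} (copy-bounded (const 0) X) bX (≈-sym′ {X} {cX} (≈-copy (const 0) X)))
                         (𝔍-≈ {cA} {A} (copy-bounded (ν X) A) bA (≈-sym′ {A} {cA} (≈-copy (ν X) A))))
          (𝔍-+ {D₃} {D₄} (𝔍-≈ {Y} {cY} bY (copy-bounded (const 0) Y) (≈-copy (const 0) Y))
                         (𝔍-≈ {B} {cB} bB (copy-bounded (ν Y) B) (≈-copy (ν Y) B))))) ,
      λ F → trans (recover F) (sym (trans
        (cong₂ ℤ._-_ (pos-φ-⊕ em X A F) (pos-φ-⊕ em Y B F)) (inter (ℤ.+ φ X F) (ℤ.+ φ A F) (ℤ.+ φ Y F) (ℤ.+ φ B F))))
      where
      ≈-sym′ : ∀ {U V} → U ≈ V → V ≈ U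
      ≈-sym′ = IsEquivalence.sym (IsEquinumerosity.isEquivalence (IsNaturalEquinumerosity.isEquinumerosity nat))
      cX = copy em (const 0) X
      cA = copy em (ν X) A
      cY = copy em (const 0) Y
      cB = copy em (ν Y) B
      R  = (𝕊 X -ˢ 𝕊 Y) -ˢ (S -ˢ (𝕊 A -ˢ 𝕊 B))
      D₁ = 𝕊 cX -ˢ 𝕊 X
      D₂ = 𝕊 cA -ˢ 𝕊 A
      D₃ = 𝕊 Y -ˢ 𝕊 cY
      D₄ = 𝕊 B -ˢ 𝕊 cB
      bounded : ∀ U V → DegreeBounded (U ⊞ V)
      bounded U V = degreeBounded-∪ (copy em (const 0) U) (copy em (ν U) V) (copy-bounded (const 0) U) (copy-bounded (ν U) V)
      regroup : ∀ cX cA cY cB X A Y B S → ((cX ℤ.+ cA) ℤ.- (cY ℤ.+ cB)) ℤ.- S ≡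
        ((X ℤ.- Y) ℤ.- (S ℤ.- (A ℤ.- B))) ℤ.+ (((cX ℤ.- X) ℤ.+ (cA ℤ.- A)) ℤ.+ ((Y ℤ.- cY) ℤ.+ (B ℤ.- cB)))
      regroup = solve-∀
      inter : ∀ x a y b → (x ℤ.+ a) ℤ.- (y ℤ.+ b) ≡ (x ℤ.- y) ℤ.+ (a ℤ.- b)
      inter = solve-∀
      shift : ∀ s d → s ≡ (s ℤ.- d) ℤ.+ d
      shift = solve-∀
      recover : ∀ F → Φ S F ≡ δ X Y F ℤ.+ δ A B F
      recover F = trans (shift (Φ S F) (Φ (𝕊 A -ˢ 𝕊 B) F)) (cong₂ ℤ._+_
        (trans (sym (value-- S (𝕊 A -ˢ 𝕊 B) (𝐱 F))) (v F))
        (trans (value-- (𝕊 A) (𝕊 B) (𝐱 F)) (cong₂ ℤ._-_ (Φ-𝕊 A F) (Φ-𝕊 B F))))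

    realization-≐0 : ∀ S → S ≐ 0ˢ → Realization S
    realization-≐0 S e = ∅ , ∅ , (empty , empty) ,
      𝔍-resp {0ˢ} {(𝕊 ∅ -ˢ 𝕊 ∅) -ˢ S} (λ a → sym (cong₂ ℤ._-_ (ℤ.+-inverseʳ (coeff (𝕊 ∅) a)) (e a))) 𝔍-0 ,
      λ F → trans (trans (value-cong {S} {0ˢ} (𝐱 F) e) (value-0ˢ F)) (sym (ℤ.+-inverseʳ (ℤ.+ φ ∅ F)))
      where
      empty : DegreeBounded ∅
      empty _ = 0 , λ _ ()
      value-0ˢ : ∀ F → Φ 0ˢ F ≡ 0ℤ
      value-0ˢ F = sumℤ-zero (monomialValue 0ˢ (𝐱 F)) (All.universal (λ v → ℤ.*-zeroˡ (ℤ.+ power (at (𝐱 F)) v))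
        (box (Point.bound (𝐱 F)) 0))

    -- A coefficient may exceed the number of arrangements of its exponent by
    -- a factor b; each step takes off one multiple of that number.

    realize : ∀ b (d : ℕ → ℕ) S → coeff S (exponentOf []) ≡ 0ℤ →
      (∀ a → (∃[ n ] (entry (entries a) n > d n)) → coeff S a ≡ 0ℤ) →
      (∀ a → ℤ.∣ coeff S a ∣ * factorials a ≤ b * degree a !) → Realization S
    realize zero    d S z p q = realization-≐0 S (λ a → ℤ.∣i∣≡0⇒i≡0 (m*n≡0⇒m≡0 ℤ.∣ coeff S a ∣ (factorials a)
                                  {{product≢0 (All.map⁺ (All.universal (λ n → >-nonZero (n!>0 n)) (entries a)))}}
                                    (n≤0⇒n≡0 (q a))))
      where
      n!>0 : ∀ n → 0 < n !
      n!>0 zero    = s≤s z≤n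
      n!>0 (suc n) = *-mono-≤ (s≤s (z≤n {n})) (n!>0 n)
    realize (suc b) d S z p q = realization-step S {P.clip} {N.clip} (P.clip-degreeBounded d p) (N.clip-degreeBounded d p)
      (realize b d (S -ˢ (𝕊 P.clip -ˢ 𝕊 N.clip)) (vanish (exponentOf []) z) (λ a g → vanish a (p a g)) bound)
      where
      module P = Clip S (λ a → posPart (coeff S a)) (λ a e → cong posPart e) z
      module N = Clip S (λ a → negPart (coeff S a)) (λ a e → cong negPart e) z
      remainder : ∀ a → coeff S a ℤ.- (coeff (𝕊 P.clip) a ℤ.- coeff (𝕊 N.clip) a) ≡
                  coeff S a ℤ.- (ℤ.+ (posPart (coeff S a) ⊓ length (arrangements a)) ℤ.- ℤ.+
                    (negPart (coeff S a) ⊓ length (arrangements a)))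
      remainder a = cong₂ (λ u v → coeff S a ℤ.- (u ℤ.- v)) (P.coeff-clip a) (N.coeff-clip a)
      vanish : ∀ a → coeff S a ≡ 0ℤ → coeff S a ℤ.- (coeff (𝕊 P.clip) a ℤ.- coeff (𝕊 N.clip) a) ≡ 0ℤ
      vanish a e = trans (remainder a) (cong (λ s → s ℤ.-
        (ℤ.+ (posPart s ⊓ length (arrangements a)) ℤ.- ℤ.+ (negPart s ⊓ length (arrangements a)))) e)
      monus : ∀ s m → ℤ.+ s ℤ.- ℤ.+ (s ⊓ m) ≡ ℤ.+ (s ∸ m)
      monus s m = trans (ℤ.m-n≡m⊖n s (s ⊓ m)) (trans (ℤ.⊖-≥ (m⊓n≤m s m)) (cong ℤ.+_
        (trans (cong (_∸ (s ⊓ m)) (sym (trans (cong (_+ (s ∸ m)) (⊓-comm s m)) (m⊓n+n∸m≡n m s))))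
          (m+n∸m≡n (s ⊓ m) (s ∸ m)))))
      -- At most one of the two parts of s is nonzero, and its truncation at m is what is taken off.
      abs-remainder : ∀ s m → ℤ.∣ s ℤ.- (ℤ.+ (posPart s ⊓ m) ℤ.- ℤ.+ (negPart s ⊓ m)) ∣ ≡ ℤ.∣ s ∣ ∸ m
      abs-remainder (ℤ.+ s)    m = cong ℤ.∣_∣ (trans (cong (λ z → ℤ.+ s ℤ.- z) (ℤ.+-identityʳ (ℤ.+ (s ⊓ m)))) (monus s m))
      abs-remainder ℤ.-[1+ s ] m = trans (cong ℤ.∣_∣ (negate (ℤ.+ suc s) (ℤ.+ (suc s ⊓ m))))
        (trans (ℤ.∣-i∣≡∣i∣ (ℤ.+ suc s ℤ.- ℤ.+ (suc s ⊓ m)))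
        (cong ℤ.∣_∣ (monus (suc s) m)))
        where
        negate : ∀ s k → ℤ.- s ℤ.- (0ℤ ℤ.- k) ≡ ℤ.- (s ℤ.- k)
        negate = solve-∀
      bound : ∀ a → ℤ.∣ coeff S a ℤ.- (coeff (𝕊 P.clip) a ℤ.- coeff (𝕊 N.clip) a) ∣ * factorials a ≤ b * degree a !
      bound a = begin
        ℤ.∣ coeff S a ℤ.- (coeff (𝕊 P.clip) a ℤ.- coeff (𝕊 N.clip) a) ∣ * Π
          ≡⟨ cong (_* Π) (trans (cong ℤ.∣_∣ (remainder a)) (abs-remainder (coeff S a) M)) ⟩
        (ℤ.∣ coeff S a ∣ ∸ M) * Π
          ≡⟨ *-distribʳ-∸ Π ℤ.∣ coeff S a ∣ M ⟩
        ℤ.∣ coeff S a ∣ * Π ∸ M * Π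
          ≡⟨ cong (ℤ.∣ coeff S a ∣ * Π ∸_) (arrangements-length a) ⟩
        ℤ.∣ coeff S a ∣ * Π ∸ degree a !
          ≤⟨ ∸-monoˡ-≤ (degree a !) (q a) ⟩
        degree a ! + b * degree a ! ∸ degree a !
          ≡⟨ m+n∸m≡n (degree a !) (b * degree a !) ⟩
        b * degree a ! ∎
        where
        open ≤-Reasoning
        Π = factorials a
        M = length (arrangements a)

    -- Adding a multiple of t₀ − 1 moves the constant term to the coefficient of t₀.

    𝔍-zeros : ∀ S → 𝔍 S → ∃₂ λ X Y → X ≈ Y × (∀ F → Big F → Φ S F ≡ δ X Y F)
    𝔍-zeros S s = let X , Y , (bX , bY) , j , v = realized in X , Y
      , Equivalence.from (represents X Y (𝕊-∈ℛ X bX) (𝕊-∈ℛ Y bY))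
          (𝔍-resp {((𝕊 X -ˢ 𝕊 Y) -ˢ S′) +ˢ S′} {𝕊 X -ˢ 𝕊 Y}
            (λ a → cancel (coeff (𝕊 X) a ℤ.- coeff (𝕊 Y) a) (coeff S′ a)) (𝔍-+ {(𝕊 X -ˢ 𝕊 Y) -ˢ S′} {S′} j s′))
      , λ F b → trans (sym (value-S′ F b)) (v F)
      where
      c = coeff S (exponentOf [])
      D = t 0 -ˢ 1ˢ
      S′ = S +ˢ scale c D
      D-∈ℛ : D ∈ℛ
      D-∈ℛ = ∈ℛ-- {t 0} {1ˢ} (t-∈ℛ 0) 1ˢ-∈ℛ
      s′ : 𝔍 S′
      s′ = 𝔍-+ {S} {scale c D} s (𝔍-resp {scale c 1ˢ *ˢ D} {scale c D} (constant-* c D)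
        (𝔍-* {scale c 1ˢ} {D} (∈ℛ-scale c {1ˢ} 1ˢ-∈ℛ) (⊇𝔍₀ (generator 0))
             (∈ℛ-resp {scale c D} {scale c 1ˢ *ˢ D} (sym ∘ constant-* c D) (∈ℛ-scale c {D} D-∈ℛ))))
      cancel : ∀ x s → (x ℤ.- s) ℤ.+ s ≡ x
      cancel = solve-∀
      D-constant : coeff D (exponentOf []) ≡ ℤ.-1ℤ
      D-constant = refl
      constant : coeff S′ (exponentOf []) ≡ 0ℤ
      constant = trans (cong (λ z → c ℤ.+ c ℤ.* z) D-constant) (kill c)
        where
        kill : ∀ c → c ℤ.+ c ℤ.* ℤ.-1ℤ ≡ 0ℤ
        kill = solve-∀
      realized : Realization S′
      realized = let r = ⊆ℛ s′ ; d , p = _∈ℛ.boundedDegrees r ; b , q = _∈ℛ.boundedCoeffs r in realize b d S′ constant p q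
      -- t₀ - 1 vanishes at x_F when F contains 0, so the correction leaves values on big sets
      -- unchanged.
      value-S′ : ∀ F → Big F → Φ S′ F ≡ Φ S F
      value-S′ F (big i _) = trans (value-+ S (scale c D) (𝐱 F)) (trans (cong (λ z → Φ S F ℤ.+ z)
        (trans (value-scale c D (𝐱 F)) (trans (cong (c ℤ.*_) value-D) (ℤ.*-zeroʳ c)))) (ℤ.+-identityʳ _))
        where
        value-D : Φ D F ≡ 0ℤ
        value-D = trans (value-- (t 0) 1ˢ (𝐱 F)) (cong₂ ℤ._-_
          (trans (sym (value-cong {𝕊 ｛ 0 ｝} {t 0} (𝐱 F) (𝕊-｛｝ 0))) (trans (Φ-𝕊 ｛ 0 ｝ F) (cong ℤ.+_ (φ-｛｝-∈ {0} {F} i))))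
          (value-1ˢ (𝐱 F)))

    -- On big sets S vanishes wherever the counts of two equinumerous sets agree. This happens
    -- almost everywhere, so the set of zeros meets every initial set.
    suitableForIdeal : SuitableForIdeal 𝐱 𝔍
    suitableForIdeal S s k = vanishing (𝔍-zeros S s)
      where
      open Numerosity em _≈_ nat 𝒰 𝒰-isUltrafilter ≈⇔𝒰
      open Ultra em 𝒰 𝒰-isUltrafilter
      Zero : FinSet → Set
      Zero F = F ∈ˢ Initial 𝐱 k × value S (𝐱 F) ≡ 0ℤ
      zero-at : ∀ X Y → (∀ F → Big F → Φ S F ≡ δ X Y F) →
                ∀ F → F ∈ˢ Initial 𝐱 k × Big F → φ X F ≡ φ Y F → Zero F
      zero-at X Y v F (i , b) e = i , trans (v F b) (ℤ.i≡j⇒i-j≡0 {ℤ.+ φ X F} {ℤ.+ φ Y F} (cong ℤ.+_ e))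
      AE-initial : AE (λ F → F ∈ˢ Initial 𝐱 k × Big F)
      AE-initial = AE-∩ (AE-intro {λ F → F ∈ˢ Initial 𝐱 k} {Initial 𝐱 k} (λ _ i → i) (suitable k)) AE-big
      vanishing : (∃₂ λ X Y → X ≈ Y × (∀ F → Big F → Φ S F ≡ δ X Y F)) → ∃[ F ] Zero F
      vanishing (X , Y , p , v) = AE-witness (AE-map₂ {R = Zero} (zero-at X Y v) AE-initial (≈⇒AE {X} {Y} p))

theorem2p5 : ExcludedMiddle 0ℓ →
    ( ∀ (_≈_ : Rel 𝕎 0ℓ) (𝔍 : Pred Series 0ℓ) →
    IsNaturalEquinumerosity _≈_ → IsGaugeIdeal 𝔍 → Represents 𝔍 _≈_ →
    IsCountingSet 𝐱 × SuitableForIdeal 𝐱 𝔍 ×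
    ( Σ[ 𝒰 ∈ Pred (Subset FinSet) 0ℓ ]
    ( ( IsGaugeUltrafilter 𝒰 × SuitableUltrafilter 𝐱 𝒰 ×
    (∀ X Y → X ≈ Y ⇔ 𝒰 (Agree X Y)) ) ×
    ( ∀ (𝒱 : Pred (Subset FinSet) 0ℓ) →
    IsGaugeUltrafilter 𝒱 → SuitableUltrafilter 𝐱 𝒱 →
    (∀ X Y → X ≈ Y ⇔ 𝒱 (Agree X Y)) →
    ∀ A → 𝒰 A ⇔ 𝒱 A ) ×
    ΦInducesIsomorphism 𝒰 _≈_ ) ) ) ×
    ( ∀ (𝒰 : Pred (Subset FinSet) 0ℓ) → IsUltrafilter 𝒰 →
    IsNaturalEquinumerosity (λ X Y → 𝒰 (Agree X Y)) ⇔ IsGaugeUltrafilter 𝒰 )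
theorem2p5 em =
  (λ _≈_ 𝔍 nat gauge represents →
    let open Natural em _≈_ nat using (𝒰; 𝒰-isUltrafilter; ≈⇔𝒰)
        open Numerosity em _≈_ nat 𝒰 𝒰-isUltrafilter ≈⇔𝒰
    in countingSet , suitableForIdeal em _≈_ 𝔍 nat gauge represents ,
       𝒰 , (isGauge , suitable , ≈⇔𝒰) ,
       (λ 𝒱 gauge𝒱 _ ≈⇔𝒱 A → 𝒰-unique em _≈_ nat 𝒰-isUltrafilter ≈⇔𝒰 (IsGaugeUltrafilter.isUltrafilter gauge𝒱) ≈⇔𝒱 A) ,
       isomorphism) ,
  -- The relation is defined by agreement on 𝒰, so the equivalence required by `Numerosity` is the
  -- identity.
  (λ 𝒰 uf → mk⇔ (λ nat → Numerosity.isGauge em (λ X Y → 𝒰 (Agree X Y)) nat 𝒰 uf (λ _ _ → mk⇔ id id))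
                (Ultra.gauge⇒natural em 𝒰 uf))
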